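{- Let $k \geq 5$ be an integer and let $G$ be a finite simple connected $k$-regular graph of order $n$. Then $D'(G) \leq 2$.
   Context: A graph is $k$-regular if every vertex has degree $k$; the order of a graph is its number of vertices. The distinguishing index $D'(G)$ of a graph $G$ is the least number $d$ such that $G$ has an edge labeling with $d$ labels (an arbitrary map from $E(G)$ to a set of $d$ labels, not necessarily a proper edge colouring) that is preserved only by the identity automorphism of $G$. An automorphism $\varphi$ of $G$ preserves an edge labeling $c$ if $c(\varphi(u)\varphi(w)) = c(uw)$ for every edge $uw\in E(G)$. -}

module Defs where

open import Data.Bool.Base using (Bool; T)
open import Data.Fin.Base using (Fin)
open import Data.Fin.Permutation using (Permutation′; _⟨$⟩ʳ_; id; _≈_)
open import Data.Fin.Subset using (Subset; ∣_∣)
open import Data.Nat.Base using (ℕ; _≤_)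
open import Data.Product.Base using (_×_; Σ-syntax)
open import Data.Vec.Base using (tabulate)
open import Function.Bundles using (_⇔_; Equivalence)
open import Relation.Binary.Construct.Closure.ReflexiveTransitive using (Star)
open import Relation.Binary.Definitions using (Symmetric; Irreflexive)
open import Relation.Binary.PropositionalEquality.Core using (_≡_)

-- A finite simple graph of order n.  Adjacency is Boolean-valued, so that it is
-- decidable and Adj u w has at most one inhabitant.
record Graph (n : ℕ) : Set where
  field
    adj : Fin n → Fin n → Bool

  Adj : Fin n → Fin n → Set
  Adj u w = T (adj u w)

  field
    symmetric   : Symmetric Adj
    irreflexive : Irreflexive _≡_ Adj

  neighbours : Fin n → Subset n
  neighbours v = tabulate (adj v)

  degree : Fin n → ℕ
  degree v = ∣ neighbours v ∣

module _ {n : ℕ} (G : Graph n) where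
  open Graph G

  Regular : ℕ → Set
  Regular k = ∀ v → degree v ≡ k

  -- The first component excludes the graph with no vertices; elements of
  -- Star Adj u w are the walks from u to w.
  Connected : Set
  Connected = Fin n × (∀ u w → Star Adj u w)

  record Automorphism : Set where
    field
      perm      : Permutation′ n
      preserves : ∀ {u w} → Adj u w ⇔ Adj (perm ⟨$⟩ʳ u) (perm ⟨$⟩ʳ w)

    onEdge : ∀ {u w} → Adj u w → Adj (perm ⟨$⟩ʳ u) (perm ⟨$⟩ʳ w)
    onEdge = Equivalence.to preserves

  -- A map from the set of (unordered) edges to d labels, given as a map on
  -- oriented edges that takes the same value on both orientations.  Only edges
  -- receive labels: with d = 0 such a map exists exactly when G has no edges.
  record EdgeLabelling (d : ℕ) : Set where
    field
      label     : ∀ {u w} → Adj u w → Fin d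
      label-sym : ∀ {u w} (e : Adj u w) (e′ : Adj w u) → label e ≡ label e′

  PreservedBy : ∀ {d} → EdgeLabelling d → Automorphism → Set
  PreservedBy c φ = ∀ {u w} (e : Adj u w) → label (onEdge e) ≡ label e
    where
    open EdgeLabelling c
    open Automorphism φ

  Distinguishing : ∀ {d} → EdgeLabelling d → Set
  Distinguishing c = ∀ φ → PreservedBy c φ → Automorphism.perm φ ≈ id

  HasDistinguishingLabelling : ℕ → Set
  HasDistinguishingLabelling d = Σ[ c ∈ EdgeLabelling d ] Distinguishing c

  -- D′(G) = d, i.e. d is the least number of labels of a distinguishing edge
  -- labelling.  This is a relation because some graphs (e.g. K₂) have no
  -- distinguishing edge labelling at all.
  IsDistinguishingIndex : ℕ → Set
  IsDistinguishingIndex d =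
    HasDistinguishingLabelling d × (∀ d′ → HasDistinguishingLabelling d′ → d ≤ d′)

{-# OPTIONS --safe #-}
module Submission where

-- Colour the edges red (false) and blue (true).  A vertex r with red edges only and a
-- neighbour s of r with exactly one blue edge st are fixed by every colour-preserving
-- automorphism, provided that every other vertex has a blue edge and every other neighbour
-- of r has two.  Below t the graph is explored depth first.  When x is reached from its
-- parent v, the edge vx gets one colour, and the edges from v to the other unexplored
-- vertices of the same class (same explored neighbours as x) get the other one; this fixes x.
-- Isomorphic branches below a vertex are told apart by their numbers of blue edges, so every
-- branch has to admit many such numbers.  What guarantees them is the number of edges at a
-- vertex whose colour is not yet decided, compared with the size p of its class: a step in
-- the class decides one edge at each of its vertices but also lowers p by one, and as long
-- as p ≥ 3 the two choices for the colour of vx give one additional number.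
-- Suitable r, s, t exist unless the graph is complete or complete bipartite, where a blue
-- Hamiltonian path with one chord does the job.

open import Defs
open import Algebra.Properties.CommutativeMonoid.Sum using (sum; sum-cong-≗; ∑-distrib-+; sum-permute; ∑-comm)
open import Data.Bool.Base using (Bool; true; false; _∧_; _∨_; not; if_then_else_; T)
open import Data.Bool.Properties using (∧-comm; ∨-comm; ∧-zeroʳ; T-≡) renaming (_≟_ to _≟B_)
open import Data.Empty using (⊥; ⊥-elim)
open import Data.Fin.Base using (Fin; zero; suc; toℕ; fromℕ<)
open import Data.Fin.Permutation using (Permutation′; permutation; _⟨$⟩ʳ_; _⟨$⟩ˡ_; inverseˡ; inverseʳ; flip)
open import Data.Fin.Properties using (any?; all?; toℕ-injective; toℕ-fromℕ<; toℕ<n) renaming (_≟_ to _≟F_; suc-injective to Fsuc-injective)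
open import Data.Fin.Subset using (∣_∣)
open import Data.List.Base using (List; []; _∷_; length; map; filter; take; upTo)
open import Data.List.Membership.Propositional using (_∈_; _∉_)
open import Data.List.Membership.Propositional.Properties using (∈-filter⁻; ∈-upTo⁻)
open import Data.List.Properties using (length-map; length-upTo; filter-accept; filter-reject)
open import Data.List.Relation.Unary.All as All using (All; []; _∷_)
import Data.List.Relation.Unary.All.Properties as Allₚ
open import Data.List.Relation.Unary.AllPairs using ([]; _∷_)
open import Data.List.Relation.Unary.Any using (here; there)
open import Data.List.Relation.Unary.Unique.Propositional using (Unique)
import Data.List.Relation.Unary.Unique.Propositional.Properties as Uniqueₚ
open import Data.Nat.Base using (ℕ; zero; suc; _+_; _*_; _∸_; _≤_; _<_; _≥_; z≤n; s≤s; _⊓_; _⊔_; >-nonZero)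
open import Data.Nat.Properties
open import Data.Product.Base using (_×_; _,_; proj₁; proj₂; ∃-syntax; Σ-syntax)
open import Data.Sum.Base using (_⊎_; inj₁; inj₂)
open import Data.Vec.Base using (Vec; []; _∷_; lookup; tabulate)
open import Data.Vec.Functional using () renaming (_∷_ to _◂_)
open import Data.Vec.Properties using (lookup∘tabulate)
open import Function.Base using (_∘_)
open import Function.Bundles using (Equivalence; mk⇔)
open import Relation.Binary.Construct.Closure.ReflexiveTransitive using (Star; ε; _◅_)
open import Relation.Binary.PropositionalEquality
open import Relation.Nullary using (¬_; Dec; yes; no; does; contradiction; ¬?)
open import Relation.Nullary.Decidable using (_⊎-dec_; _×-dec_; map′)

-- An automorphism fixing the explored vertices permutes the branches below a vertex x and preserves
-- the classes. So interchangeable branches have equally many vertices in each class: if q of them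
-- hold p′ vertices of the class of z each, then q * p′ ≤ p. A vertex z with more than p undecided
-- edges therefore has room for the q numbers that separate the branches, and for one more that lets
-- their sums vary. A vertex without explored neighbours escapes this count, but all its k edges are
-- undecided, while x has at most k - 1 branches; only k - 1 similar branches are critical. The hard
-- vertices are the neighbours of r. Their edge to r is spent, and since they owe a second blue
-- edge, steps in their classes gain nothing. Most conditions on r, s, t serve to keep these classes
-- small; the remaining one, that the graph stays connected without r and s, lets the search from t
-- reach every vertex. To find r, one grows a connected set as long as it leaves some vertex
-- undominated, and takes r undominated: deleting r does no harm to the grown set.

private
  variable
    n : ℕ

-- Booleans, finite sums and counting

∧-true : ∀ {a b} → a ≡ true → b ≡ true → a ∧ b ≡ true
∧-true refl refl = refl

∧-true₁ : ∀ {a b} → a ∧ b ≡ true → a ≡ true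
∧-true₁ {true} _ = refl

∧-true₂ : ∀ {a b} → a ∧ b ≡ true → b ≡ true
∧-true₂ {true} e = e

∨-true₁ : ∀ {a b} → a ≡ true → a ∨ b ≡ true
∨-true₁ refl = refl

∨-true₂ : ∀ {a b} → b ≡ true → a ∨ b ≡ true
∨-true₂ {true} _ = refl
∨-true₂ {false} e = e

∨-cases : ∀ {a b} → a ∨ b ≡ true → a ≡ true ⊎ b ≡ true
∨-cases {true} _ = inj₁ refl
∨-cases {false} e = inj₂ e

true⊎false : ∀ b → b ≡ true ⊎ b ≡ false
true⊎false true = inj₁ refl
true⊎false false = inj₂ refl

true≢false : ∀ {b} → b ≡ true → b ≡ false → ⊥
true≢false refl ()

¬true⇒false : ∀ {b} → (b ≡ true → ⊥) → b ≡ false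
¬true⇒false {true} h = ⊥-elim (h refl)
¬true⇒false {false} _ = refl

not-true : ∀ {b} → b ≡ false → not b ≡ true
not-true refl = refl

true-not : ∀ {b} → not b ≡ true → b ≡ false
true-not {false} _ = refl

bool-ext : ∀ {a b} → (a ≡ true → b ≡ true) → (b ≡ true → a ≡ true) → a ≡ b
bool-ext {true} f g = sym (f refl)
bool-ext {false} {true} f g = g refl
bool-ext {false} {false} f g = refl

opaque
  _==_ : Fin n → Fin n → Bool
  i == j = does (i ≟F j)

  ==-sound : {i j : Fin n} → (i == j) ≡ true → i ≡ j
  ==-sound {i = i} {j} e with yes p ← i ≟F j = p

  ==-refl : (i : Fin n) → (i == i) ≡ true
  ==-refl i with i ≟F i
  ... | yes _ = refl
  ... | no h = ⊥-elim (h refl)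

==-complete : {i j : Fin n} → i ≡ j → (i == j) ≡ true
==-complete refl = ==-refl _

==-≢ : {i j : Fin n} → i ≢ j → (i == j) ≡ false
==-≢ h = ¬true⇒false (h ∘ ==-sound)

==-false : {i j : Fin n} → (i == j) ≡ false → i ≢ j
==-false e refl = true≢false (==-refl _) e

≢-true : {i j : Fin n} → i ≢ j → not (i == j) ≡ true
≢-true h = not-true (==-≢ h)

true-≢ : {i j : Fin n} → not (i == j) ≡ true → i ≢ j
true-≢ e = ==-false (true-not e)

_⇔ᵇ_ : Bool → Bool → Bool
true ⇔ᵇ b = b
false ⇔ᵇ b = not b

⇔ᵇ-sound : ∀ {a b} → (a ⇔ᵇ b) ≡ true → a ≡ b
⇔ᵇ-sound {true} e = sym e
⇔ᵇ-sound {false} e = sym (true-not e)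

⇔ᵇ-refl : ∀ {a b} → a ≡ b → (a ⇔ᵇ b) ≡ true
⇔ᵇ-refl {true} refl = refl
⇔ᵇ-refl {false} refl = refl

opaque
  Σᶠ : (Fin n → ℕ) → ℕ
  Σᶠ = sum +-0-commutativeMonoid

  Σ-zero : (f : Fin 0 → ℕ) → Σᶠ f ≡ 0
  Σ-zero f = refl

  Σ-suc : (f : Fin (suc n) → ℕ) → Σᶠ f ≡ f zero + Σᶠ (f ∘ suc)
  Σ-suc f = refl

  Σ-cong : {f g : Fin n → ℕ} → (∀ i → f i ≡ g i) → Σᶠ f ≡ Σᶠ g
  Σ-cong = sum-cong-≗ +-0-commutativeMonoid

  Σ-+ : (f g : Fin n → ℕ) → Σᶠ (λ i → f i + g i) ≡ Σᶠ f + Σᶠ g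
  Σ-+ = ∑-distrib-+ +-0-commutativeMonoid

  Σ-permute : (f : Fin n → ℕ) (π : Permutation′ n) → Σᶠ f ≡ Σᶠ (λ i → f (π ⟨$⟩ʳ i))
  Σ-permute = sum-permute +-0-commutativeMonoid

  Σ-swap : ∀ {m} (f : Fin m → Fin n → ℕ) → Σᶠ (λ i → Σᶠ (f i)) ≡ Σᶠ (λ j → Σᶠ (λ i → f i j))
  Σ-swap = ∑-comm +-0-commutativeMonoid

  Σ-mono : {f g : Fin n → ℕ} → (∀ i → f i ≤ g i) → Σᶠ f ≤ Σᶠ g
  Σ-mono {zero} h = z≤n
  Σ-mono {suc n} h = +-mono-≤ (h zero) (Σ-mono (h ∘ suc))

  Σ-mono-< : {f g : Fin n → ℕ} → (∀ i → f i ≤ g i) → ∀ i → f i < g i → Σᶠ f < Σᶠ g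
  Σ-mono-< h zero l = +-mono-<-≤ l (Σ-mono (h ∘ suc))
  Σ-mono-< h (suc i) l = +-mono-≤-< (h zero) (Σ-mono-< (h ∘ suc) i l)

  Σ-const : ∀ n c → Σᶠ {n} (λ _ → c) ≡ n * c
  Σ-const zero c = refl
  Σ-const (suc n) c = cong (c +_) (Σ-const n c)

⟦_⟧ : Bool → ℕ
⟦ true ⟧ = 1
⟦ false ⟧ = 0

⟦⟧-mono : ∀ {a b} → (a ≡ true → b ≡ true) → ⟦ a ⟧ ≤ ⟦ b ⟧
⟦⟧-mono {true} h rewrite h refl = s≤s z≤n
⟦⟧-mono {false} h = z≤n

opaque
  count : (Fin n → Bool) → ℕ
  count f = Σᶠ (λ i → ⟦ f i ⟧)

  count-Σ : (f : Fin n → Bool) → count f ≡ Σᶠ (λ i → ⟦ f i ⟧)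
  count-Σ f = refl

  count-cong : {f g : Fin n → Bool} → (∀ i → f i ≡ g i) → count f ≡ count g
  count-cong h = Σ-cong (λ i → cong ⟦_⟧ (h i))

  count-mono : {f g : Fin n → Bool} → (∀ i → f i ≡ true → g i ≡ true) → count f ≤ count g
  count-mono h = Σ-mono (λ i → ⟦⟧-mono (h i))

  count-mono-< : {f g : Fin n → Bool} → (∀ i → f i ≡ true → g i ≡ true) →
                 ∀ i → f i ≡ false → g i ≡ true → count f < count g
  count-mono-< h i fi gi = Σ-mono-< (λ j → ⟦⟧-mono (h j)) i (lemma fi gi)
    where
    lemma : ∀ {a b} → a ≡ false → b ≡ true → ⟦ a ⟧ < ⟦ b ⟧
    lemma refl refl = s≤s z≤n

  count-none : {f : Fin n → Bool} → (∀ i → f i ≡ false) → count f ≡ 0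
  count-none {n} h = trans (Σ-cong (λ i → cong ⟦_⟧ (h i))) (trans (Σ-const n 0) (*-zeroʳ n))

  count-permute : (f : Fin n → Bool) (π : Permutation′ n) → count f ≡ count (λ i → f (π ⟨$⟩ʳ i))
  count-permute f π = Σ-permute (λ i → ⟦ f i ⟧) π

  count-∨ : (f g : Fin n → Bool) → (∀ i → f i ≡ true → g i ≡ true → ⊥) →
            count (λ i → f i ∨ g i) ≡ count f + count g
  count-∨ f g h = trans (Σ-cong (λ i → lemma (f i) (g i) (h i))) (Σ-+ (λ i → ⟦ f i ⟧) (λ i → ⟦ g i ⟧))
    where
    lemma : ∀ a b → (a ≡ true → b ≡ true → ⊥) → ⟦ a ∨ b ⟧ ≡ ⟦ a ⟧ + ⟦ b ⟧
    lemma true true h = ⊥-elim (h refl refl)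
    lemma true false h = refl
    lemma false b h = refl

⟦⟧-true-* : ∀ {b c} → b ≡ true → ⟦ b ⟧ * c ≡ c
⟦⟧-true-* {c = c} refl = +-identityʳ c

⟦⟧-false-* : ∀ {b c} → b ≡ false → ⟦ b ⟧ * c ≡ 0
⟦⟧-false-* refl = refl

Σ-single : (x : Fin n) (g : Fin n → ℕ) → Σᶠ (λ i → ⟦ i == x ⟧ * g i) ≡ g x
Σ-single {suc n} zero g = trans (Σ-suc _) (trans (cong₂ _+_ (⟦⟧-true-* (==-refl zero))
  (trans (Σ-cong (λ i → ⟦⟧-false-* (==-≢ {i = suc i} {zero} λ ()))) (trans (Σ-const n 0) (*-zeroʳ n))))
  (+-identityʳ (g zero)))
Σ-single {suc n} (suc x) g = trans (Σ-suc _) (cong₂ _+_ (⟦⟧-false-* (==-≢ {i = zero} {suc x} λ ()))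
  (trans (Σ-cong (λ i → cong (λ b → ⟦ b ⟧ * g (suc i)) (==-suc i))) (Σ-single x (g ∘ suc))))
  where
  ==-suc : ∀ i → (suc i == suc x) ≡ (i == x)
  ==-suc i = bool-ext (==-complete ∘ Fsuc-injective ∘ ==-sound) (==-complete ∘ cong suc ∘ ==-sound)

count-pos : {f : Fin n → Bool} → ∀ i → f i ≡ true → 1 ≤ count f
count-pos {n} {f} i fi = subst (_< count f) (count-none {f = λ _ → false} (λ _ → refl))
  (count-mono-< {f = λ _ → false} (λ _ ()) i refl fi)

count-find-diff : (f g : Fin n → Bool) → count f < count g → ∃[ i ] (g i ≡ true × f i ≡ false)
count-find-diff f g h with any? (λ i → (g i ∧ not (f i)) ≟B true)
... | yes (i , p) = i , ∧-true₁ p , true-not (∧-true₂ {g i} p)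
... | no q = contradiction h (≤⇒≯ (count-mono λ i gi → lemma i gi (true⊎false (f i))))
  where
  lemma : ∀ i → g i ≡ true → f i ≡ true ⊎ f i ≡ false → f i ≡ true
  lemma i gi (inj₁ e) = e
  lemma i gi (inj₂ e) = ⊥-elim (q (i , ∧-true gi (not-true e)))

count-find : (f : Fin n → Bool) → 1 ≤ count f → ∃[ i ] f i ≡ true
count-find f h with i , p , _ ← count-find-diff (λ _ → false) f (subst (_< count f) (sym (count-none (λ _ → refl))) h) = i , p

count-single : (x : Fin n) → count (λ i → i == x) ≡ 1
count-single x = trans (count-Σ _) (trans (Σ-cong (λ i → sym (*-identityʳ _))) (Σ-single x (λ _ → 1)))

count-remove : (f : Fin n → Bool) (x : Fin n) → f x ≡ true →
               count f ≡ suc (count (λ i → f i ∧ not (i == x)))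
count-remove f x fx = begin
  count f ≡⟨ count-cong split ⟩
  count (λ i → (i == x) ∨ (f i ∧ not (i == x)))
    ≡⟨ count-∨ _ _ (λ i p q → true≢false p (true-not (∧-true₂ {f i} q))) ⟩
  count (λ i → i == x) + count (λ i → f i ∧ not (i == x)) ≡⟨ cong (_+ count (λ i → f i ∧ not (i == x))) (count-single x) ⟩
  suc (count (λ i → f i ∧ not (i == x))) ∎
  where
  open ≡-Reasoning
  split : ∀ i → f i ≡ (i == x) ∨ (f i ∧ not (i == x))
  split i with i == x in e
  ... | true = trans (cong f (==-sound e)) fx
  ... | false with f i
  ... | true = refl
  ... | false = refl

count-two : (f : Fin n → Bool) → ∀ {a b} → f a ≡ true → f b ≡ true → a ≢ b → 2 ≤ count f
count-two f {a} {b} fa fb a≢b = subst (2 ≤_) (sym (count-remove f a fa))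
  (s≤s (count-pos b (∧-true fb (≢-true (a≢b ∘ sym)))))

count-another : (f : Fin n → Bool) (x : Fin n) → 2 ≤ count f → ∃[ y ] (f y ≡ true × y ≢ x)
count-another f x h with true⊎false (f x)
... | inj₂ fx with y , p ← count-find f (≤-trans (s≤s z≤n) h) =
  y , p , λ { refl → true≢false p fx }
... | inj₁ fx with y , p ← count-find (λ i → f i ∧ not (i == x)) (≤-pred (subst (2 ≤_) (count-remove f x fx) h)) =
  y , ∧-true₁ p , true-≢ (∧-true₂ {f y} p)

count-choose : (f : Fin n → Bool) (x : Fin n) → f x ≡ true → ∀ j → suc j ≤ count f →
               Σ[ g ∈ (Fin n → Bool) ] ((∀ i → g i ≡ true → f i ≡ true) × g x ≡ true × count g ≡ suc j)
count-choose f x fx zero h = (λ i → i == x) , (λ i e → subst (λ y → f y ≡ true) (sym (==-sound e)) fx) ,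
  ==-refl x , count-single x
count-choose f x fx (suc j) h with count-choose f x fx j (≤-trans (n≤1+n _) h)
... | g , g⊆f , gx , cg with count-find-diff g f (subst (_< count f) (sym cg) h)
... | y , fy , gy = (λ i → (i == y) ∨ g i) , sub , ∨-true₂ {x == y} gx ,
  trans (count-∨ _ g (λ i p q → true≢false (subst (λ y → g y ≡ true) (==-sound p) q) gy))
        (trans (cong (_+ count g) (count-single y)) (cong suc cg))
  where
  sub : ∀ i → (i == y) ∨ g i ≡ true → f i ≡ true
  sub i e with ∨-cases e
  ... | inj₁ p = subst (λ y → f y ≡ true) (sym (==-sound p)) fy
  ... | inj₂ p = g⊆f i p

-- Distinct sums of selections

_without_ : List ℕ → ℕ → List ℕ
A without x = filter (λ y → ¬? (y ≟ x)) A

without-⊆ : ∀ {A x y} → y ∈ A without x → y ∈ A × y ≢ x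
without-⊆ = ∈-filter⁻ _

without-unique : ∀ {A x} → Unique A → Unique (A without x)
without-unique = Uniqueₚ.filter⁺ _

without-∉ : ∀ A {x} → x ∉ A → length (A without x) ≡ length A
without-∉ [] h = refl
without-∉ (a ∷ A) {x} h with a ≟ x
... | yes refl = ⊥-elim (h (here refl))
... | no a≢x = trans (cong length (filter-accept (λ y → ¬? (y ≟ x)) a≢x)) (cong suc (without-∉ A (h ∘ there)))

without-length : ∀ {A} x → Unique A → length A ≤ suc (length (A without x))
without-length {[]} x u = z≤n
without-length {a ∷ A} x (a∉ ∷ u) with a ≟ x
... | yes refl = s≤s (≤-reflexive (sym (trans (cong length (filter-reject (λ y → ¬? (y ≟ x)) {a} {A} (λ h → h refl)))
  (without-∉ A (λ i → All.lookup a∉ i refl)))))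
... | no a≢x = s≤s (≤-trans (without-length x u) (≤-reflexive (sym (cong length (filter-accept (λ y → ¬? (y ≟ x)) a≢x)))))

pigeonhole-∉ : ∀ {A} (F : List ℕ) → Unique A → length F < length A → ∃[ e ] (e ∈ A × e ∉ F)
pigeonhole-∉ {a ∷ A} [] u l = a , here refl , λ ()
pigeonhole-∉ {A} (x ∷ F) u l
  with e , e∈ , e∉ ← pigeonhole-∉ F (without-unique {x = x} u) (≤-pred (≤-trans l (without-length x u))) =
  e , proj₁ (without-⊆ {A} e∈) , λ { (here p) → proj₂ (without-⊆ {A} e∈) p ; (there p) → e∉ p }

maximal : ∀ A → 1 ≤ length A → ∃[ M ] (M ∈ A × (∀ {y} → y ∈ A → y ≤ M))
maximal (a ∷ []) _ = a , here refl , λ { (here refl) → ≤-refl }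
maximal (a ∷ b ∷ A) _ with maximal (b ∷ A) (s≤s z≤n)
... | M , M∈ , h with ≤-total a M
... | inj₁ a≤M = M , there M∈ , λ { (here refl) → a≤M ; (there i) → h i }
... | inj₂ M≤a = a , here refl , λ { (here refl) → ≤-refl ; (there i) → ≤-trans (h i) M≤a }

minimal : ∀ A → 1 ≤ length A → ∃[ μ ] (μ ∈ A × (∀ {y} → y ∈ A → μ ≤ y))
minimal (a ∷ []) _ = a , here refl , λ { (here refl) → ≤-refl }
minimal (a ∷ b ∷ A) _ with minimal (b ∷ A) (s≤s z≤n)
... | M , M∈ , h with ≤-total a M
... | inj₁ a≤M = a , here refl , λ { (here refl) → ≤-refl ; (there i) → ≤-trans a≤M (h i) }
... | inj₂ M≤a = M , there M∈ , λ { (here refl) → M≤a ; (there i) → h i }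

count-suc : ∀ {m} (f : Fin (suc m) → Bool) → count f ≡ ⟦ f zero ⟧ + count (f ∘ suc)
count-suc f = trans (count-Σ f) (trans (Σ-suc _) (cong (⟦ f zero ⟧ +_) (sym (count-Σ _))))

collect : ∀ {m} → (Fin m → Bool) → (Fin m → ℕ) → List ℕ
collect {zero} f s = []
collect {suc m} f s = if f zero then s zero ∷ collect (f ∘ suc) (s ∘ suc) else collect (f ∘ suc) (s ∘ suc)

collect-length : ∀ {m} (f : Fin m → Bool) s → length (collect f s) ≡ count f
collect-length {zero} f s = sym (trans (count-Σ f) (Σ-zero _))
collect-length {suc m} f s rewrite count-suc f with f zero
... | true = cong suc (collect-length (f ∘ suc) (s ∘ suc))
... | false = collect-length (f ∘ suc) (s ∘ suc)

collect-∈ : ∀ {m} (f : Fin m → Bool) s i → f i ≡ true → s i ∈ collect f s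
collect-∈ f s zero e rewrite e = here refl
collect-∈ f s (suc i) e with f zero
... | true = there (collect-∈ (f ∘ suc) (s ∘ suc) i e)
... | false = collect-∈ (f ∘ suc) (s ∘ suc) i e

∈-take : ∀ {A : List ℕ} k {x} → x ∈ take k A → x ∈ A
∈-take {a ∷ A} (suc k) (here p) = here p
∈-take {a ∷ A} (suc k) (there i) = there (∈-take k i)

take-length : ∀ (A : List ℕ) k → k ≤ length A → length (take k A) ≡ k
take-length A zero _ = refl
take-length (a ∷ A) (suc k) (s≤s h) = cong suc (take-length A k h)

module Selection {m} (A : Fin m → List ℕ) (conf : Fin m → Fin m → Bool) where
  Selects : (Fin m → ℕ) → Set
  Selects s = (∀ i → s i ∈ A i) × (∀ i j → i ≢ j → conf i j ≡ true → s i ≢ s j)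

  SumOfSelection : ℕ → Set
  SumOfSelection t = ∃[ s ] (Selects s × Σᶠ s ≡ t)

open Selection

⟦⟧≤1 : ∀ b → ⟦ b ⟧ ≤ 1
⟦⟧≤1 true = ≤-refl
⟦⟧≤1 false = z≤n

-- The surplus value, beyond those blocked by conflicts, that an item needs in order to deviate once
-- from its largest value; with a single sum (`τ = 0`) there is no deviation.
extra : ℕ → ℕ
extra zero = 0
extra (suc _) = 1

extra≤1 : ∀ τ → extra τ ≤ 1
extra≤1 zero = z≤n
extra≤1 (suc _) = ≤-refl

-- Item 0 takes its largest value M in all but one of the sums; the remaining one
-- pairs the smallest sum of the other items with a value of item 0 below M.
distinct-sums : ∀ {m} τ (A : Fin (suc m) → List ℕ) (conf : Fin (suc m) → Fin (suc m) → Bool) →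
  (∀ i → conf i i ≡ true) → (∀ i j → conf i j ≡ conf j i) →
  (∀ i → Unique (A i)) →
  (∀ i → suc τ ≤ length (A i)) →
  (∀ i → count (conf i) + extra τ ≤ length (A i)) →
  ∃[ S ] (Unique S × length S ≡ suc τ × All (SumOfSelection A conf) S)
distinct-sums {zero} τ A conf cr cs uA lA cA =
  take (suc τ) (A zero) , Uniqueₚ.take⁺ (suc τ) (uA zero) , take-length (A zero) (suc τ) (lA zero) ,
  All.tabulate (λ {t} t∈ → (λ _ → t) ,
    ((λ { zero → ∈-take (suc τ) t∈ }) , λ { zero zero h → ⊥-elim (h refl) }) ,
    trans (Σ-suc _) (trans (cong (t +_) (Σ-zero _)) (+-identityʳ t)))
distinct-sums {suc m} τ A conf cr cs uA lA cA = result τ lA cA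
  where
  top = maximal (A zero) (≤-trans (s≤s z≤n) (lA zero))
  M = proj₁ top
  c : Fin (suc m) → Bool
  c i = conf zero (suc i)
  A′ : Fin (suc m) → List ℕ
  -- An item in conflict with item 0 loses at most one value and exactly one conflict, so its list
  -- stays long enough for the remaining conflicts.
  A′ i = if c i then A (suc i) without M else A (suc i)
  conf′ : Fin (suc m) → Fin (suc m) → Bool
  conf′ i j = conf (suc i) (suc j)

  uA′ : ∀ i → Unique (A′ i)
  uA′ i with c i
  ... | true = without-unique (uA (suc i))
  ... | false = uA (suc i)

  A′⊆ : ∀ i {t} → t ∈ A′ i → t ∈ A (suc i) × (c i ≡ true → M ≢ t)
  A′⊆ i t∈ with c i
  ... | true = proj₁ (without-⊆ {A (suc i)} t∈) , λ _ p → proj₂ (without-⊆ {A (suc i)} t∈) (sym p)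
  ... | false = t∈ , λ ()

  q-suc : ∀ i → count (conf (suc i)) ≡ ⟦ c i ⟧ + count (conf′ i)
  q-suc i = trans (count-suc _) (cong (λ b → ⟦ b ⟧ + count (conf′ i)) (cs (suc i) zero))

  lA′ : ∀ i k → ⟦ c i ⟧ + k ≤ length (A (suc i)) → k ≤ length (A′ i)
  lA′ i k h with c i
  ... | true = ≤-pred (≤-trans h (without-length M (uA (suc i))))
  ... | false = h

  cA′ : ∀ k → (∀ i → count (conf i) + k ≤ length (A i)) → ∀ i → count (conf′ i) + k ≤ length (A′ i)
  cA′ k h i = lA′ i _ (subst (_≤ length (A (suc i))) (trans (cong (_+ k) (q-suc i)) (+-assoc ⟦ c i ⟧ _ k)) (h (suc i)))

  extend : ∀ x {s} → x ∈ A zero → Selects A′ conf′ s → (∀ i → c i ≡ true → x ≢ s i) → Selects A conf (x ◂ s)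
  extend x x∈ (s∈ , sd) x≢ = (λ { zero → x∈ ; (suc i) → proj₁ (A′⊆ i (s∈ i)) }) ,
    λ { zero zero h → ⊥-elim (h refl)
      ; zero (suc j) _ e → x≢ j e
      ; (suc i) zero _ e → x≢ i (trans (cs zero (suc i)) e) ∘ sym
      ; (suc i) (suc j) h e → sd i j (h ∘ cong suc) e }

  Σ-cons : ∀ x (s : Fin (suc m) → ℕ) → Σᶠ (x ◂ s) ≡ x + Σᶠ s
  Σ-cons x s = Σ-suc (x ◂ s)

  withM : ∀ {t} → SumOfSelection A′ conf′ t → SumOfSelection A conf (M + t)
  withM (s , sel , refl) = M ◂ s ,
    extend M (proj₁ (proj₂ top)) sel (λ i e → proj₂ (A′⊆ i (proj₁ sel i)) e) , Σ-cons M s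

  result : ∀ τ → (∀ i → suc τ ≤ length (A i)) → (∀ i → count (conf i) + extra τ ≤ length (A i)) →
           ∃[ S ] (Unique S × length S ≡ suc τ × All (SumOfSelection A conf) S)
  result zero lA cA
    with S , uS , lS , aS ← distinct-sums zero A′ conf′ (cr ∘ suc) (λ i j → cs _ _) uA′
           (λ i → ≤-trans (count-pos i (cr (suc i))) (≤-trans (m≤m+n _ 0) (cA′ 0 cA i))) (cA′ 0 cA) =
    map (M +_) S , Uniqueₚ.map⁺ (+-cancelˡ-≡ M _ _) uS , trans (length-map _ S) lS ,
    Allₚ.map⁺ (All.map withM aS)
  result (suc τ) lA cA
    with S , uS , lS , aS ← distinct-sums τ A′ conf′ (cr ∘ suc) (λ i j → cs _ _) uA′
           (λ i → lA′ i (suc τ) (≤-trans (+-monoˡ-≤ (suc τ) (⟦⟧≤1 (c i))) (lA (suc i))))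
           (λ i → ≤-trans (+-monoʳ-≤ (count (conf′ i)) (extra≤1 τ)) (cA′ 1 cA i))
    with μ , μ∈ , μ≤ ← minimal S (subst (1 ≤_) (sym lS) (s≤s z≤n))
    with s , sel , refl ← All.lookup aS μ∈
    -- Forbidden for item 0 are `M` and the values of the other items in conflict with it. Its
    -- conflict with itself pays for `M`, and `extra` leaves one value free.
    with e , e∈ , e∉ ← pigeonhole-∉ (M ∷ collect c s) (uA zero)
           (subst (_≤ length (A zero)) (trans (+-comm _ 1) (cong suc (trans (count-suc (conf zero))
             (cong₂ _+_ (cong ⟦_⟧ (cr zero)) (sym (collect-length c s)))))) (cA zero)) =
    (e + Σᶠ s) ∷ map (M +_) S ,
    (Allₚ.map⁺ (All.tabulate λ {t} t∈ → <⇒≢ (+-mono-<-≤ e<M (μ≤ t∈))) ∷ Uniqueₚ.map⁺ (+-cancelˡ-≡ M _ _) uS) ,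
    cong suc (trans (length-map _ S) lS) ,
    (e ◂ s , extend e e∈ sel (λ i ci p → e∉ (there (subst (_∈ collect c s) (sym p) (collect-∈ c s i ci)))) , Σ-cons e s)
      ∷ Allₚ.map⁺ (All.map withM aS)
    where
    e<M : e < M
    e<M = ≤∧≢⇒< (proj₂ (proj₂ top) e∈) (λ p → e∉ (here p))

-- Branches and labellings

count-≤⟦⟧ : ∀ {m} (f : Fin m → Bool) b → (∀ i → f i ≡ true → b ≡ true) →
            (∀ i j → f i ≡ true → f j ≡ true → i ≡ j) → count f ≤ ⟦ b ⟧
count-≤⟦⟧ f b h u with any? (λ i → f i ≟B true)
... | no q = subst (_≤ ⟦ b ⟧) (sym (count-none (λ i → ¬true⇒false (λ e → q (i , e))))) z≤n
... | yes (i , fi) rewrite h i fi = subst (count f ≤_) (count-single i) (count-mono (λ j fj → ==-complete (u j i fj fi)))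

Σ⟦⟧-unique : ∀ {m} (f : Fin m → Bool) i → (∀ j → f j ≡ true → j ≡ i) → Σᶠ (λ j → ⟦ f j ⟧) ≡ ⟦ f i ⟧
Σ⟦⟧-unique f i u = trans (sym (count-Σ f)) (lemma (f i) refl)
  where
  lemma : ∀ b → f i ≡ b → count f ≡ ⟦ b ⟧
  lemma true e = trans (count-cong (λ j → bool-ext (λ fj → ==-complete (u j fj)) (λ ji → subst (λ y → f y ≡ true) (sym (==-sound ji)) e))) (count-single i)
  lemma false e = count-none (λ j → ¬true⇒false (λ fj → true≢false fj (trans (cong f (u j fj)) e)))

≡true-dec : ∀ {A : Set} (d : Dec A) → does d ≡ true → A
≡true-dec (yes a) _ = a

dec-≡true : ∀ {A : Set} (d : Dec A) → A → does d ≡ true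
dec-≡true (yes a) _ = refl
dec-≡true (no ¬a) a = ⊥-elim (¬a a)

isZero : ∀ {m} → Fin m → Bool
isZero zero = true
isZero (suc _) = false

record Context (n : ℕ) : Set where
  field
    adj : Fin n → Fin n → Bool
    adj-sym : ∀ a b → adj a b ≡ adj b a
    adj-irrefl : ∀ a → adj a a ≡ false
    k : ℕ
    k≥5 : 5 ≤ k
    regular : ∀ v → count (adj v) ≡ k

  2≤k : 2 ≤ k
  2≤k = ≤-trans (s≤s (s≤s z≤n)) k≥5

module Labellings {n : ℕ} (Γ : Context n) where
  open Context Γ public

  V : Set
  V = Fin n

  adj-≢ : ∀ {a b} → adj a b ≡ true → a ≢ b
  adj-≢ e refl = true≢false e (adj-irrefl _)

  record Aut : Set where
    field
      perm : Permutation′ n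
      adj-perm : ∀ a b → adj (perm ⟨$⟩ʳ a) (perm ⟨$⟩ʳ b) ≡ adj a b
    at : V → V
    at v = perm ⟨$⟩ʳ v
  open Aut public

  Aut-inv : Aut → Aut
  Aut-inv φ = record { perm = flip (perm φ) ; adj-perm = λ a b →
    trans (sym (adj-perm φ _ _)) (cong₂ adj (inverseʳ (perm φ)) (inverseʳ (perm φ))) }

  aut-injective : ∀ (φ : Aut) {a b} → at φ a ≡ at φ b → a ≡ b
  aut-injective φ e = trans (sym (inverseˡ (perm φ))) (trans (cong (perm φ ⟨$⟩ˡ_) e) (inverseˡ (perm φ)))

  Lab : Set
  Lab = V → V → Bool

  opaque
    -- The relation within which an automorphism fixing `P` pointwise can move a vertex
    -- (`cls-fixed`): the parent has to mark `x` against its class only.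
    cls : List V → V → V → Bool
    cls [] y z = true
    cls (w ∷ P) y z = (adj y w ⇔ᵇ adj z w) ∧ cls P y z

    cls-sound : ∀ {P y z w} → cls P y z ≡ true → w ∈ P → adj y w ≡ adj z w
    cls-sound e (here refl) = ⇔ᵇ-sound (∧-true₁ e)
    cls-sound {x ∷ P} {y} {z} e (there i) = cls-sound {P} (∧-true₂ {adj y x ⇔ᵇ adj z x} e) i

    cls-complete : ∀ {P y z} → (∀ w → w ∈ P → adj y w ≡ adj z w) → cls P y z ≡ true
    cls-complete {[]} h = refl
    cls-complete {x ∷ P} h = ∧-true (⇔ᵇ-refl (h x (here refl))) (cls-complete {P} (λ w i → h w (there i)))

  cls-refl : ∀ P y → cls P y y ≡ true
  cls-refl P y = cls-complete (λ _ _ → refl)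

  cls-sym : ∀ {P y z} → cls P y z ≡ true → cls P z y ≡ true
  cls-sym e = cls-complete (λ w i → sym (cls-sound e i))

  cls-trans : ∀ {P y z u} → cls P y z ≡ true → cls P z u ≡ true → cls P y u ≡ true
  cls-trans e f = cls-complete (λ w i → trans (cls-sound e i) (cls-sound f i))

  cls-tail : ∀ {x P y z} → cls (x ∷ P) y z ≡ true → cls P y z ≡ true
  cls-tail e = cls-complete (λ w i → cls-sound e (there i))

  cls-fixed : ∀ (φ : Aut) {P} → (∀ w → w ∈ P → at φ w ≡ w) → ∀ z → cls P (at φ z) z ≡ true
  cls-fixed φ fix z = cls-complete (λ w i → trans (cong (adj (at φ z)) (sym (fix w i))) (adj-perm φ z w))

  classSize : (V → Bool) → List V → V → ℕ
  classSize K P z = count (λ y → K y ∧ cls P z y)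

  classSize-pos : ∀ {K P z} → K z ≡ true → 1 ≤ classSize K P z
  classSize-pos {K} {P} {z} Kz = count-pos z (∧-true Kz (cls-refl P z))

  active : Lab → V → ℕ
  active act z = count (act z)

  -- Sums over ordered pairs, so every edge is counted twice.
  blue : (V → Bool) → Lab → Lab → ℕ
  blue K act lam = Σᶠ (λ a → Σᶠ (λ b → ⟦ ((K a ∨ K b) ∧ act a b) ∧ lam a b ⟧))

  Preserves : Aut → (V → Bool) → Lab → Lab → Set
  Preserves φ K act lam = ∀ a b → K a ∨ K b ≡ true → act a b ≡ true → lam (at φ a) (at φ b) ≡ lam a b

  -- K is an unexplored branch and P the list of explored vertices above it.
  Rigid : (V → Bool) → List V → Lab → Lab → Set
  Rigid K P act lam = ∀ (φ : Aut) → (∀ w → w ∈ P → at φ w ≡ w) → (∀ z → K (at φ z) ≡ K z) →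
    Preserves φ K act lam → ∀ z → K z ≡ true → at φ z ≡ z

  module Rooted (r s t : V) (adj-rs : adj r s ≡ true) where

    special : V → Bool
    special z = adj r z

    Blue₁ Blue₂ : (V → Bool) → Lab → Lab → Set
    Blue₁ K act lam = ∀ z → K z ≡ true → ∃[ w ] (act z w ≡ true × lam z w ≡ true)
    Blue₂ K act lam = ∀ z → K z ≡ true → special z ≡ true →
      ∃[ w ] ∃[ w′ ] (w ≢ w′ × (act z w ≡ true × lam z w ≡ true) × (act z w′ ≡ true × lam z w′ ≡ true))

    -- v is the parent of the branch K.  The value c = false stands for the exceptional case in
    -- which v has a single edge into K and this edge is red.
    record Good (K : V → Bool) (P : List V) (act : Lab) (v : V) (c : Bool) (lam : Lab) : Set where
      field
        lam-sym : ∀ a b → lam a b ≡ lam b a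
        rigid : Rigid K P act lam
        blue₁ : Blue₁ K act lam
        blue₂ : Blue₂ K act lam
        into : c ≡ true → ∃[ z ] (K z ≡ true × act z v ≡ true × lam z v ≡ true)
        none : c ≡ false → ∀ z → K z ≡ true → act z v ≡ true → lam z v ≡ false

    -- act consists of the edges whose colour is not yet decided.  The cap k ∸ 2 in bound₂ is only
    -- exceeded by the full class of all k ∸ 1 neighbours of r other than s.
    record Inv (K : V → Bool) (P : List V) (act : Lab) : Set where
      field
        outside : ∀ {w} → w ∈ P → K w ≡ false
        closed : ∀ z w → K z ≡ true → adj z w ≡ true → K w ≡ true ⊎ w ∈ P
        act-sym : ∀ a b → act a b ≡ act b a
        act-adj : ∀ a b → act a b ≡ true → adj a b ≡ true
        act-in : ∀ a b → K a ≡ true → K b ≡ true → adj a b ≡ true → act a b ≡ true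
        act-cls : ∀ y z w → K y ≡ true → K z ≡ true → cls P y z ≡ true → w ∈ P → act y w ≡ act z w
        r∈P : r ∈ P
        s∈P : s ∈ P
        t∈P : t ∈ P
        act-r : ∀ z → K z ≡ true → act z r ≡ false
        bound₁ : ∀ z w → K z ≡ true → special z ≡ false → w ∈ P → adj z w ≡ true → classSize K P z < active act z
        bound₂ : ∀ z → K z ≡ true → special z ≡ true → classSize K P z ⊓ (k ∸ 2) < active act z
        cap : ∀ z w → K z ≡ true → special z ≡ true → w ∈ P → act z w ≡ true → classSize K P z ≤ k ∸ 2

    -- Enough undecided edges for N different numbers of blue edges.  Special vertices need a
    -- second blue edge, so steps in their classes do not contribute further numbers.
    Pot : ℕ → (V → Bool) → List V → Lab → Set
    Pot N K P act = ∀ z → K z ≡ true →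
      (special z ≡ false → N ≤ active act z × (2 ≤ classSize K P z → suc N ≤ active act z)) ×
      (special z ≡ true → N + classSize K P z ⊓ (k ∸ 2) ≤ active act z)

    Family : (V → Bool) → Lab → (Lab → Set) → ℕ → Set
    Family K act P N = ∃[ S ] (Unique S × length S ≡ N × All (λ b → ∃[ lam ] (P lam × blue K act lam ≡ b)) S)

    -- The search tree is built before any colour is decided, hence the quantification over all ways
    -- of entering the branch. The last premise restricts the red entry `c = false` to roots that
    -- find a blue edge below them and do not need a second one.
    Solvable : (V → Bool) → V → Bool → Set
    Solvable K x leaf = ∀ P v act c N → 1 ≤ N → Inv K P act → v ∈ P → v ≢ s → v ≢ r → adj x v ≡ true →
      (∀ z → K z ≡ true → adj z v ≡ true → act z v ≡ true) →
      Pot N K P act →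
      (c ≡ false → leaf ≡ false × special x ≡ false × (∀ z → K z ≡ true → adj z v ≡ true → z ≡ x)) →
      Family K act (Good K P act v c) N

    classSize-mono : ∀ {K K′ P} → (∀ z → K z ≡ true → K′ z ≡ true) → ∀ z → classSize K P z ≤ classSize K′ P z
    classSize-mono {K} h z = count-mono (λ y e → ∧-true (h y (∧-true₁ e)) (∧-true₂ {K y} e))

    -- Since `r` is explored, the whole class consists of neighbours of `r`, and `s` is not among
    -- them.
    special-classSize : ∀ {K P act} → Inv K P act → ∀ z → special z ≡ true → classSize K P z ≤ k ∸ 1
    special-classSize {K} {P} inv z sz = ∸-monoˡ-≤ 1 (subst (suc (classSize K P z) ≤_) (regular r)
      (count-mono-< (λ y e → trans (adj-sym r y) (trans (sym (cls-sound (∧-true₂ {K y} e) r∈P)) (trans (adj-sym z r) sz)))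
        s (¬true⇒false (λ e → true≢false (∧-true₁ e) (outside s∈P))) adj-rs))
      where open Inv inv

    special-active : ∀ {K P act} → Inv K P act → ∀ z → K z ≡ true → special z ≡ true → active act z ≤ k ∸ 1
    special-active {act = act} inv z Kz sz = ∸-monoˡ-≤ 1 (subst (suc (active act z) ≤_) (regular z)
      (count-mono-< (λ y → act-adj z y) r (act-r z Kz) (trans (adj-sym z r) sz)))
      where open Inv inv

    untouched-active : ∀ {K P act} → Inv K P act → ∀ z → K z ≡ true →
      (∀ w → w ∈ P → adj z w ≡ false) → active act z ≡ k
    untouched-active inv z Kz h = trans (count-cong (λ w → bool-ext (act-adj z w) (λ e → lemma w e (closed z w Kz e)))) (regular z)
      where
      open Inv inv
      lemma : ∀ w → adj z w ≡ true → _ ⊎ _ → _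
      lemma w e (inj₁ Kw) = act-in z w Kz Kw e
      lemma w e (inj₂ w∈) = ⊥-elim (true≢false e (h w w∈))

    touched? : ∀ P z → (∃[ w ] (w ∈ P × adj z w ≡ true)) ⊎ (∀ w → w ∈ P → adj z w ≡ false)
    touched? [] z = inj₂ λ _ ()
    touched? (x ∷ P) z with true⊎false (adj z x) | touched? P z
    ... | inj₁ e | _ = inj₁ (x , here refl , e)
    ... | inj₂ e | inj₁ (w , i , f) = inj₁ (w , there i , f)
    ... | inj₂ e | inj₂ h = inj₂ λ { w (here refl) → e ; w (there i) → h w i }

    Inv-sub : ∀ {K K′ P act} → Inv K P act → (∀ z → K′ z ≡ true → K z ≡ true) →
      (∀ z w → K′ z ≡ true → adj z w ≡ true → K′ w ≡ true ⊎ w ∈ P) → Inv K′ P act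
    Inv-sub {K} {K′} {P} inv sub cl = record
      { outside = λ i → ¬true⇒false (λ e → true≢false (sub _ e) (outside i))
      ; closed = cl ; act-sym = act-sym ; act-adj = act-adj
      ; act-in = λ a b Ka Kb → act-in a b (sub a Ka) (sub b Kb)
      ; act-cls = λ y z w Ky Kz → act-cls y z w (sub y Ky) (sub z Kz)
      ; r∈P = r∈P ; s∈P = s∈P ; t∈P = t∈P
      ; act-r = λ z Kz → act-r z (sub z Kz)
      ; bound₁ = λ z w Kz sz i e → ≤-trans (s≤s (classSize-mono {K′} {K} {P} sub z)) (bound₁ z w (sub z Kz) sz i e)
      ; bound₂ = λ z Kz sz → ≤-trans (s≤s (⊓-monoˡ-≤ (k ∸ 2) (classSize-mono {K′} {K} {P} sub z))) (bound₂ z (sub z Kz) sz)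
      ; cap = λ z w Kz sz i e → ≤-trans (classSize-mono {K′} {K} {P} sub z) (cap z w (sub z Kz) sz i e) }
      where open Inv inv

    module _ {K P act} (inv : Inv K P act) (φ : Aut) (fix : ∀ w → w ∈ P → at φ w ≡ w)
             (Kφ : ∀ z → K (at φ z) ≡ K z) where
      open Inv inv

      private
        half : ∀ a b → K a ≡ true → act (at φ a) (at φ b) ≡ act a b
        half a b Ka with true⊎false (adj a b)
        ... | inj₂ e = trans (off (trans (adj-perm φ a b) e)) (sym (off e))
          where
          off : ∀ {a b} → adj a b ≡ false → act a b ≡ false
          off e = ¬true⇒false (λ h → true≢false (act-adj _ _ h) e)
        ... | inj₁ e with closed a b Ka e
        ... | inj₁ Kb = trans (act-in _ _ (trans (Kφ a) Ka) (trans (Kφ b) Kb) (trans (adj-perm φ a b) e)) (sym (act-in a b Ka Kb e))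
        ... | inj₂ b∈ = trans (cong (act (at φ a)) (fix b b∈)) (act-cls _ a b (trans (Kφ a) Ka) Ka (cls-fixed φ fix a) b∈)

      -- Inside `K` every edge is undecided. Towards `P`, which is fixed, `act` is constant on
      -- classes by `act-cls`, and `φ` moves vertices only within classes.
      act-invariant : ∀ a b → K a ∨ K b ≡ true → act (at φ a) (at φ b) ≡ act a b
      act-invariant a b e with ∨-cases e
      ... | inj₁ Ka = half a b Ka
      ... | inj₂ Kb = trans (act-sym _ _) (trans (half b a Kb) (act-sym b a))

    -- The invariant alone pays for one number, whatever was demanded before.
    pot-one : ∀ {K P act} → Inv K P act → Pot 1 K P act
    pot-one {K} {P} {act} inv z Kz = ordinary , bound₂ z Kz
      where
      open Inv inv
      ordinary : special z ≡ false → 1 ≤ active act z × (2 ≤ classSize K P z → 2 ≤ active act z)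
      ordinary sz with touched? P z
      ... | inj₁ (w , w∈ , e) = ≤-trans (s≤s z≤n) (bound₁ z w Kz sz w∈ e) , λ h → ≤-trans (≤-trans h (n≤1+n _)) (bound₁ z w Kz sz w∈ e)
      ... | inj₂ h rewrite untouched-active inv z Kz h = ≤-trans (s≤s z≤n) k≥5 , λ _ → 2≤k

-- Forests of branches

Σ-*ʳ : ∀ {m} (f : Fin m → ℕ) c → Σᶠ (λ i → f i * c) ≡ Σᶠ f * c
Σ-*ʳ {zero} f c = trans (Σ-zero _) (cong (_* c) (sym (Σ-zero f)))
Σ-*ʳ {suc m} f c = trans (Σ-suc _) (trans (cong (f zero * c +_) (Σ-*ʳ (f ∘ suc) c))
  (trans (sym (*-distribʳ-+ c (f zero) _)) (cong (_* c) (sym (Σ-suc f)))))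

sum≤1+product : ∀ q p → 1 ≤ q → 1 ≤ p → q + p ≤ suc (q * p)
sum≤1+product (suc q) (suc p) _ _ = s≤s (≤-trans (≤-reflexive (+-comm q (suc p))) (+-monoʳ-≤ (suc p) (m≤m*n q (suc p))))

sum≤product : ∀ q p → 2 ≤ q → 2 ≤ p → q + p ≤ q * p
sum≤product (suc (suc q)) p (s≤s (s≤s _)) 2≤p = ≤-trans (≤-reflexive (+-comm (2 + q) p))
  (+-monoʳ-≤ p (+-mono-≤ 2≤p (m≤m*n q p {{>-nonZero (≤-trans (s≤s z≤n) 2≤p)}})))

extra≤ : ∀ τ → extra τ ≤ τ
extra≤ zero = z≤n
extra≤ (suc τ) = s≤s z≤n

-- Here and in the next two lemmas, `q` similar branches hold `p′` vertices each of a class of size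
-- `p`, `E` counts the undecided edges at one of these vertices, and `q + e` (below, `q + extra τ`)
-- is the demand on a branch.
ordinary-bound₁ : ∀ {q e p p′ E} → e ≤ 1 → 1 ≤ p′ → q * p′ ≤ p → p < E → q + e ≤ E
ordinary-bound₁ {q} {e} {p} {suc p′} e≤1 _ qp p<E = ≤-trans (≤-trans (+-monoʳ-≤ q e≤1)
  (≤-trans (≤-reflexive (+-comm q 1)) (s≤s (≤-trans (m≤m*n q (suc p′)) qp)))) p<E

ordinary-bound₂ : ∀ {q e p p′ E} → 1 ≤ q → e ≤ 1 → 2 ≤ p′ → q * p′ ≤ p → p < E → suc (q + e) ≤ E
ordinary-bound₂ {q} {e} {p} {p′} 1≤q e≤1 2≤p′ qp p<E = ≤-trans (s≤s (≤-trans (+-monoʳ-≤ q (≤-trans e≤1 1≤q))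
  (≤-trans (≤-reflexive (trans (sym (cong (q +_) (+-identityʳ q))) (*-comm 2 q))) (≤-trans (*-monoʳ-≤ q 2≤p′) qp)))) p<E

-- If `p ≤ a`, it suffices that `q + p′` exceeds `q * p′` by at most one. Otherwise `p` and `E` both
-- equal `suc a` and `τ` is zero; what remains are the cases `q = 1`, `p′ = 1`, and both at least
-- two, where `q + p′ ≤ q * p′`.
special-bound : ∀ τ {q p p′ E a} → 1 ≤ q → 1 ≤ p′ → q * p′ ≤ p → p ≤ suc a → E ≤ suc a → q ≤ a →
  suc τ + p ⊓ a ≤ E → q + extra τ + p′ ⊓ a ≤ E
special-bound τ {q} {p} {p′} {E} {a} 1≤q 1≤p′ qp p≤ E≤ q≤a h with ≤-<-connex p a
... | inj₁ p≤a = ≤-trans (+-monoʳ-≤ (q + extra τ) (m⊓n≤m p′ a)) (begin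
    q + extra τ + p′ ≡⟨ trans (cong (_+ p′) (+-comm q (extra τ))) (+-assoc (extra τ) q p′) ⟩
    extra τ + (q + p′) ≤⟨ +-mono-≤ (extra≤ τ) (≤-trans (sum≤1+product q p′ 1≤q 1≤p′) (s≤s qp)) ⟩
    τ + suc p ≡⟨ +-suc τ p ⟩
    suc τ + p ≡⟨ cong (suc τ +_) (sym (m≤n⇒m⊓n≡m p≤a)) ⟩
    suc τ + p ⊓ a ≤⟨ h ⟩
    E ∎)
  where open ≤-Reasoning
... | inj₂ a<p = large τ q p′ 1≤q 1≤p′ qp q≤a (≤-trans (≤-reflexive (cong (suc τ +_) (sym (m≥n⇒m⊓n≡n (<⇒≤ a<p))))) h)
  where
  large : ∀ τ q p′ → 1 ≤ q → 1 ≤ p′ → q * p′ ≤ p → q ≤ a → suc τ + a ≤ E → q + extra τ + p′ ⊓ a ≤ E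
  large (suc τ) q p′ 1≤q 1≤p′ qp q≤a h = ⊥-elim (<-irrefl refl (≤-trans (s≤s (s≤s (m≤n+m a τ))) (≤-trans h E≤)))
  large zero 1 p′ 1≤q 1≤p′ qp q≤a h = ≤-trans (s≤s (m⊓n≤n p′ a)) h
  large zero (suc (suc q)) 1 1≤q 1≤p′ qp q≤a h = ≤-trans (≤-trans (+-monoʳ-≤ (2 + q + 0) (m⊓n≤m 1 a))
    (≤-trans (≤-reflexive (trans (cong (_+ 1) (+-identityʳ (2 + q))) (+-comm (2 + q) 1))) (s≤s q≤a))) h
  large zero (suc (suc q)) (suc (suc p′)) 1≤q 1≤p′ qp q≤a h = ≤-trans (+-monoʳ-≤ (2 + q + 0) (m⊓n≤m (2 + p′) a))
    (≤-trans (≤-reflexive (cong (_+ (2 + p′)) (+-identityʳ (2 + q))))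
    (≤-trans (sum≤product (2 + q) (2 + p′) (s≤s (s≤s z≤n)) (s≤s (s≤s z≤n))) (≤-trans qp (≤-trans p≤ h))))

other-side : ∀ {m} → 1 ≤ m → (i : Fin (suc m)) → Σ[ j ∈ Fin (suc m) ] isZero j ≡ not (isZero i)
other-side {suc m} _ zero = suc zero , refl
other-side {suc m} _ (suc i) = zero , refl

isZero-zero : ∀ {m} (i : Fin (suc m)) → isZero i ≡ true → i ≡ zero
isZero-zero zero _ = refl

module Forests {n : ℕ} (Γ : Context n) (r s t : Fin n) (adj-rs : Context.adj Γ r s ≡ true) where
  open Labellings Γ
  open Rooted r s t adj-rs

  record ForestGood (K : V → Bool) (P : List V) (act : Lab) (x : V) (lam : Lab) : Set where
    field
      lam-sym : ∀ a b → lam a b ≡ lam b a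
      rigid : Rigid K (x ∷ P) act lam
      blue₁ : Blue₁ K act lam
      blue₂ : Blue₂ K act lam
      into : ∃[ z ] (K z ≡ true × act z x ≡ true × lam z x ≡ true)

  record IsForest (P : List V) (x : V) {m} (K : V → Bool) (Ks : Fin m → V → Bool) (root : Fin m → V) (leaf : Fin m → Bool) : Set where
    field
      cover : ∀ z → K z ≡ true → ∃[ i ] Ks i z ≡ true
      sub : ∀ i z → Ks i z ≡ true → K z ≡ true
      disjoint : ∀ i j z → Ks i z ≡ true → Ks j z ≡ true → i ≡ j
      closed : ∀ i z w → Ks i z ≡ true → adj z w ≡ true → Ks i w ≡ true ⊎ w ∈ x ∷ P
      connected : ∀ i (C : V → Bool) → C (root i) ≡ true →
        (∀ a b → Ks i a ≡ true → Ks i b ≡ true → adj a b ≡ true → C a ≡ true → C b ≡ true) →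
        ∀ z → Ks i z ≡ true → C z ≡ true
      root∈ : ∀ i → Ks i (root i) ≡ true
      root-adj : ∀ i → adj (root i) x ≡ true
      leaf-only : ∀ i → leaf i ≡ true → ∀ z → Ks i z ≡ true → z ≡ root i

  module _ (P : List V) (x : V) (act : Lab) {m : ℕ} (K : V → Bool) (Ks : Fin (suc m) → V → Bool)
    (root : Fin (suc m) → V) (leaf : Fin (suc m) → Bool)
    (isForest : IsForest P x K Ks root leaf)
    (inv : Inv K (x ∷ P) act)
    (alive : ∀ z → K z ≡ true → adj z x ≡ true → act z x ≡ true)
    (x≢s : x ≢ s) (x≢r : x ≢ r) (v : V) (v∈P : v ∈ P) (adj-xv : adj x v ≡ true)
    (solve : ∀ i → Solvable (Ks i) (root i) (leaf i))
    where
    open IsForest isForest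
    open Inv inv using (outside; act-sym; act-adj; act-in; act-cls; r∈P; bound₁; cap)

    private
      p : Fin (suc m) → V → ℕ
      p i z = classSize (Ks i) (x ∷ P) z

      opaque
        -- A decidable necessary condition for an automorphism fixing `x ∷ P` to carry one branch to
        -- another. It is coarser than isomorphism, but strong enough for `q*p≤`.
        sim : Fin (suc m) → Fin (suc m) → Bool
        sim i j = does (all? (λ z → p i z ≟ p j z))

        sim-sound : ∀ {i j} → sim i j ≡ true → ∀ z → p i z ≡ p j z
        sim-sound {i} {j} = ≡true-dec (all? (λ z → p i z ≟ p j z))

        sim-complete : ∀ {i j} → (∀ z → p i z ≡ p j z) → sim i j ≡ true
        sim-complete {i} {j} = dec-≡true (all? (λ z → p i z ≟ p j z))

        -- If k ∸ 1 similar branches hang below x, there may be too few numbers of blue edges to tell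
        -- them apart.  Then the edge from x to the first one is red, while x has a blue edge into
        -- each of the others.
        oneRed : Bool
        oneRed = does (suc m ≟ k ∸ 1) ∧ (not (leaf zero) ∧ not (special (root zero)))

        oneRed-sound : oneRed ≡ true → suc m ≡ k ∸ 1 × leaf zero ≡ false × special (root zero) ≡ false
        oneRed-sound e = ≡true-dec (suc m ≟ k ∸ 1) (∧-true₁ e) ,
          true-not (∧-true₁ {not (leaf zero)} (∧-true₂ {does (suc m ≟ k ∸ 1)} e)) ,
          true-not (∧-true₂ {not (leaf zero)} (∧-true₂ {does (suc m ≟ k ∸ 1)} e))

        oneRed-complete : suc m ≡ k ∸ 1 → leaf zero ≡ false → special (root zero) ≡ false → oneRed ≡ true
        oneRed-complete a b c = ∧-true (dec-≡true (suc m ≟ k ∸ 1) a) (∧-true (not-true b) (not-true c))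

        -- The pairs that need different numbers of blue edges. Under `oneRed` the colour of the
        -- edges to `x` already separates the first branch from the others.
        conf : Fin (suc m) → Fin (suc m) → Bool
        conf i j = sim i j ∧ (not oneRed ∨ (isZero i ⇔ᵇ isZero j))

        conf-intro : ∀ {i j} → sim i j ≡ true → isZero i ≡ isZero j ⊎ oneRed ≡ false → conf i j ≡ true
        conf-intro {i} {j} e (inj₁ f) = ∧-true e (∨-true₂ {not oneRed} (⇔ᵇ-refl {isZero i} {isZero j} f))
        conf-intro {i} {j} e (inj₂ f) = ∧-true e (∨-true₁ {not oneRed} (not-true f))

        conf-elim : ∀ {i j} → conf i j ≡ true → sim i j ≡ true × (isZero i ≡ isZero j ⊎ oneRed ≡ false)
        conf-elim {i} {j} e = ∧-true₁ e , half (∨-cases {not oneRed} (∧-true₂ {sim i j} e))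
          where
          half : not oneRed ≡ true ⊎ (isZero i ⇔ᵇ isZero j) ≡ true → isZero i ≡ isZero j ⊎ oneRed ≡ false
          half (inj₁ g) = inj₂ (true-not g)
          half (inj₂ g) = inj₁ (⇔ᵇ-sound {isZero i} {isZero j} g)

        colour : Fin (suc m) → Bool
        colour i = not (oneRed ∧ isZero i)

        colour-false : ∀ i → colour i ≡ false → oneRed ≡ true × isZero i ≡ true
        colour-false i e = ∧-true₁ (f (oneRed ∧ isZero i) e) , ∧-true₂ {oneRed} (f (oneRed ∧ isZero i) e)
          where
          f : ∀ b → not b ≡ false → b ≡ true
          f true _ = refl

        colour-zero : ∀ i → oneRed ≡ true → isZero i ≡ true → colour i ≡ false
        colour-zero i e f = cong not (∧-true e f)

        colour-suc : ∀ i → isZero i ≡ false → colour i ≡ true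
        colour-suc i e = not-true (trans (cong (oneRed ∧_) e) (∧-zeroʳ oneRed))

        colour-plain : ∀ i → oneRed ≡ false → colour i ≡ true
        colour-plain i e = not-true (cong (_∧ isZero i) e)

      q : Fin (suc m) → ℕ
      q i = count (conf i)

      conf-refl : ∀ i → conf i i ≡ true
      conf-refl i = conf-intro {i} {i} (sim-complete {i} {i} (λ _ → refl)) (inj₁ refl)

      conf-sym₁ : ∀ i j → conf i j ≡ true → conf j i ≡ true
      conf-sym₁ i j e with conf-elim {i} {j} e
      ... | f , g = conf-intro {j} {i} (sim-complete {j} {i} (λ z → sym (sim-sound {i} {j} f z))) (swap g)
        where
        swap : isZero i ≡ isZero j ⊎ oneRed ≡ false → isZero j ≡ isZero i ⊎ oneRed ≡ false
        swap (inj₁ h) = inj₁ (sym h)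
        swap (inj₂ h) = inj₂ h

      conf-sym : ∀ i j → conf i j ≡ conf j i
      conf-sym i j = bool-ext (conf-sym₁ i j) (conf-sym₁ j i)

      q-pos : ∀ i → 1 ≤ q i
      q-pos i = count-pos i (conf-refl i)

      sub-additive : (g : V → Bool) → Σᶠ (λ j → count (λ y → Ks j y ∧ g y)) ≤ count (λ y → K y ∧ g y)
      sub-additive g = begin
        Σᶠ (λ j → count (λ y → Ks j y ∧ g y)) ≡⟨ Σ-cong (λ j → count-Σ _) ⟩
        Σᶠ (λ j → Σᶠ (λ y → ⟦ Ks j y ∧ g y ⟧)) ≡⟨ Σ-swap _ ⟩
        Σᶠ (λ y → Σᶠ (λ j → ⟦ Ks j y ∧ g y ⟧)) ≡⟨ Σ-cong (λ y → sym (count-Σ _)) ⟩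
        Σᶠ (λ y → count (λ j → Ks j y ∧ g y))
          ≤⟨ Σ-mono (λ y → count-≤⟦⟧ _ _ (λ j e → ∧-true (sub j y (∧-true₁ e)) (∧-true₂ {Ks j y} e))
               (λ i j e f → disjoint i j y (∧-true₁ e) (∧-true₁ f))) ⟩
        Σᶠ (λ y → ⟦ K y ∧ g y ⟧) ≡⟨ sym (count-Σ _) ⟩
        count (λ y → K y ∧ g y) ∎
        where open ≤-Reasoning

      -- The branches are disjoint, and each of the `q i` branches in conflict with `i` contains
      -- `p i z` vertices of the class of `z`.
      q*p≤ : ∀ i z → q i * p i z ≤ classSize K (x ∷ P) z
      q*p≤ i z = begin
        q i * p i z ≡⟨ cong (_* p i z) (count-Σ _) ⟩
        Σᶠ (λ j → ⟦ conf i j ⟧) * p i z ≡⟨ sym (Σ-*ʳ _ _) ⟩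
        Σᶠ (λ j → ⟦ conf i j ⟧ * p i z) ≤⟨ Σ-mono (λ j → lemma j (conf i j) refl) ⟩
        Σᶠ (λ j → p j z) ≤⟨ sub-additive (cls (x ∷ P) z) ⟩
        classSize K (x ∷ P) z ∎
        where
        open ≤-Reasoning
        lemma : ∀ j b → conf i j ≡ b → ⟦ b ⟧ * p i z ≤ p j z
        lemma j true e = ≤-reflexive (trans (+-identityʳ _) (sim-sound {i} {j} (proj₁ (conf-elim {i} {j} e)) z))
        lemma j false e = z≤n

      neighbours : Fin (suc m) → ℕ
      neighbours j = count (λ y → Ks j y ∧ adj x y)

      neighbours-pos : ∀ j → 1 ≤ neighbours j
      neighbours-pos j = count-pos (root j) (∧-true (root∈ j) (trans (adj-sym x _) (root-adj j)))

      Σneighbours≤ : Σᶠ neighbours ≤ k ∸ 1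
      Σneighbours≤ = ≤-trans (sub-additive (adj x)) (∸-monoˡ-≤ 1 (subst (suc (count (λ y → K y ∧ adj x y)) ≤_) (regular x)
        (count-mono-< (λ y e → ∧-true₂ {K y} e) v (¬true⇒false (λ e → true≢false (∧-true₁ e) (outside (there v∈P)))) adj-xv)))

      Σ1≡ : Σᶠ {suc m} (λ _ → 1) ≡ suc m
      Σ1≡ = trans (Σ-const (suc m) 1) (*-identityʳ (suc m))

      -- Each branch contains a neighbour of `x`, and the parent `v` is one outside all branches.
      trees≤ : suc m ≤ k ∸ 1
      trees≤ = ≤-trans (≤-trans (≤-reflexive (sym Σ1≡)) (Σ-mono neighbours-pos)) Σneighbours≤

      one-neighbour : suc m ≡ k ∸ 1 → ∀ j → neighbours j ≤ 1
      one-neighbour e j with ≤-<-connex (neighbours j) 1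
      ... | inj₁ h = h
      ... | inj₂ h = ⊥-elim (<-irrefl (trans Σ1≡ e) (≤-trans (Σ-mono-< neighbours-pos j h) Σneighbours≤))

      q≤ : ∀ i → q i ≤ suc m
      q≤ i = ≤-trans (count-mono {g = λ _ → true} (λ _ _ → refl)) (≤-reflexive all-true)
        where
        all-true : count {suc m} (λ _ → true) ≡ suc m
        all-true = trans (count-Σ _) Σ1≡

      q-full : ∀ i → suc m ≤ q i → ∀ j → conf i j ≡ true
      q-full i h j with true⊎false (conf i j)
      ... | inj₁ e = e
      ... | inj₂ e = ⊥-elim (<-irrefl refl (≤-trans (count-mono-< {g = λ _ → true} (λ _ _ → refl) j e refl)
        (≤-trans (≤-reflexive (trans (count-Σ _) Σ1≡)) h)))

      active-parent-cap : ∀ z → K z ≡ true → special z ≡ true → adj z x ≡ true → classSize K (x ∷ P) z ≤ k ∸ 2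
      active-parent-cap z Kz sz e = cap z x Kz sz (here refl) (alive z Kz e)

      k-2<k-1 : suc (k ∸ 2) ≡ k ∸ 1
      k-2<k-1 = sym (+-∸-assoc 1 2≤k)

      -- More than `k ∸ 2` conflicts mean that there are `k ∸ 1` branches, all in conflict with `i`,
      -- which rules out `oneRed`. So the first root is special or a leaf. A special vertex of these
      -- branches adjacent to `x` would lie in a class of size at least `k ∸ 1`, against `cap`; and
      -- similarity to a leaf puts `z` into the class of that leaf, hence next to `x`.
      few-or-touched : ∀ i z → Ks i z ≡ true → q i ≤ k ∸ 2 ⊎ (special z ≡ false × adj z x ≡ true)
      few-or-touched i z Kz with ≤-<-connex (q i) (k ∸ 2)
      ... | inj₁ h = inj₁ h
      ... | inj₂ k-2<q = inj₂ (by-oneRed oneRed refl)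
        where
        k-1≤q : k ∸ 1 ≤ q i
        k-1≤q = subst (_≤ q i) k-2<k-1 k-2<q
        m≡ : suc m ≡ k ∸ 1
        m≡ = ≤-antisym trees≤ (≤-trans k-1≤q (q≤ i))
        full : ∀ j → conf i j ≡ true
        full = q-full i (≤-trans trees≤ k-1≤q)
        cap-contradiction : ∀ y → K y ≡ true → special y ≡ true → adj y x ≡ true → 1 ≤ p i y → ⊥
        cap-contradiction y Ky sy e h = <-irrefl refl (≤-trans (≤-trans k-2<q (m≤m*n (q i) (p i y) {{>-nonZero h}}))
          (≤-trans (q*p≤ i y) (active-parent-cap y Ky sy e)))
        same-as-zero : ∀ y → p i y ≡ p zero y
        same-as-zero = sim-sound {i} {zero} (proj₁ (conf-elim {i} {zero} (full zero)))
        by-oneRed : ∀ b → oneRed ≡ b → special z ≡ false × adj z x ≡ true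
        by-oneRed true e with j , f ← other-side (≤-pred (≤-trans (s≤s (s≤s z≤n)) (≤-trans (∸-monoˡ-≤ 1 k≥5) (≤-reflexive (sym m≡))))) i
          with proj₂ (conf-elim {i} {j} (full j))
        ... | inj₂ g = ⊥-elim (true≢false e g)
        ... | inj₁ g = ⊥-elim (not-≢ (trans g f))
          where
          not-≢ : ∀ {b} → b ≡ not b → ⊥
          not-≢ {true} ()
          not-≢ {false} ()
        by-oneRed false e with true⊎false (special (root zero)) | true⊎false (leaf zero)
        ... | inj₁ sr | _ = ⊥-elim (cap-contradiction (root zero) (sub zero _ (root∈ zero)) sr (root-adj zero)
          (subst (1 ≤_) (sym (same-as-zero (root zero))) (classSize-pos (root∈ zero))))
        ... | inj₂ sr | inj₂ lf = ⊥-elim (true≢false (oneRed-complete m≡ lf sr) e)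
        ... | inj₂ sr | inj₁ lf
          with y , f ← count-find _ (subst (1 ≤_) (same-as-zero z) (classSize-pos Kz)) =
          ¬true⇒false (λ sz → cap-contradiction z (sub i z Kz) sz zx (classSize-pos Kz)) , zx
          where
          zx : adj z x ≡ true
          zx = trans (cls-sound (∧-true₂ {Ks zero y} f) (here refl))
            (subst (λ y → adj y x ≡ true) (sym (leaf-only zero lf y (∧-true₁ f))) (root-adj zero))

      invs : ∀ i → Inv (Ks i) (x ∷ P) act
      invs i = Inv-sub inv (sub i) (closed i)

    module Combine (f : Fin (suc m) → ℕ) (f≢ : ∀ i j → i ≢ j → conf i j ≡ true → f i ≢ f j)
      (lams : Fin (suc m) → Lab) (goods : ∀ i → Good (Ks i) (x ∷ P) act x (colour i) (lams i))
      (blues : ∀ i → blue (Ks i) act (lams i) ≡ f i) where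
      private
        module G i = Good (goods i)

        meets : Fin (suc m) → V → V → Bool
        meets i a b = Ks i a ∨ Ks i b

      opaque
        lam : Lab
        lam a b = does (any? (λ i → (meets i a b ∧ lams i a b) ≟B true))

        lam-sound : ∀ {a b} → lam a b ≡ true → ∃[ i ] (meets i a b ∧ lams i a b ≡ true)
        lam-sound {a} {b} = ≡true-dec (any? (λ i → (meets i a b ∧ lams i a b) ≟B true))

        lam-complete : ∀ {a b} i → meets i a b ∧ lams i a b ≡ true → lam a b ≡ true
        lam-complete {a} {b} i e = dec-≡true (any? (λ i → (meets i a b ∧ lams i a b) ≟B true)) (i , e)

      private
        lam-sym₁ : ∀ a b → lam a b ≡ true → lam b a ≡ true
        lam-sym₁ a b e with i , h ← lam-sound e =
          lam-complete i (∧-true (trans (∨-comm (Ks i b) _) (∧-true₁ h)) (trans (G.lam-sym i b a) (∧-true₂ {meets i a b} h)))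

        lam-symm : ∀ a b → lam a b ≡ lam b a
        lam-symm a b = bool-ext (lam-sym₁ a b) (lam-sym₁ b a)

        -- A branch is closed up to explored vertices, so no edge joins two branches.
        meets-unique : ∀ i j a b → act a b ≡ true → meets i a b ≡ true → meets j a b ≡ true → i ≡ j
        meets-unique i j a b e mi mj with ∨-cases mi | ∨-cases mj
        ... | inj₁ ia | inj₁ ja = disjoint i j a ia ja
        ... | inj₂ ib | inj₂ jb = disjoint i j b ib jb
        ... | inj₁ ia | inj₂ jb with closed i a b ia (act-adj a b e)
        ... | inj₁ ib = disjoint i j b ib jb
        ... | inj₂ b∈ = ⊥-elim (true≢false (sub j b jb) (outside b∈))
        meets-unique i j a b e mi mj | inj₂ ib | inj₁ ja with closed j a b ja (act-adj a b e)
        ... | inj₁ jb = disjoint i j b ib jb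
        ... | inj₂ b∈ = ⊥-elim (true≢false (sub i b ib) (outside b∈))

        lam-at : ∀ i a b → act a b ≡ true → meets i a b ≡ true → lam a b ≡ lams i a b
        lam-at i a b e mi = bool-ext forth (λ h → lam-complete i (∧-true mi h))
          where
          forth : lam a b ≡ true → lams i a b ≡ true
          forth h with j , g ← lam-sound h with refl ← meets-unique i j a b e mi (∧-true₁ g) = ∧-true₂ {meets j a b} g

        blue-at : ∀ i → blue (Ks i) act lam ≡ f i
        blue-at i = trans (Σ-cong (λ a → Σ-cong (λ b → cong ⟦_⟧ (eq a b)))) (blues i)
          where
          eq : ∀ a b → (meets i a b ∧ act a b) ∧ lam a b ≡ (meets i a b ∧ act a b) ∧ lams i a b
          eq a b with true⊎false (meets i a b ∧ act a b)
          ... | inj₁ e = cong ((meets i a b ∧ act a b) ∧_) (lam-at i a b (∧-true₂ {meets i a b} e) (∧-true₁ e))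
          ... | inj₂ e rewrite e = refl

        K-find : ∀ a b → K a ∨ K b ≡ true → ∃[ i ] meets i a b ≡ true
        K-find a b e with ∨-cases e
        ... | inj₁ Ka with i , h ← cover a Ka = i , ∨-true₁ h
        ... | inj₂ Kb with i , h ← cover b Kb = i , ∨-true₂ {Ks i a} h

        K-meets : ∀ i a b → meets i a b ≡ true → K a ∨ K b ≡ true
        K-meets i a b e with ∨-cases e
        ... | inj₁ h = ∨-true₁ (sub i a h)
        ... | inj₂ h = ∨-true₂ {K a} (sub i b h)

      blue-total : blue K act lam ≡ Σᶠ f
      blue-total = begin
        blue K act lam ≡⟨ Σ-cong (λ a → Σ-cong (λ b → eq a b)) ⟩
        Σᶠ (λ a → Σᶠ (λ b → Σᶠ (λ i → g i a b))) ≡⟨ Σ-cong (λ a → Σ-swap _) ⟩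
        Σᶠ (λ a → Σᶠ (λ i → Σᶠ (λ b → g i a b))) ≡⟨ Σ-swap _ ⟩
        Σᶠ (λ i → blue (Ks i) act lam) ≡⟨ Σ-cong blue-at ⟩
        Σᶠ f ∎
        where
        open ≡-Reasoning
        g : Fin (suc m) → V → V → ℕ
        g i a b = ⟦ (meets i a b ∧ act a b) ∧ lam a b ⟧
        eq : ∀ a b → ⟦ ((K a ∨ K b) ∧ act a b) ∧ lam a b ⟧ ≡ Σᶠ (λ i → g i a b)
        eq a b with true⊎false (act a b)
        ... | inj₂ e rewrite e = sym (trans (Σ-cong (λ i → cong (λ c → ⟦ c ∧ lam a b ⟧) (∧-zeroʳ (meets i a b))))
                                   (trans (Σ-const (suc m) 0) (trans (*-zeroʳ (suc m)) (cong (λ c → ⟦ c ∧ lam a b ⟧) (sym (∧-zeroʳ (K a ∨ K b)))))))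
        ... | inj₁ e with true⊎false (K a ∨ K b)
        ... | inj₁ Kab with i , h ← K-find a b Kab = sym (trans (Σ⟦⟧-unique _ i
              (λ j gj → meets-unique j i a b e (∧-true₁ {meets j a b} (∧-true₁ gj)) h))
              (cong (λ c → ⟦ (c ∧ act a b) ∧ lam a b ⟧) (trans h (sym Kab))))
        ... | inj₂ Kab = trans (cong (λ c → ⟦ (c ∧ act a b) ∧ lam a b ⟧) Kab)
              (sym (trans (Σ-cong (λ i → cong (λ c → ⟦ (c ∧ act a b) ∧ lam a b ⟧) (¬true⇒false (λ h → true≢false (K-meets i a b h) Kab))))
                (trans (Σ-const (suc m) 0) (*-zeroʳ (suc m)))))

      private
        module _ (φ : Aut) (fix : ∀ w → w ∈ x ∷ P → at φ w ≡ w) (Kφ : ∀ z → K (at φ z) ≡ K z)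
                 (pres : Preserves φ K act lam) where
          ψ : V → V
          ψ z = perm φ ⟨$⟩ˡ z

          -- The image of a connected branch is connected and avoids the explored vertices, so it
          -- cannot leave the branch that contains the image of the root.
          stays : ∀ (χ : Aut) → (∀ z → K (at χ z) ≡ K z) → ∀ i j → Ks j (at χ (root i)) ≡ true →
            ∀ z → Ks i z ≡ true → Ks j (at χ z) ≡ true
          stays χ Kχ i j h = connected i (λ z → Ks j (at χ z)) h step
            where
            step : ∀ a b → Ks i a ≡ true → Ks i b ≡ true → adj a b ≡ true → Ks j (at χ a) ≡ true → Ks j (at χ b) ≡ true
            step a b ia ib e ja with closed j (at χ a) (at χ b) ja (trans (adj-perm χ a b) e)
            ... | inj₁ jb = jb
            ... | inj₂ b∈ = ⊥-elim (true≢false (trans (Kχ b) (sub i b ib)) (outside b∈))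

          Kψ : ∀ z → K (ψ z) ≡ K z
          Kψ z = trans (sym (Kφ (ψ z))) (cong K (inverseʳ (perm φ)))

          image : ∀ i → ∃[ j ] (∀ z → Ks j (at φ z) ≡ Ks i z)
          image i with j , h ← cover (at φ (root i)) (trans (Kφ (root i)) (sub i _ (root∈ i))) =
            j , λ z → bool-ext (back z) (stays φ Kφ i j h z)
            where
            back : ∀ z → Ks j (at φ z) ≡ true → Ks i z ≡ true
            back z e with l , g ← cover (ψ (root j)) (trans (Kψ (root j)) (sub j _ (root∈ j)))
              with from ← stays (Aut-inv φ) Kψ j l g
              with refl ← disjoint l i (root i) (subst (λ y → Ks l y ≡ true) (inverseˡ (perm φ)) (from _ h)) (root∈ i) =
              subst (λ y → Ks l y ≡ true) (inverseˡ (perm φ)) (from _ e)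

          act-φ : ∀ a b → K a ∨ K b ≡ true → act (at φ a) (at φ b) ≡ act a b
          act-φ = act-invariant inv φ fix Kφ

          -- As `φ` fixes `x ∷ P`, it maps each class to itself, hence the part of a class in one
          -- branch onto its part in the other.
          sim-image : ∀ i j → (∀ z → Ks j (at φ z) ≡ Ks i z) → sim i j ≡ true
          sim-image i j h = sim-complete {i} {j} (λ z → sym (trans (count-permute _ (perm φ)) (count-cong (λ y → cong₂ _∧_ (h y)
            (bool-ext (λ e → cls-trans e (cls-fixed φ fix y)) (λ e → cls-trans e (cls-sym (cls-fixed φ fix y))))))))

          blue-image : ∀ i j → (∀ z → Ks j (at φ z) ≡ Ks i z) → f i ≡ f j
          blue-image i j h = trans (sym (blue-at i)) (trans (Σ-cong (λ a → trans (Σ-cong (λ b → cong ⟦_⟧ (eq a b))) (sym (Σ-permute _ (perm φ)))))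
            (trans (sym (Σ-permute (λ a → Σᶠ (λ b → ⟦ (meets j a b ∧ act a b) ∧ lam a b ⟧)) (perm φ))) (blue-at j)))
            where
            eq : ∀ a b → (meets i a b ∧ act a b) ∧ lam a b ≡
              (meets j (at φ a) (at φ b) ∧ act (at φ a) (at φ b)) ∧ lam (at φ a) (at φ b)
            eq a b rewrite h a | h b with true⊎false (meets i a b)
            ... | inj₂ e rewrite e = refl
            ... | inj₁ e rewrite act-φ a b (K-meets i a b e) with true⊎false (act a b)
            ... | inj₁ g rewrite pres a b (K-meets i a b e) g = refl
            ... | inj₂ g rewrite g | e = refl

          -- Under `oneRed`, the undecided edges from the first branch to `x` are all red, while
          -- every other branch has a blue one.
          same-side : ∀ i j → (∀ z → Ks j (at φ z) ≡ Ks i z) → isZero i ≡ isZero j ⊎ oneRed ≡ false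
          same-side i j h with true⊎false oneRed | isZero i in ei | isZero j in ej
          ... | inj₂ tr | _ | _ = inj₂ tr
          ... | inj₁ tr | true | true = inj₁ refl
          ... | inj₁ tr | false | false = inj₁ refl
          ... | inj₁ tr | true | false with z , jz , az , lz ← G.into j (colour-suc j ej) =
            ⊥-elim (true≢false (trans (sym eq₁) eq₂) (G.none i (colour-zero i tr ei) (ψ z) iz (trans (sym eq₃) az)))
            where
            iz : Ks i (ψ z) ≡ true
            iz = trans (sym (h (ψ z))) (trans (cong (Ks j) (inverseʳ (perm φ))) jz)
            Kz = K-meets i (ψ z) x (∨-true₁ iz)
            eq₃ : act z x ≡ act (ψ z) x
            eq₃ = trans (sym (cong₂ act (inverseʳ (perm φ)) (fix x (here refl)))) (act-φ (ψ z) x Kz)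
            az′ = trans (sym eq₃) az
            eq₁ : lam z x ≡ lams i (ψ z) x
            eq₁ = trans (sym (cong₂ lam (inverseʳ (perm φ)) (fix x (here refl)))) (trans (pres (ψ z) x Kz az′) (lam-at i _ _ az′ (∨-true₁ iz)))
            eq₂ : lam z x ≡ true
            eq₂ = trans (lam-at j z x az (∨-true₁ jz)) lz
          ... | inj₁ tr | false | true with z , iz , az , lz ← G.into i (colour-suc i ei) =
            ⊥-elim (true≢false (trans (sym eq₁) eq₂) (G.none j (colour-zero j tr ej) (at φ z) jz az′))
            where
            jz = trans (h z) iz
            Kz = K-meets i z x (∨-true₁ iz)
            az′ : act (at φ z) x ≡ true
            az′ = trans (trans (sym (cong (act (at φ z)) (fix x (here refl)))) (act-φ z x Kz)) az
            eq₁ : lam (at φ z) x ≡ lams j (at φ z) x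
            eq₁ = lam-at j _ _ az′ (∨-true₁ jz)
            eq₂ : lam (at φ z) x ≡ true
            eq₂ = trans (cong (lam (at φ z)) (sym (fix x (here refl)))) (trans (pres z x Kz az) (trans (lam-at i z x az (∨-true₁ iz)) lz))

          conf-image : ∀ i j → (∀ z → Ks j (at φ z) ≡ Ks i z) → conf i j ≡ true
          conf-image i j h = conf-intro {i} {j} (sim-image i j h) (same-side i j h)

          image-self : ∀ i → ∀ z → Ks i (at φ z) ≡ Ks i z
          image-self i with j , h ← image i with i ≟F j
          ... | yes refl = h
          -- `φ` preserves the number of blue edges, but conflicting branches were given different
          -- numbers.
          ... | no i≢j = ⊥-elim (f≢ i j i≢j (conf-image i j h) (blue-image i j h))

          fixes : ∀ z → K z ≡ true → at φ z ≡ z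
          fixes z Kz with i , iz ← cover z Kz = G.rigid i φ fix (image-self i) pres-i z iz
            where
            pres-i : Preserves φ (Ks i) act (lams i)
            pres-i a b e g = trans (sym (lam-at i _ _ (trans (act-φ a b (K-meets i a b e)) g)
                (trans (cong₂ _∨_ (image-self i a) (image-self i b)) e)))
              (trans (pres a b (K-meets i a b e) g) (lam-at i a b g e))

        blue-tree : ∃[ i ] colour i ≡ true
        blue-tree with true⊎false oneRed
        ... | inj₂ e = zero , colour-plain zero e
        ... | inj₁ e with j , g ← other-side (≤-pred (≤-trans (s≤s (s≤s z≤n)) (≤-trans (∸-monoˡ-≤ 1 k≥5)
                (≤-reflexive (sym (proj₁ (oneRed-sound e))))))) (zero {m}) =
          j , colour-suc j g

      good : ForestGood K P act x lam
      good = record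
        { lam-sym = lam-symm
        ; rigid = fixes
        ; blue₁ = blue₁
        ; blue₂ = blue₂
        ; into = into }
        where
        blue₁ : Blue₁ K act lam
        blue₁ z Kz with i , iz ← cover z Kz with w , a , l ← G.blue₁ i z iz =
          w , a , trans (lam-at i z w a (∨-true₁ iz)) l
        blue₂ : Blue₂ K act lam
        blue₂ z Kz sz with i , iz ← cover z Kz with w , w′ , d , (a , l) , (a′ , l′) ← G.blue₂ i z iz sz =
          w , w′ , d , (a , trans (lam-at i z w a (∨-true₁ iz)) l) , (a′ , trans (lam-at i z w′ a′ (∨-true₁ iz)) l′)
        into : ∃[ z ] (K z ≡ true × act z x ≡ true × lam z x ≡ true)
        into with i , c ← blue-tree with z , iz , a , l ← G.into i c =
          z , sub i z iz , a , trans (lam-at i z x a (∨-true₁ iz)) l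

    module _ (τ : ℕ) (pot : Pot (suc τ) K (x ∷ P) act) where
      private
        -- The larger of the two list lengths that `distinct-sums` requires of branch `i`.
        N : Fin (suc m) → ℕ
        N i = suc τ ⊔ (q i + extra τ)

        p≤ : ∀ i z → p i z ≤ classSize K (x ∷ P) z
        p≤ i z = classSize-mono (sub i) z

        -- A touched vertex has more undecided edges than class members, and `q*p≤` turns this into
        -- room for the demand. An untouched one has all `k` edges undecided, and `few-or-touched`
        -- bounds `q i` by `k ∸ 2`.
        ordinary : ∀ i z → Ks i z ≡ true → special z ≡ false →
          q i + extra τ ≤ active act z × (2 ≤ p i z → suc (q i + extra τ) ≤ active act z)
        ordinary i z Kz sz with touched? (x ∷ P) z
        ... | inj₁ (w , w∈ , e) = ordinary-bound₁ {q i} (extra≤1 τ) (classSize-pos Kz) (q*p≤ i z) b ,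
            λ h → ordinary-bound₂ {q i} (q-pos i) (extra≤1 τ) h (q*p≤ i z) b
          where b = bound₁ z w (sub i z Kz) sz w∈ e
        ... | inj₂ h with few-or-touched i z Kz
        ... | inj₂ (_ , zx) = ⊥-elim (true≢false zx (h x (here refl)))
        ... | inj₁ q≤k-2 = ≤-trans (n≤1+n _) b , λ _ → b
          where
          b : suc (q i + extra τ) ≤ active act z
          b = subst (suc (q i + extra τ) ≤_) (sym (untouched-active inv z (sub i z Kz) h))
            (≤-trans (s≤s (+-mono-≤ q≤k-2 (extra≤1 τ))) (≤-reflexive (trans (cong suc (+-comm (k ∸ 2) 1)) (m+[n∸m]≡n 2≤k))))

        exceptional : ∀ i z → Ks i z ≡ true → special z ≡ true → q i + extra τ + p i z ⊓ (k ∸ 2) ≤ active act z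
        exceptional i z Kz sz with few-or-touched i z Kz
        ... | inj₂ (sz′ , _) = ⊥-elim (true≢false sz sz′)
        ... | inj₁ q≤k-2 = special-bound τ (q-pos i) (classSize-pos Kz) (q*p≤ i z)
          (≤-trans (special-classSize inv z sz) (≤-reflexive (sym k-2<k-1)))
          (≤-trans (special-active inv z (sub i z Kz) sz) (≤-reflexive (sym k-2<k-1)))
          q≤k-2 (proj₂ (pot z (sub i z Kz)) sz)

        pots : ∀ i → Pot (N i) (Ks i) (x ∷ P) act
        pots i z Kz = (λ sz → let a , b = proj₁ (pot z (sub i z Kz)) sz ; c , d = ordinary i z Kz sz in
            ⊔-lub a c , λ h → ⊔-lub (b (≤-trans h (p≤ i z))) (d h)) ,
          λ sz → subst (_≤ active act z) (sym (+-distribʳ-⊔ (p i z ⊓ (k ∸ 2)) (suc τ) (q i + extra τ)))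
            (⊔-lub (≤-trans (+-monoʳ-≤ (suc τ) (⊓-monoˡ-≤ (k ∸ 2) (p≤ i z))) (proj₂ (pot z (sub i z Kz)) sz)) (exceptional i z Kz sz))

        red-tree : ∀ i → colour i ≡ false →
          leaf i ≡ false × special (root i) ≡ false × (∀ z → Ks i z ≡ true → adj z x ≡ true → z ≡ root i)
        red-tree i e = go i (isZero-zero i (proj₂ (colour-false i e)))
          where
          tk = oneRed-sound (proj₁ (colour-false i e))
          go : ∀ i → i ≡ zero → leaf i ≡ false × special (root i) ≡ false × (∀ z → Ks i z ≡ true → adj z x ≡ true → z ≡ root i)
          go i refl = proj₁ (proj₂ tk) , proj₂ (proj₂ tk) , unique
            where
            unique : ∀ z → Ks zero z ≡ true → adj z x ≡ true → z ≡ root zero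
            unique z Kz e with z ≟F root zero
            ... | yes eq = eq
            ... | no z≢ = ⊥-elim (<-irrefl refl (≤-trans
              (count-two _ (∧-true Kz (trans (adj-sym x z) e)) (∧-true (root∈ zero) (trans (adj-sym x _) (root-adj zero))) z≢)
              (one-neighbour (proj₁ tk) zero)))

        family : ∀ i → Family (Ks i) act (Good (Ks i) (x ∷ P) act x (colour i)) (N i)
        family i = solve i (x ∷ P) x act (colour i) (N i) (≤-trans (s≤s z≤n) (m≤m⊔n (suc τ) (q i + extra τ))) (invs i) (here refl) x≢s x≢r
          (root-adj i) (λ z Kz → alive z (sub i z Kz)) (pots i) (red-tree i)

        A : Fin (suc m) → List ℕ
        A i = proj₁ (family i)

        lenA : ∀ i → length (A i) ≡ N i
        lenA i = proj₁ (proj₂ (proj₂ (family i)))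

        combined : ∀ {b} (f : Fin (suc m) → ℕ) → (∀ i → f i ∈ A i) → (∀ i j → i ≢ j → conf i j ≡ true → f i ≢ f j) →
          Σᶠ f ≡ b → ∃[ lam ] (ForestGood K P act x lam × blue K act lam ≡ b)
        combined f f∈ f≢ e = C.lam , C.good , trans C.blue-total e
          where
          pick : ∀ i → ∃[ lam ] (Good (Ks i) (x ∷ P) act x (colour i) lam × blue (Ks i) act lam ≡ f i)
          pick i = All.lookup (proj₂ (proj₂ (proj₂ (family i)))) (f∈ i)
          module C = Combine f f≢ (λ i → proj₁ (pick i)) (λ i → proj₁ (proj₂ (pick i))) (λ i → proj₂ (proj₂ (pick i)))

      forest-family : Family K act (ForestGood K P act x) (suc τ)
      forest-family with S , uS , lS , aS ← distinct-sums τ A conf conf-refl conf-sym (λ i → proj₁ (proj₂ (family i)))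
            (λ i → subst (suc τ ≤_) (sym (lenA i)) (m≤m⊔n (suc τ) (q i + extra τ)))
            (λ i → subst (q i + extra τ ≤_) (sym (lenA i)) (m≤n⊔m (suc τ) (q i + extra τ))) =
        S , uS , lS , All.map (λ { (f , (f∈ , f≢) , e) → combined f f∈ f≢ e }) aS

-- One step of the exploration

double-injective : ∀ a b → a + a ≡ b + b → a ≡ b
double-injective zero zero _ = refl
double-injective (suc a) (suc b) e = cong suc (double-injective a b
  (suc-injective (trans (sym (+-suc a a)) (trans (suc-injective e) (+-suc b b)))))

module Stars {n : ℕ} where
  opaque
    star : Fin n → (Fin n → Bool) → Fin n → Fin n → Bool
    star v g a b = ((a == v) ∧ g b) ∨ ((b == v) ∧ g a)

    star-sym : ∀ v g a b → star v g a b ≡ star v g b a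
    star-sym v g a b = ∨-comm ((a == v) ∧ g b) _

    star-cases : ∀ {v g a b} → star v g a b ≡ true → (a ≡ v × g b ≡ true) ⊎ (b ≡ v × g a ≡ true)
    star-cases {v} {g} {a} {b} e with ∨-cases {(a == v) ∧ g b} e
    ... | inj₁ f = inj₁ (==-sound (∧-true₁ f) , ∧-true₂ {a == v} f)
    ... | inj₂ f = inj₂ (==-sound (∧-true₁ f) , ∧-true₂ {b == v} f)

    star-at : ∀ {v a} g → a ≢ v → star v g a v ≡ g a
    star-at {v} {a} g a≢v rewrite ==-≢ a≢v | ==-refl v = refl

    star-off : ∀ {v a b} g → a ≢ v → b ≢ v → star v g a b ≡ false
    star-off g a≢v b≢v rewrite ==-≢ a≢v | ==-≢ b≢v = refl

    star-Σ : ∀ v g → g v ≡ false → Σᶠ (λ a → Σᶠ (λ b → ⟦ star v g a b ⟧)) ≡ count g + count g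
    star-Σ v g gv = begin
      Σᶠ (λ a → Σᶠ (λ b → ⟦ star v g a b ⟧)) ≡⟨ Σ-cong (λ a → Σ-cong (λ b → split a b)) ⟩
      Σᶠ (λ a → Σᶠ (λ b → ⟦ a == v ⟧ * ⟦ g b ⟧ + ⟦ b == v ⟧ * ⟦ g a ⟧)) ≡⟨ Σ-cong (λ a → Σ-+ _ _) ⟩
      Σᶠ (λ a → Σᶠ (λ b → ⟦ a == v ⟧ * ⟦ g b ⟧) + Σᶠ (λ b → ⟦ b == v ⟧ * ⟦ g a ⟧)) ≡⟨ Σ-+ _ _ ⟩
      Σᶠ (λ a → Σᶠ (λ b → ⟦ a == v ⟧ * ⟦ g b ⟧)) + Σᶠ (λ a → Σᶠ (λ b → ⟦ b == v ⟧ * ⟦ g a ⟧))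
        ≡⟨ cong₂ _+_ (trans (Σ-swap _) (Σ-cong (λ b → Σ-single v (λ _ → ⟦ g b ⟧)))) (Σ-cong (λ a → Σ-single v (λ _ → ⟦ g a ⟧))) ⟩
      Σᶠ (λ b → ⟦ g b ⟧) + Σᶠ (λ a → ⟦ g a ⟧) ≡⟨ cong₂ _+_ (sym (count-Σ g)) (sym (count-Σ g)) ⟩
      count g + count g ∎
      where
      open ≡-Reasoning
      bit : ∀ p q r u → (p ≡ true → r ≡ true → u ≡ false) → ⟦ (p ∧ q) ∨ (r ∧ u) ⟧ ≡ ⟦ p ⟧ * ⟦ q ⟧ + ⟦ r ⟧ * ⟦ u ⟧
      bit true true true u h rewrite h refl refl = refl
      bit true true false u h = refl
      bit true false r u h = rest r u
        where
        rest : ∀ r u → ⟦ r ∧ u ⟧ ≡ ⟦ r ⟧ * ⟦ u ⟧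
        rest true u = sym (+-identityʳ ⟦ u ⟧)
        rest false u = refl
      bit false q true u h = sym (+-identityʳ ⟦ u ⟧)
      bit false q false u h = refl
      split : ∀ a b → ⟦ star v g a b ⟧ ≡ ⟦ a == v ⟧ * ⟦ g b ⟧ + ⟦ b == v ⟧ * ⟦ g a ⟧
      split a b = bit (a == v) (g b) (b == v) (g a) (λ e _ → trans (cong g (==-sound e)) gv)

open Stars

module Trees {n : ℕ} (Γ : Context n) (r s t : Fin n) (adj-rs : Context.adj Γ r s ≡ true) where
  open Labellings Γ
  open Rooted r s t adj-rs
  open Forests Γ r s t adj-rs

  true≢-K : ∀ {K : V → Bool} {a b} → K a ≡ true → K b ≡ false → a ≢ b
  true≢-K Ka Kb refl = true≢false Ka Kb

  leaf-solvable : ∀ {K x} → K x ≡ true → (∀ z → K z ≡ true → z ≡ x) → Solvable K x true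
  leaf-solvable {K} {x} Kx only P v act false N 1≤N inv v∈P v≢s v≢r adj-xv alive pot red with proj₁ (red refl)
  ... | ()
  leaf-solvable {K} {x} Kx only P v act true N 1≤N inv v∈P v≢s v≢r adj-xv alive pot red =
    map size (upTo N) , Uniqueₚ.map⁺ size-injective (Uniqueₚ.upTo⁺ N) , trans (length-map size (upTo N)) (length-upTo N) ,
    Allₚ.map⁺ (All.tabulate (λ i∈ → labelling _ (∈-upTo⁻ i∈)))
    where
    open Inv inv
    o = ⟦ special x ⟧
    size : ℕ → ℕ
    -- Edges are counted twice. One blue edge is `xv`; a special leaf gets a second one, and `i`
    -- further ones make the number variable.
    size i = suc (o + i) + suc (o + i)
    size-injective : ∀ {i j} → size i ≡ size j → i ≡ j
    size-injective e = +-cancelˡ-≡ o _ _ (suc-injective (double-injective _ _ e))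

    enough : ∀ b → special x ≡ b → ⟦ b ⟧ + N ≤ active act x
    enough true sx = ≤-trans (≤-trans (≤-reflexive (+-comm 1 N)) (+-monoʳ-≤ N
      (⊓-glb (classSize-pos Kx) (≤-trans (s≤s z≤n) (∸-monoˡ-≤ 2 k≥5))))) (proj₂ (pot x Kx) sx)
    enough false sx = proj₁ (proj₁ (pot x Kx) sx)

    act-xv : act x v ≡ true
    act-xv = alive x Kx adj-xv

    x≢v : x ≢ v
    x≢v = adj-≢ adj-xv

    labelling : ∀ i → i < N → ∃[ lam ] (Good K P act v true lam × blue K act lam ≡ size i)
    labelling i i<N with count-choose (act x) v act-xv (o + i)
      (≤-trans (≤-reflexive (sym (+-suc o i))) (≤-trans (+-monoʳ-≤ o i<N) (enough (special x) refl)))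
    ... | g , g⊆ , gv , cg = star x g , record
      { lam-sym = star-sym x g
      ; rigid = λ φ fix Kφ pres z Kz → trans (only _ (trans (Kφ z) Kz)) (sym (only z Kz))
      ; blue₁ = λ z Kz → v , subst (λ z → act z v ≡ true × star x g z v ≡ true) (sym (only z Kz)) (act-xv , at-x v gv x≢v)
      ; blue₂ = λ z Kz sz → subst (λ z → special z ≡ true → ∃[ w ] ∃[ w′ ] (w ≢ w′ × (act z w ≡ true × star x g z w ≡ true) ×
          (act z w′ ≡ true × star x g z w′ ≡ true))) (sym (only z Kz)) two sz
      ; into = λ _ → x , Kx , act-xv , at-x v gv x≢v
      ; none = λ () } , trans supported (trans (star-Σ x g gx) (cong₂ _+_ cg cg))
      where
      gx : g x ≡ false
      gx = ¬true⇒false (λ e → adj-≢ (act-adj x x (g⊆ x e)) refl)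
      at-x : ∀ w → g w ≡ true → x ≢ w → star x g x w ≡ true
      at-x w gw x≢w = trans (star-sym x g x w) (trans (star-at g (x≢w ∘ sym)) gw)
      two : special x ≡ true → ∃[ w ] ∃[ w′ ] (w ≢ w′ × (act x w ≡ true × star x g x w ≡ true) ×
          (act x w′ ≡ true × star x g x w′ ≡ true))
      two sx with w , gw , w≢v ← count-another g v (subst (2 ≤_) (sym cg) (s≤s (subst (λ b → 1 ≤ ⟦ b ⟧ + i) (sym sx) (s≤s z≤n)))) =
        v , w , w≢v ∘ sym , (act-xv , at-x v gv x≢v) , (g⊆ w gw , at-x w gw (adj-≢ (act-adj x w (g⊆ w gw))))
      supported : blue K act (star x g) ≡ Σᶠ (λ a → Σᶠ (λ b → ⟦ star x g a b ⟧))
      supported = Σ-cong (λ a → Σ-cong (λ b → cong ⟦_⟧ (eq a b)))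
        where
        meet : ∀ a b → star x g a b ≡ true → (K a ∨ K b) ∧ act a b ≡ true
        meet a b e with star-cases e
        ... | inj₁ (refl , gb) = ∧-true (∨-true₁ Kx) (g⊆ b gb)
        ... | inj₂ (refl , ga) = ∧-true (∨-true₂ {K a} Kx) (trans (act-sym a x) (g⊆ a ga))
        eq : ∀ a b → ((K a ∨ K b) ∧ act a b) ∧ star x g a b ≡ star x g a b
        eq a b = bool-ext (∧-true₂ {(K a ∨ K b) ∧ act a b}) (λ e → ∧-true (meet a b e) e)

  -- Ensures that the neighbours of r other than s are not all reached for the first time at
  -- the same step.
  Crowded : Set
  Crowded = ∀ x → x ≢ r → x ≢ s → x ≢ t → (f : V → Bool) →
    (∀ y → f y ≡ true → adj r y ≡ true × y ≢ s × y ≢ t × adj x y ≡ true) →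
    (∀ y z → f y ≡ true → f z ≡ true → adj t y ≡ adj t z) →
    k ∸ 1 ≤ count f → ∀ v → adj x v ≡ true → adj r v ≡ true

  delete : (V → Bool) → V → V → Bool
  delete K x z = K z ∧ not (z == x)

  module Step (crowded : Crowded) (K : V → Bool) (x : V) (Kx : K x ≡ true)
    (P : List V) (v : V) (act : Lab) (inv : Inv K P act) (v∈P : v ∈ P) (v≢s : v ≢ s) (v≢r : v ≢ r) (adj-xv : adj x v ≡ true)
    (alive : ∀ z → K z ≡ true → adj z v ≡ true → act z v ≡ true) where
    open Inv inv

    K′ : V → Bool
    K′ = delete K x

    opaque
      mate : V → Bool
      mate y = (K y ∧ cls P x y) ∧ not (y == x)

      mate-elim : ∀ {y} → mate y ≡ true → K y ≡ true × cls P x y ≡ true × y ≢ x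
      mate-elim {y} e = ∧-true₁ (∧-true₁ e) , ∧-true₂ {K y} (∧-true₁ e) , true-≢ (∧-true₂ {K y ∧ cls P x y} e)

      mate-intro : ∀ {y} → K y ≡ true → cls P x y ≡ true → y ≢ x → mate y ≡ true
      mate-intro a b c = ∧-true (∧-true a b) (≢-true c)

      count-mate : classSize K P x ≡ suc (count mate)
      count-mate = count-remove _ x (∧-true Kx (cls-refl P x))

      -- Only the edges from `v` to the mates are struck out. The edge from `v` to `x` has both ends
      -- outside `K′` and thereby drops out of the count.
      act′ : Lab
      act′ a b = act a b ∧ not (star v mate a b)

      act′-elim : ∀ {a b} → act′ a b ≡ true → act a b ≡ true × star v mate a b ≡ false
      act′-elim {a} {b} e = ∧-true₁ e , true-not (∧-true₂ {act a b} e)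

      act′-intro : ∀ {a b} → act a b ≡ true → star v mate a b ≡ false → act′ a b ≡ true
      act′-intro e f = ∧-true e (not-true f)

      act′-def : ∀ a b → act′ a b ≡ act a b ∧ not (star v mate a b)
      act′-def a b = refl

    K′-elim : ∀ {z} → K′ z ≡ true → K z ≡ true × z ≢ x
    K′-elim {z} e = ∧-true₁ e , true-≢ (∧-true₂ {K z} e)

    K′⊆K : ∀ {z} → K′ z ≡ true → K z ≡ true
    K′⊆K = ∧-true₁

    K′-intro : ∀ {z} → K z ≡ true → z ≢ x → K′ z ≡ true
    K′-intro a b = ∧-true a (≢-true b)

    K′x : K′ x ≡ false
    K′x = ¬true⇒false (λ e → proj₂ (K′-elim e) refl)

    Kv : K v ≡ false
    Kv = outside v∈P

    ≢v : ∀ {z} → K z ≡ true → z ≢ v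
    ≢v Kz = true≢-K {K} Kz Kv

    ≢x : ∀ {w} → w ∈ P → w ≢ x
    ≢x w∈ refl = true≢false Kx (outside w∈)

    mate-adj : ∀ {z} → mate z ≡ true → adj z v ≡ true
    mate-adj e = trans (sym (cls-sound (proj₁ (proj₂ (mate-elim e))) v∈P)) adj-xv

    act′≡act : ∀ z w → K z ≡ true → mate z ≡ false → act′ z w ≡ act z w
    act′≡act z w Kz mz = bool-ext (proj₁ ∘ act′-elim) (λ e → act′-intro e (¬true⇒false (λ h → contra (star-cases h))))
      where
      contra : (z ≡ v × mate w ≡ true) ⊎ (w ≡ v × mate z ≡ true) → ⊥
      contra (inj₁ (e , _)) = ≢v Kz e
      contra (inj₂ (_ , e)) = true≢false e mz

    active-other : ∀ z → K z ≡ true → mate z ≡ false → active act′ z ≡ active act z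
    active-other z Kz mz = count-cong (λ w → act′≡act z w Kz mz)

    active-mate : ∀ z → mate z ≡ true → active act z ≡ suc (active act′ z)
    active-mate z mz = trans (count-remove (act z) v (alive z (proj₁ (mate-elim mz)) (mate-adj mz))) (cong suc (count-cong eq))
      where
      Kz = proj₁ (mate-elim mz)
      eq : ∀ w → act z w ∧ not (w == v) ≡ act′ z w
      eq w = bool-ext
        (λ e → act′-intro (∧-true₁ e) (star-off mate (≢v Kz) (true-≢ (∧-true₂ {act z w} e))))
        (λ e → ∧-true (proj₁ (act′-elim e)) (≢-true λ { refl →
          true≢false (trans (star-at mate (≢v Kz)) mz) (proj₂ (act′-elim e)) }))

    classSize-≤ : ∀ z → classSize K′ (x ∷ P) z ≤ classSize K P z
    classSize-≤ z = count-mono (λ y e → ∧-true (K′⊆K (∧-true₁ e)) (cls-tail (∧-true₂ {K′ y} e)))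

    classSize-mate : ∀ z → mate z ≡ true → classSize K′ (x ∷ P) z < classSize K P z
    classSize-mate z mz = count-mono-< (λ y e → ∧-true (K′⊆K (∧-true₁ e)) (cls-tail (∧-true₂ {K′ y} e)))
      x (¬true⇒false (λ e → true≢false (∧-true₁ e) K′x)) (∧-true Kx (cls-sym (proj₁ (proj₂ (mate-elim mz)))))

    classSize-new : ∀ z → adj z x ≡ true → classSize K′ (x ∷ P) z < k
    classSize-new z e = subst (classSize K′ (x ∷ P) z <_) (regular x)
      (count-mono-< (λ y h → trans (adj-sym x y) (trans (sym (cls-sound (∧-true₂ {K′ y} h) (here refl))) e))
        v (¬true⇒false (λ h → true≢false (K′⊆K (∧-true₁ h)) Kv)) adj-xv)

    mate-special : ∀ z → mate z ≡ true → special x ≡ special z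
    mate-special z mz = trans (adj-sym r x) (trans (cls-sound (proj₁ (proj₂ (mate-elim mz))) r∈P) (adj-sym z r))

    cls-adj-r : ∀ {y z} → cls P z y ≡ true → special y ≡ special z
    cls-adj-r {y} {z} e = trans (adj-sym r y) (trans (sym (cls-sound e r∈P)) (adj-sym z r))

    -- If `v` is a neighbour of `r`, then both `s` and `v` are neighbours of `r` missing from the
    -- class, which leaves `k ∸ 2`. If not, a class of size `k ∸ 1` next to `x` is exactly what
    -- `crowded` excludes.
    new-cap : ∀ z → K′ z ≡ true → special z ≡ true → adj z x ≡ true → classSize K′ (x ∷ P) z ≤ k ∸ 2
    new-cap z K′z sz zx with true⊎false (adj r v)
    ... | inj₁ rv = ≤-pred (≤-pred (subst (suc (suc (classSize K′ (x ∷ P) z)) ≤_) (sym (m+[n∸m]≡n 2≤k))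
        (≤-trans (s≤s (count-mono-< {g = λ y → adj r y ∧ not (y == s)}
          (λ y h → ∧-true (trans (cls-adj-r (cls-tail (∧-true₂ {K′ y} h))) sz)
            (≢-true λ { refl → true≢false (K′⊆K (∧-true₁ h)) (outside s∈P) }))
          v (¬true⇒false (λ h → true≢false (K′⊆K (∧-true₁ h)) Kv)) (∧-true rv (≢-true v≢s))))
          (≤-reflexive (trans (sym (count-remove (adj r) s adj-rs)) (regular r))))))
    ... | inj₂ rv with ≤-<-connex (classSize K′ (x ∷ P) z) (k ∸ 2)
    ... | inj₁ h = h
    ... | inj₂ h = ⊥-elim (true≢false (crowded x (ne r∈P) (ne s∈P) (ne t∈P) (λ y → K′ y ∧ cls (x ∷ P) z y)
        (λ y e → let Ky = K′⊆K (∧-true₁ e) ; c = ∧-true₂ {K′ y} e in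
          trans (cls-adj-r (cls-tail c)) sz , true≢-K {K} Ky (outside s∈P) , true≢-K {K} Ky (outside t∈P) ,
          trans (adj-sym x y) (trans (sym (cls-sound c (here refl))) zx))
        (λ y y′ e e′ → trans (adj-sym t y) (trans (trans (sym (cls-sound (∧-true₂ {K′ y} e) (there t∈P))) (cls-sound (∧-true₂ {K′ y′} e′) (there t∈P))) (adj-sym y′ t)))
        (≤-trans (≤-reflexive (+-∸-assoc 1 {k} {2} 2≤k)) h) v adj-xv) rv)
      where
      ne : ∀ {w} → w ∈ P → x ≢ w
      ne w∈ = ≢x w∈ ∘ sym

    inv′ : Inv K′ (x ∷ P) act′
    inv′ = record
      { outside = λ { (here refl) → K′x ; (there i) → ¬true⇒false (λ e → true≢false (K′⊆K e) (outside i)) }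
      ; closed = closed′
      ; act-sym = λ a b → trans (act′-def a b) (trans (cong₂ (λ p q → p ∧ not q) (act-sym a b) (star-sym v mate a b)) (sym (act′-def b a)))
      ; act-adj = λ a b e → act-adj a b (proj₁ (act′-elim e))
      ; act-in = λ a b Ka Kb e → act′-intro (act-in a b (K′⊆K Ka) (K′⊆K Kb) e)
          (star-off mate (≢v (K′⊆K Ka)) (≢v (K′⊆K Kb)))
      ; act-cls = act-cls′
      ; r∈P = there r∈P ; s∈P = there s∈P ; t∈P = there t∈P
      ; act-r = λ z Kz → ¬true⇒false (λ e → true≢false (proj₁ (act′-elim e)) (act-r z (K′⊆K Kz)))
      ; bound₁ = bound₁′
      ; bound₂ = bound₂′
      ; cap = cap′ }
      where
      closed′ : ∀ z w → K′ z ≡ true → adj z w ≡ true → K′ w ≡ true ⊎ w ∈ x ∷ P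
      closed′ z w Kz e with closed z w (K′⊆K Kz) e
      ... | inj₂ w∈ = inj₂ (there w∈)
      ... | inj₁ Kw with w ≟F x
      ... | yes refl = inj₂ (here refl)
      ... | no w≢x = inj₁ (K′-intro Kw w≢x)
      inner : ∀ y → K′ y ≡ true → act y x ≡ adj y x
      inner y Ky = bool-ext (act-adj y x) (act-in y x (K′⊆K Ky) Kx)
      act-cls′ : ∀ y z w → K′ y ≡ true → K′ z ≡ true → cls (x ∷ P) y z ≡ true → w ∈ x ∷ P → act′ y w ≡ act′ z w
      act-cls′ y z w Ky Kz c w∈ = trans (act′-def y w) (trans (cong₂ (λ p q → p ∧ not q) (same w∈) (starred w∈)) (sym (act′-def z w)))
        where
        same : w ∈ x ∷ P → act y w ≡ act z w
        same (here refl) = trans (inner y Ky) (trans (cls-sound c (here refl)) (sym (inner z Kz)))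
        same (there i) = act-cls y z w (K′⊆K Ky) (K′⊆K Kz) (cls-tail c) i
        transfer : ∀ {y z} → K′ z ≡ true → cls (x ∷ P) y z ≡ true → mate y ≡ true → mate z ≡ true
        transfer Kz c m = mate-intro (K′⊆K Kz) (cls-trans (proj₁ (proj₂ (mate-elim m))) (cls-tail c)) (proj₂ (K′-elim Kz))
        starred : w ∈ x ∷ P → star v mate y w ≡ star v mate z w
        starred _ with w ≟F v
        ... | yes refl = trans (star-at mate (≢v (K′⊆K Ky))) (trans (bool-ext (transfer Kz c) (transfer Ky (cls-sym c)))
                (sym (star-at mate (≢v (K′⊆K Kz)))))
        ... | no w≢v = trans (star-off mate (≢v (K′⊆K Ky)) w≢v) (sym (star-off mate (≢v (K′⊆K Kz)) w≢v))
      bound₁′ : ∀ z w → K′ z ≡ true → special z ≡ false → w ∈ x ∷ P → adj z w ≡ true → classSize K′ (x ∷ P) z < active act′ z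
      bound₁′ z w Kz sz w∈ e with touched? P z | true⊎false (mate z)
      ... | inj₁ (u , u∈ , f) | inj₁ mz = ≤-trans (classSize-mate z mz)
            (≤-pred (subst (classSize K P z <_) (active-mate z mz) (bound₁ z u (K′⊆K Kz) sz u∈ f)))
      ... | inj₁ (u , u∈ , f) | inj₂ mz = ≤-trans (s≤s (classSize-≤ z))
            (subst (classSize K P z <_) (sym (active-other z (K′⊆K Kz) mz)) (bound₁ z u (K′⊆K Kz) sz u∈ f))
      ... | inj₂ h | inj₁ mz = ⊥-elim (true≢false (mate-adj mz) (h v v∈P))
      ... | inj₂ h | inj₂ mz with w∈
      ... | there i = ⊥-elim (true≢false e (h w i))
      -- Touched for the first time: all `k` edges at `z` are undecided, and its class lies among
      -- the neighbours of `x` other than `v`.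
      ... | here refl = subst (classSize K′ (x ∷ P) z <_) (sym (trans (active-other z (K′⊆K Kz) mz)
            (untouched-active inv z (K′⊆K Kz) h))) (classSize-new z e)
      bound₂′ : ∀ z → K′ z ≡ true → special z ≡ true → classSize K′ (x ∷ P) z ⊓ (k ∸ 2) < active act′ z
      bound₂′ z Kz sz with true⊎false (mate z)
      ... | inj₂ mz = ≤-trans (s≤s (⊓-monoˡ-≤ (k ∸ 2) (classSize-≤ z)))
            (subst (classSize K P z ⊓ (k ∸ 2) <_) (sym (active-other z (K′⊆K Kz) mz)) (bound₂ z (K′⊆K Kz) sz))
      -- The edge from `z` to `v` was undecided, so by `cap` the minimum was the class size itself,
      -- which drops along with the number of undecided edges.
      ... | inj₁ mz = ≤-trans (s≤s (m⊓n≤m _ (k ∸ 2))) (≤-trans (classSize-mate z mz)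
            (≤-pred (subst₂ _<_ (m≤n⇒m⊓n≡m (cap z v (K′⊆K Kz) sz v∈P (alive z (K′⊆K Kz) (mate-adj mz))))
              (active-mate z mz) (bound₂ z (K′⊆K Kz) sz))))
      cap′ : ∀ z w → K′ z ≡ true → special z ≡ true → w ∈ x ∷ P → act′ z w ≡ true → classSize K′ (x ∷ P) z ≤ k ∸ 2
      cap′ z w Kz sz (here refl) e = new-cap z Kz sz (act-adj z x (proj₁ (act′-elim e)))
      cap′ z w Kz sz (there i) e = ≤-trans (classSize-≤ z) (cap z w (K′⊆K Kz) sz i (proj₁ (act′-elim e)))

    alive′ : ∀ z → K′ z ≡ true → adj z x ≡ true → act′ z x ≡ true
    alive′ z Kz e = act′-intro (act-in z x (K′⊆K Kz) Kx e) (star-off mate (≢v (K′⊆K Kz)) (≢v Kx))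

    special-pot : ∀ {N} → Pot N K P act → ∀ z → K′ z ≡ true → special z ≡ true → N + classSize K′ (x ∷ P) z ⊓ (k ∸ 2) ≤ active act′ z
    special-pot {N} pot z Kz sz with true⊎false (mate z)
    ... | inj₂ mz = ≤-trans (+-monoʳ-≤ N (⊓-monoˡ-≤ (k ∸ 2) (classSize-≤ z)))
          (subst (N + classSize K P z ⊓ (k ∸ 2) ≤_) (sym (active-other z (K′⊆K Kz) mz)) (proj₂ (pot z (K′⊆K Kz)) sz))
    ... | inj₁ mz = ≤-pred (≤-trans (≤-reflexive (sym (+-suc N _))) (≤-trans (+-monoʳ-≤ N (≤-trans (s≤s (m⊓n≤m _ (k ∸ 2))) (classSize-mate z mz)))
          (subst₂ _≤_ (cong (N +_) (m≤n⇒m⊓n≡m (cap z v (K′⊆K Kz) sz v∈P (alive z (K′⊆K Kz) (mate-adj mz)))))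
            (active-mate z mz) (proj₂ (pot z (K′⊆K Kz)) sz))))

    other-pot : ∀ {N} → Pot N K P act → ∀ z → K′ z ≡ true → mate z ≡ false → special z ≡ false →
      N ≤ active act′ z × (2 ≤ classSize K′ (x ∷ P) z → suc N ≤ active act′ z)
    other-pot {N} pot z Kz mz sz rewrite active-other z (K′⊆K Kz) mz =
      let a , b = proj₁ (pot z (K′⊆K Kz)) sz in a , λ h → b (≤-trans h (classSize-≤ z))

    mate-pot : ∀ {N} → Pot N K P act → ∀ z → mate z ≡ true → special z ≡ false → N ≤ active act′ z
    mate-pot {N} pot z mz sz = ≤-pred (subst (suc N ≤_) (active-mate z mz) (proj₂ (proj₁ (pot z Kz) sz)
      (≤-trans (s≤s (classSize-pos′ z mz)) (classSize-mate z mz))))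
      where
      Kz = proj₁ (mate-elim mz)
      classSize-pos′ : ∀ z → mate z ≡ true → 1 ≤ classSize K′ (x ∷ P) z
      classSize-pos′ z mz = classSize-pos {K′} {x ∷ P} (K′-intro (proj₁ (mate-elim mz)) (proj₂ (proj₂ (mate-elim mz))))

    classSize-same : ∀ z → mate z ≡ true → classSize K P z ≡ classSize K P x
    classSize-same z mz = count-cong (λ y → cong (K y ∧_) (bool-ext (cls-trans c) (cls-trans (cls-sym c))))
      where c = proj₁ (proj₂ (mate-elim mz))

    -- A mate loses one undecided edge. If the class had at most two members, the mate is now alone
    -- in its class and the stronger clause for classes of two or more is void. If `x` is special,
    -- so are its mates, and both sides of their inequality drop by one.
    pot-small : ∀ {N} → classSize K P x ≤ 2 ⊎ special x ≡ true → Pot N K P act → Pot N K′ (x ∷ P) act′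
    pot-small {N} small pot z Kz = ordinary small , special-pot pot z Kz
      where
      ordinary : classSize K P x ≤ 2 ⊎ special x ≡ true → special z ≡ false →
        N ≤ active act′ z × (2 ≤ classSize K′ (x ∷ P) z → suc N ≤ active act′ z)
      ordinary small sz with true⊎false (mate z)
      ordinary _ sz | inj₂ mz = other-pot pot z Kz mz sz
      ordinary (inj₂ sx) sz | inj₁ mz = ⊥-elim (true≢false (trans (sym (mate-special z mz)) sx) sz)
      ordinary (inj₁ p≤2) sz | inj₁ mz = mate-pot pot z mz sz ,
            λ h → ⊥-elim (<-irrefl refl (≤-trans (s≤s h) (≤-trans (classSize-mate z mz) (≤-trans (≤-reflexive (classSize-same z mz)) p≤2))))

    -- A mate shared its class with `x`, so it had at least `suc (suc N)` undecided edges and keeps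
    -- `suc N`, enough for either clause. The number given up here is won back in `gain-family`.
    pot-gain : ∀ {N} → Pot (suc N) K P act → Pot N K′ (x ∷ P) act′
    pot-gain {N} pot z Kz = ordinary , λ sz → ≤-trans (n≤1+n _) (special-pot pot z Kz sz)
      where
      ordinary : special z ≡ false → N ≤ active act′ z × (2 ≤ classSize K′ (x ∷ P) z → suc N ≤ active act′ z)
      ordinary sz with true⊎false (mate z)
      ... | inj₁ mz = ≤-trans (n≤1+n N) (mate-pot pot z mz sz) , λ _ → mate-pot pot z mz sz
      ... | inj₂ mz = let a , b = other-pot pot z Kz mz sz in ≤-trans (n≤1+n N) a , λ h → ≤-trans (n≤1+n (suc N)) (b h)

    -- The edges decided in the step form a star at v: those to g are blue, where g is {x}, the set
    -- of class mates of x, or empty.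
    module Assemble (c : Bool) (lamF : Lab) (forestGood : ForestGood K′ P act′ x lamF)
      (g : V → Bool) (g⊆ : ∀ y → g y ≡ true → y ≡ x ⊎ mate y ≡ true)
      (g-mate : ∀ y → mate y ≡ true → g y ≢ g x)
      (g-special : special x ≡ true → g x ≡ true)
      (g-into : c ≡ true → ∃[ y ] g y ≡ true)
      (g-none : c ≡ false → ∀ y → g y ≡ false)
      (only : c ≡ false → ∀ z → K z ≡ true → adj z v ≡ true → z ≡ x) where
      private
        module F = ForestGood forestGood

        region : V → V → Bool
        region a b = (K′ a ∨ K′ b) ∧ act′ a b

      opaque
        lam : Lab
        lam a b = if region a b then lamF a b else star v g a b

        lam-in : ∀ {a b} → region a b ≡ true → lam a b ≡ lamF a b
        lam-in e rewrite e = refl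

        lam-out : ∀ {a b} → region a b ≡ false → lam a b ≡ star v g a b
        lam-out e rewrite e = refl

      private
        region-sym : ∀ a b → region a b ≡ region b a
        region-sym a b = cong₂ _∧_ (∨-comm (K′ a) (K′ b)) (Inv.act-sym inv′ a b)

        region-K : ∀ a b → region a b ≡ true → K a ∨ K b ≡ true
        region-K a b e with ∨-cases {K′ a} (∧-true₁ e)
        ... | inj₁ h = ∨-true₁ (K′⊆K h)
        ... | inj₂ h = ∨-true₂ {K a} (K′⊆K h)

        region-act : ∀ a b → region a b ≡ true → act a b ≡ true
        region-act a b e = proj₁ (act′-elim (∧-true₂ {K′ a ∨ K′ b} e))

        K-of : ∀ y → y ≡ x ⊎ mate y ≡ true → K y ≡ true
        K-of y (inj₁ refl) = Kx
        K-of y (inj₂ m) = proj₁ (mate-elim m)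

        adj-of : ∀ y → y ≡ x ⊎ mate y ≡ true → adj y v ≡ true
        adj-of y (inj₁ refl) = adj-xv
        adj-of y (inj₂ m) = mate-adj m

        outside-region : ∀ y → y ≡ x ⊎ mate y ≡ true → region y v ≡ false
        outside-region y h = ¬true⇒false (λ e → absurd h (∨-cases {K′ y} (∧-true₁ e)) (∧-true₂ {K′ y ∨ K′ v} e))
          where
          absurd : y ≡ x ⊎ mate y ≡ true → K′ y ≡ true ⊎ K′ v ≡ true → act′ y v ≡ true → ⊥
          absurd _ (inj₂ f) _ = true≢false (K′⊆K f) Kv
          absurd (inj₁ refl) (inj₁ f) _ = true≢false f K′x
          absurd (inj₂ m) (inj₁ f) a = true≢false (trans (star-at mate (≢v (proj₁ (mate-elim m)))) m) (proj₂ (act′-elim a))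

        lam-v : ∀ y → y ≡ x ⊎ mate y ≡ true → lam y v ≡ g y
        lam-v y h = trans (lam-out (outside-region y h)) (star-at g (≢v (K-of y h)))

        star-region : ∀ a b → star v g a b ≡ true → region a b ≡ false × (K a ∨ K b) ∧ act a b ≡ true
        star-region a b e with star-cases e
        ... | inj₁ (refl , gb) = trans (region-sym v b) (outside-region b (g⊆ b gb)) ,
              ∧-true (∨-true₂ {K v} (K-of b (g⊆ b gb))) (trans (act-sym v b) (alive b (K-of b (g⊆ b gb)) (adj-of b (g⊆ b gb))))
        ... | inj₂ (refl , ga) = outside-region a (g⊆ a ga) ,
              ∧-true (∨-true₁ (K-of a (g⊆ a ga))) (alive a (K-of a (g⊆ a ga)) (adj-of a (g⊆ a ga)))

        gv : g v ≡ false
        gv = ¬true⇒false (λ e → true≢false (K-of v (g⊆ v e)) Kv)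

      blue-lam : blue K act lam ≡ blue K′ act′ lamF + (count g + count g)
      blue-lam = begin
        blue K act lam ≡⟨ Σ-cong (λ a → Σ-cong (λ b → split a b)) ⟩
        Σᶠ (λ a → Σᶠ (λ b → ⟦ region a b ∧ lamF a b ⟧ + ⟦ star v g a b ⟧)) ≡⟨ Σ-cong (λ a → Σ-+ _ _) ⟩
        Σᶠ (λ a → Σᶠ (λ b → ⟦ region a b ∧ lamF a b ⟧) + Σᶠ (λ b → ⟦ star v g a b ⟧)) ≡⟨ Σ-+ _ _ ⟩
        blue K′ act′ lamF + Σᶠ (λ a → Σᶠ (λ b → ⟦ star v g a b ⟧)) ≡⟨ cong (blue K′ act′ lamF +_) (star-Σ v g gv) ⟩
        blue K′ act′ lamF + (count g + count g) ∎
        where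
        open ≡-Reasoning
        split : ∀ a b → ⟦ ((K a ∨ K b) ∧ act a b) ∧ lam a b ⟧ ≡ ⟦ region a b ∧ lamF a b ⟧ + ⟦ star v g a b ⟧
        split a b with true⊎false (region a b)
        ... | inj₁ e = trans (cong ⟦_⟧ (trans (cong₂ _∧_ (∧-true (region-K a b e) (region-act a b e)) (lam-in e)) (sym (cong (_∧ lamF a b) e))))
              (trans (sym (+-identityʳ _)) (cong (λ u → ⟦ region a b ∧ lamF a b ⟧ + ⟦ u ⟧)
                (sym (¬true⇒false (λ h → true≢false e (proj₁ (star-region a b h)))))))
        ... | inj₂ e = trans (cong ⟦_⟧ (trans (cong (((K a ∨ K b) ∧ act a b) ∧_) (lam-out e))
              (bool-ext (∧-true₂ {(K a ∨ K b) ∧ act a b}) (λ h → ∧-true (proj₂ (star-region a b h)) h))))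
              (cong (λ u → ⟦ u ∧ lamF a b ⟧ + ⟦ star v g a b ⟧) (sym e))

      private
        lam-K′ : ∀ z w → K′ z ≡ true → act′ z w ≡ true → lam z w ≡ lamF z w
        lam-K′ z w Kz a = lam-in (∧-true (∨-true₁ Kz) a)

        lam-symm : ∀ a b → lam a b ≡ lam b a
        lam-symm a b with true⊎false (region a b)
        ... | inj₁ e = trans (lam-in e) (trans (F.lam-sym a b) (sym (lam-in (trans (region-sym b a) e))))
        ... | inj₂ e = trans (lam-out e) (trans (star-sym v g a b) (sym (lam-out (trans (region-sym b a) e))))

        -- The blue edge owed to `x` always leads down into the forest, which leaves the colour of
        -- `xv` free; a special `x` takes `xv` as its second one.
        child : ∃[ w ] (K′ w ≡ true × act x w ≡ true × lam x w ≡ true)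
        child with w , Kw , a , l ← F.into = w , Kw , trans (act-sym x w) (proj₁ (act′-elim a)) ,
          trans (lam-symm x w) (trans (lam-K′ w x Kw a) l)

        rigid : Rigid K P act lam
        rigid φ fix Kφ pres = fixes
          where
          φx : at φ x ≡ x
          φx with at φ x ≟F x
          ... | yes e = e
          -- Otherwise `x` goes to a mate, whose edge to the fixed vertex `v` has the other colour.
          ... | no ne = ⊥-elim (g-mate (at φ x) m (trans (sym (lam-v (at φ x) (inj₂ m))) (trans (sym (cong (lam (at φ x)) (fix v v∈P)))
                  (trans (pres x v (∨-true₁ Kx) (alive x Kx adj-xv)) (lam-v x (inj₁ refl))))))
            where
            m : mate (at φ x) ≡ true
            m = mate-intro (trans (Kφ x) Kx) (cls-sym (cls-fixed φ fix x)) ne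
          fix′ : ∀ w → w ∈ x ∷ P → at φ w ≡ w
          fix′ w (here refl) = φx
          fix′ w (there i) = fix w i
          K′φ : ∀ z → K′ (at φ z) ≡ K′ z
          K′φ z = bool-ext (λ e → K′-intro (trans (sym (Kφ z)) (K′⊆K e)) (λ { refl → proj₂ (K′-elim e) φx }))
            (λ e → K′-intro (trans (Kφ z) (K′⊆K e)) (λ h → proj₂ (K′-elim e) (aut-injective φ (trans h (sym φx)))))
          pres′ : Preserves φ K′ act′ lamF
          pres′ a b m e = trans (sym (lam-in (∧-true (trans (cong₂ _∨_ (K′φ a) (K′φ b)) m) (trans (act-invariant inv′ φ fix′ K′φ a b m) e))))
            (trans (pres a b (region-K a b (∧-true m e)) (proj₁ (act′-elim e))) (lam-in (∧-true m e)))
          fixes : ∀ z → K z ≡ true → at φ z ≡ z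
          fixes z Kz with z ≟F x
          ... | yes refl = φx
          ... | no ne = F.rigid φ fix′ K′φ pres′ z (K′-intro Kz ne)

        blue₁ : Blue₁ K act lam
        blue₁ z Kz with z ≟F x
        ... | yes refl = let w , _ , a , l = child in w , a , l
        ... | no ne with w , a , l ← F.blue₁ z (K′-intro Kz ne) = w , proj₁ (act′-elim a) , trans (lam-K′ z w (K′-intro Kz ne) a) l

        blue₂ : Blue₂ K act lam
        blue₂ z Kz sz with z ≟F x
        ... | yes refl = let w , Kw , a , l = child in v , w , ≢v (K′⊆K Kw) ∘ sym ,
              (alive x Kx adj-xv , trans (lam-v x (inj₁ refl)) (g-special sz)) , (a , l)
        ... | no ne with w , w′ , d , (a , l) , (a′ , l′) ← F.blue₂ z (K′-intro Kz ne) sz =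
              w , w′ , d , (proj₁ (act′-elim a) , trans (lam-K′ z w (K′-intro Kz ne) a) l) ,
              (proj₁ (act′-elim a′) , trans (lam-K′ z w′ (K′-intro Kz ne) a′) l′)

      assembled : Good K P act v c lam
      assembled = record
        { lam-sym = lam-symm
        ; rigid = rigid
        ; blue₁ = blue₁
        ; blue₂ = blue₂
        ; into = λ e → let y , gy = g-into e in y , K-of y (g⊆ y gy) , alive y (K-of y (g⊆ y gy)) (adj-of y (g⊆ y gy)) ,
            trans (lam-v y (g⊆ y gy)) gy
        ; none = λ e z Kz a → trans (lam-v z (inj₁ (only e z Kz (act-adj z v a)))) (g-none e z) }

    module _ {m} (Ks : Fin (suc m) → V → Bool) (root : Fin (suc m) → V) (leaf : Fin (suc m) → Bool)
      (isForest : IsForest P x K′ Ks root leaf) (solve : ∀ i → Solvable (Ks i) (root i) (leaf i)) where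

      forest : ∀ τ → Pot (suc τ) K′ (x ∷ P) act′ → Family K′ act′ (ForestGood K′ P act′ x) (suc τ)
      forest = forest-family P x act′ K′ Ks root leaf isForest inv′ alive′ (≢x s∈P ∘ sym) (≢x r∈P ∘ sym) v v∈P adj-xv solve

      private
        single : V → Bool
        single y = y == x

        mates-differ : ∀ y → mate y ≡ true → single y ≢ single x
        mates-differ y m e = proj₂ (proj₂ (mate-elim m)) (==-sound (trans e (==-refl x)))

        module Plain lamF fg = Assemble true lamF fg single (λ y e → inj₁ (==-sound e)) mates-differ
          (λ _ → ==-refl x) (λ _ → x , ==-refl x) (λ ()) (λ ())

        plain : ∀ {b} → ∃[ lamF ] (ForestGood K′ P act′ x lamF × blue K′ act′ lamF ≡ b) →
          ∃[ lam ] (Good K P act v true lam × blue K act lam ≡ b + 2)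
        plain (lamF , fg , refl) = A.lam , A.assembled , trans A.blue-lam (cong (λ u → blue K′ act′ lamF + (u + u)) (count-single x))
          where module A = Plain lamF fg

        plain-family : ∀ {N} → Family K′ act′ (ForestGood K′ P act′ x) N → Family K act (Good K P act v true) N
        plain-family (S , uS , lS , aS) = map (_+ 2) S , Uniqueₚ.map⁺ (+-cancelʳ-≡ 2 _ _) uS , trans (length-map _ S) lS ,
          Allₚ.map⁺ (All.map plain aS)

        -- Making `xv` blue adds 2 to each number. Making instead the edges to the mates blue, of
        -- which there are at least two, adds at least 4; applied to the largest number `M`, this
        -- exceeds all the others.
        gain-family : ∀ {N} → 1 ≤ N → special x ≡ false → 3 ≤ classSize K P x →
          Family K′ act′ (ForestGood K′ P act′ x) N → Family K act (Good K P act v true) (suc N)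
        gain-family {N} 1≤N sx 3≤p (S , uS , lS , aS)
          with M , M∈ , M≥ ← maximal S (subst (1 ≤_) (sym lS) 1≤N)
          with lamF , fg , e ← All.lookup aS M∈ =
          (M + (count mate + count mate)) ∷ map (_+ 2) S ,
          (Allₚ.map⁺ (All.tabulate (λ {b} b∈ h → <⇒≢ (+-mono-≤-< (M≥ b∈) four) (sym h))) ∷ Uniqueₚ.map⁺ (+-cancelʳ-≡ 2 _ _) uS) ,
          cong suc (trans (length-map _ S) lS) ,
          (A.lam , A.assembled , trans A.blue-lam (cong (_+ (count mate + count mate)) e)) ∷ Allₚ.map⁺ (All.map plain aS)
          where
          two : 2 ≤ count mate
          two = ≤-pred (subst (3 ≤_) count-mate 3≤p)
          four : 2 < count mate + count mate
          four = ≤-trans (s≤s (s≤s (s≤s z≤n))) (+-mono-≤ two two)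
          mate-x : mate x ≡ false
          mate-x = ¬true⇒false (λ m → proj₂ (proj₂ (mate-elim m)) refl)
          module A = Assemble true lamF fg mate (λ y → inj₂) (λ y m h → true≢false m (trans h mate-x))
            (λ sx′ → ⊥-elim (true≢false sx′ sx)) (λ _ → count-find mate (≤-trans (s≤s z≤n) two)) (λ ()) (λ ())

        red-family : ∀ {N} → special x ≡ false → (∀ z → K z ≡ true → adj z v ≡ true → z ≡ x) →
          Family K′ act′ (ForestGood K′ P act′ x) N → Family K act (Good K P act v false) N
        red-family sx only (S , uS , lS , aS) = S , uS , lS , All.map red aS
          where
          red : ∀ {b} → ∃[ lamF ] (ForestGood K′ P act′ x lamF × blue K′ act′ lamF ≡ b) →
            ∃[ lam ] (Good K P act v false lam × blue K act lam ≡ b)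
          red (lamF , fg , refl) = A.lam , A.assembled , trans A.blue-lam
              (trans (cong (λ u → blue K′ act′ lamF + (u + u)) (count-none (λ _ → refl))) (+-identityʳ _))
            where
            module A = Assemble false lamF fg (λ _ → false) (λ _ ())
              (λ y m _ → proj₂ (proj₂ (mate-elim m)) (only y (proj₁ (mate-elim m)) (mate-adj m)))
              (λ sx′ → ⊥-elim (true≢false sx′ sx)) (λ ()) (λ _ _ → refl) (λ _ → only)

      node-family : ∀ c N → 1 ≤ N → Pot N K P act →
        (c ≡ false → special x ≡ false × (∀ z → K z ≡ true → adj z v ≡ true → z ≡ x)) →
        Family K act (Good K P act v c) N
      node-family false (suc N) _ pot red = red-family (proj₁ (red refl)) (proj₂ (red refl)) (forest N (pot-small (inj₁ p≤2) pot))
        where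
        p≤2 : classSize K P x ≤ 2
        p≤2 = ≤-trans (≤-reflexive (trans count-mate (cong suc (count-none (λ y → ¬true⇒false (λ m →
          proj₂ (proj₂ (mate-elim m)) (proj₂ (red refl) y (proj₁ (mate-elim m)) (mate-adj m)))))))) (s≤s z≤n)
      node-family true (suc N) _ pot _ with ≤-<-connex (classSize K P x) 2 | true⊎false (special x)
      ... | inj₁ p≤2 | _ = plain-family (forest N (pot-small (inj₁ p≤2) pot))
      ... | inj₂ _ | inj₁ sx = plain-family (forest N (pot-small (inj₂ sx) pot))
      ... | inj₂ p≥3 | inj₂ sx with N
      -- Here `pot-gain` would leave nothing, but for a single number the new invariant suffices.
      ... | zero = plain-family (forest 0 (pot-one inv′))
      ... | suc N′ = gain-family (s≤s z≤n) sx p≥3 (forest N′ (pot-gain pot))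

  -- Depth-first search trees and the induction along them

  record IsNode (K : V → Bool) (x : V) {m} (Ks : Fin m → V → Bool) (root : Fin m → V) : Set where
    field
      root∈ : K x ≡ true
      cover : ∀ z → K z ≡ true → z ≢ x → ∃[ i ] Ks i z ≡ true
      sub : ∀ i z → Ks i z ≡ true → K z ≡ true × z ≢ x
      disjoint : ∀ i j z → Ks i z ≡ true → Ks j z ≡ true → i ≡ j
      -- Characteristic of depth-first search. It makes each branch closed up to `x` and the
      -- explored vertices, so that the branches can be solved independently.
      separated : ∀ i j a b → Ks i a ≡ true → Ks j b ≡ true → adj a b ≡ true → i ≡ j
      child : ∀ i → adj (root i) x ≡ true

  data Tree : (V → Bool) → V → Bool → Set where
    leaf : ∀ {K x} → K x ≡ true → (∀ z → K z ≡ true → z ≡ x) → Tree K x true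
    node : ∀ {m K x} (Ks : Fin (suc m) → V → Bool) (root : Fin (suc m) → V) (lf : Fin (suc m) → Bool) → IsNode K x Ks root →
           (∀ i → Tree (Ks i) (root i) (lf i)) → Tree K x false

  tree-root : ∀ {K x l} → Tree K x l → K x ≡ true
  tree-root (leaf Kx _) = Kx
  tree-root (node _ _ _ isNode _) = IsNode.root∈ isNode

  tree-leaf : ∀ {K x} → Tree K x true → ∀ z → K z ≡ true → z ≡ x
  tree-leaf (leaf _ only) = only

  tree-connected : ∀ {K x l} → Tree K x l → (C : V → Bool) → C x ≡ true →
    (∀ a b → K a ≡ true → K b ≡ true → adj a b ≡ true → C a ≡ true → C b ≡ true) → ∀ z → K z ≡ true → C z ≡ true
  tree-connected (leaf _ only) C Cx step z Kz = subst (λ y → C y ≡ true) (sym (only z Kz)) Cx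
  tree-connected {x = x} (node Ks root lf isNode ts) C Cx step z Kz with z ≟F x
  ... | yes refl = Cx
  ... | no ne with i , iz ← IsNode.cover isNode z Kz ne =
    tree-connected (ts i) C (step x (root i) root∈ (proj₁ (sub i _ (tree-root (ts i)))) (trans (adj-sym x _) (child i)) Cx)
      (λ a b ia ib → step a b (proj₁ (sub i a ia)) (proj₁ (sub i b ib))) z iz
    where open IsNode isNode

  node-forest : ∀ {K x m} {Ks : Fin m → V → Bool} {root : Fin m → V} {lf : Fin m → Bool} {P} → IsNode K x Ks root → (∀ i → Tree (Ks i) (root i) (lf i)) →
    (∀ z w → K z ≡ true → adj z w ≡ true → K w ≡ true ⊎ w ∈ P) → IsForest P x (delete K x) Ks root lf
  node-forest {K} {x} {Ks = Ks} {P = P} isNode ts closed = record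
    { cover = λ z e → cover z (∧-true₁ e) (true-≢ (∧-true₂ {K z} e))
    ; sub = λ i z e → ∧-true (proj₁ (sub i z e)) (≢-true (proj₂ (sub i z e)))
    ; disjoint = disjoint
    ; closed = closedᵢ
    ; connected = λ i → tree-connected (ts i)
    ; root∈ = λ i → tree-root (ts i)
    ; root-adj = child
    ; leaf-only = λ i e → tree-leaf (subst (Tree _ _) e (ts i)) }
    where
    open IsNode isNode
    closedᵢ : ∀ i z w → Ks i z ≡ true → adj z w ≡ true → Ks i w ≡ true ⊎ w ∈ x ∷ P
    closedᵢ i z w iz e with closed z w (proj₁ (sub i z iz)) e
    ... | inj₂ w∈ = inj₂ (there w∈)
    ... | inj₁ Kw with w ≟F x
    ... | yes refl = inj₂ (here refl)
    ... | no ne with j , jw ← cover w Kw ne with refl ← separated i j z w iz jw e = inj₁ jw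

  tree-solvable : Crowded → ∀ {K x l} → Tree K x l → Solvable K x l
  tree-solvable crowded (leaf Kx only) = leaf-solvable Kx only
  tree-solvable crowded {K} {x} (node Ks root lf isNode ts) P v act c N 1≤N inv v∈P v≢s v≢r adj-xv alive pot red =
    Step.node-family crowded K x (IsNode.root∈ isNode) P v act inv v∈P v≢s v≢r adj-xv alive Ks root lf
      (node-forest isNode ts (Inv.closed inv)) (λ i → tree-solvable crowded (ts i)) c N 1≤N pot (λ e → proj₂ (red e))

-- Depth-first search

opaque
  someᵇ : ∀ {m} → (Fin m → Bool) → Bool
  someᵇ f = does (any? (λ i → f i ≟B true))

  someᵇ-sound : ∀ {m} (f : Fin m → Bool) → someᵇ f ≡ true → ∃[ i ] f i ≡ true
  someᵇ-sound f = ≡true-dec (any? (λ i → f i ≟B true))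

  someᵇ-complete : ∀ {m} (f : Fin m → Bool) i → f i ≡ true → someᵇ f ≡ true
  someᵇ-complete f i e = dec-≡true (any? (λ i → f i ≟B true)) (i , e)

module Search {n : ℕ} (Γ : Context n) (r s t : Fin n) (adj-rs : Context.adj Γ r s ≡ true) where
  open Labellings Γ
  open Rooted r s t adj-rs
  open Trees Γ r s t adj-rs

  -- `U` is the set of unvisited vertices. By `exhausts` each branch takes all that it can reach in
  -- `U`; this implies the absence of edges between branches and, in a connected graph, that nothing
  -- is left over.
  record SearchForest (x : V) (U : V → Bool) : Set where
    field
      size : ℕ
      Ks : Fin size → V → Bool
      root : Fin size → V
      lf : Fin size → Bool
      trees : ∀ i → Tree (Ks i) (root i) (lf i)
      sub : ∀ i z → Ks i z ≡ true → U z ≡ true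
      disjoint : ∀ i j z → Ks i z ≡ true → Ks j z ≡ true → i ≡ j
      child : ∀ i → adj (root i) x ≡ true
      exhausts-root : ∀ w → U w ≡ true → adj x w ≡ true → ∃[ i ] Ks i w ≡ true
      exhausts : ∀ i z w → Ks i z ≡ true → U w ≡ true → adj z w ≡ true → Ks i w ≡ true

  graft : (y : V) (U : V → Bool) → U y ≡ true → SearchForest y (λ z → U z ∧ not (z == y)) →
    Σ[ K ∈ (V → Bool) ] Σ[ l ∈ Bool ] (Tree K y l × (∀ z → K z ≡ true → U z ≡ true) ×
      (∀ z w → K z ≡ true → U w ≡ true → adj z w ≡ true → K w ≡ true))
  graft y U Uy F = K , proj₁ (tree size refl) , proj₂ (tree size refl) , K⊆ , K-closed
    where
    open SearchForest F
    K : V → Bool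
    K z = (z == y) ∨ someᵇ (λ i → Ks i z)

    K-cases : ∀ {z} → K z ≡ true → z ≡ y ⊎ ∃[ i ] Ks i z ≡ true
    K-cases {z} e with ∨-cases {z == y} e
    ... | inj₁ h = inj₁ (==-sound h)
    ... | inj₂ h = inj₂ (someᵇ-sound _ h)

    Ky : K y ≡ true
    Ky = ∨-true₁ (==-refl y)

    K-sub : ∀ i z → Ks i z ≡ true → K z ≡ true
    K-sub i z e = ∨-true₂ {z == y} (someᵇ-complete (λ i → Ks i z) i e)

    K⊆ : ∀ z → K z ≡ true → U z ≡ true
    K⊆ z e with K-cases e
    ... | inj₁ refl = Uy
    ... | inj₂ (i , h) = ∧-true₁ (sub i z h)

    K-closed : ∀ z w → K z ≡ true → U w ≡ true → adj z w ≡ true → K w ≡ true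
    K-closed z w Kz Uw e with w ≟F y
    ... | yes refl = Ky
    ... | no w≢y with K-cases Kz
    ... | inj₁ refl with i , h ← exhausts-root w (∧-true Uw (≢-true w≢y)) e = K-sub i w h
    ... | inj₂ (i , h) = K-sub i w (exhausts i z w h (∧-true Uw (≢-true w≢y)) e)

    tree : ∀ m → size ≡ m → Σ[ l ∈ Bool ] Tree K y l
    tree zero refl = true , leaf Ky only
      where
      only : ∀ z → K z ≡ true → z ≡ y
      only z Kz with K-cases Kz
      ... | inj₁ h = h
    tree (suc m) refl = false , node Ks root lf isNode trees
      where
      cover : ∀ z → K z ≡ true → z ≢ y → ∃[ i ] Ks i z ≡ true
      cover z Kz ne with K-cases Kz
      ... | inj₁ h = ⊥-elim (ne h)
      ... | inj₂ h = h
      isNode : IsNode K y Ks root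
      isNode = record
        { root∈ = Ky
        ; cover = cover
        ; sub = λ i z e → K-sub i z e , true-≢ (∧-true₂ {U z} (sub i z e))
        ; disjoint = disjoint
        ; separated = λ i j a b ia jb e → disjoint i j b (exhausts i a b ia (sub j b jb) e) jb
        ; child = child }

  -- The branch of one neighbour `y` is completed first; then the search resumes at the same `x`
  -- among the vertices that this branch left over. The set `U` shrinks in both calls.
  search : ∀ fuel x U → count U ≤ fuel → SearchForest x U
  search fuel x U h with any? (λ y → (U y ∧ adj x y) ≟B true)
  ... | no none = record
    { size = 0 ; Ks = λ () ; root = λ () ; lf = λ () ; trees = λ () ; sub = λ () ; disjoint = λ () ; child = λ ()
    ; exhausts-root = λ w Uw e → ⊥-elim (none (w , ∧-true Uw e)) ; exhausts = λ () }
  search zero x U h | yes (y , e) = ⊥-elim (1+n≰n (≤-trans (count-pos y (∧-true₁ e)) h))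
  search (suc fuel) x U h | yes (y , e)
    with K , l , tr , K⊆ , K-closed ← graft y U (∧-true₁ e) (search fuel y (λ z → U z ∧ not (z == y))
           (≤-pred (subst (_≤ suc fuel) (count-remove U y (∧-true₁ e)) h))) =
    record
      { size = suc F.size
      ; Ks = K ◂ F.Ks
      ; root = y ◂ F.root
      ; lf = l ◂ F.lf
      ; trees = λ { zero → tr ; (suc i) → F.trees i }
      ; sub = λ { zero → K⊆ ; (suc i) z p → ∧-true₁ (F.sub i z p) }
      ; disjoint = λ { zero zero z p q → refl
                     ; zero (suc j) z p q → ⊥-elim (true≢false p (true-not (∧-true₂ {U z} (F.sub j z q))))
                     ; (suc i) zero z p q → ⊥-elim (true≢false q (true-not (∧-true₂ {U z} (F.sub i z p))))
                     ; (suc i) (suc j) z p q → cong suc (F.disjoint i j z p q) }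
      ; child = λ { zero → trans (adj-sym y x) (∧-true₂ {U y} e) ; (suc i) → F.child i }
      ; exhausts-root = exhausts-root′
      ; exhausts = exhausts′ }
    where
    U₂ : V → Bool
    U₂ z = U z ∧ not (K z)
    U₂<U : count U₂ < count U
    U₂<U = count-mono-< (λ z → ∧-true₁) y (¬true⇒false (λ p → true≢false (tree-root tr) (true-not (∧-true₂ {U y} p)))) (∧-true₁ e)
    module F = SearchForest (search fuel x U₂ (≤-pred (≤-trans U₂<U h)))
    exhausts-root′ : ∀ w → U w ≡ true → adj x w ≡ true → ∃[ i ] (K ◂ F.Ks) i w ≡ true
    exhausts-root′ w Uw a with true⊎false (K w)
    ... | inj₁ p = zero , p
    ... | inj₂ p with i , q ← F.exhausts-root w (∧-true Uw (not-true p)) a = suc i , q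
    exhausts′ : ∀ i z w → (K ◂ F.Ks) i z ≡ true → U w ≡ true → adj z w ≡ true →
      (K ◂ F.Ks) i w ≡ true
    exhausts′ zero z w p Uw a = K-closed z w p Uw a
    exhausts′ (suc i) z w p Uw a with true⊎false (K w)
    ... | inj₂ q = F.exhausts i z w p (∧-true Uw (not-true q)) a
    ... | inj₁ q = ⊥-elim (true≢false (K-closed w z q (∧-true₁ (F.sub i z p)) (trans (adj-sym w z) a))
                     (true-not (∧-true₂ {U z} (F.sub i z p))))

-- The root gadget

open Stars

count-remove-≤ : ∀ {n} (f : Fin n → Bool) x → count f ≤ suc (count (λ i → f i ∧ not (i == x)))
count-remove-≤ f x with true⊎false (f x)
... | inj₁ e = ≤-reflexive (count-remove f x e)
... | inj₂ e = ≤-trans (count-mono (λ i fi → ∧-true fi (≢-true λ { refl → true≢false fi e }))) (n≤1+n _)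

count-remove-none : ∀ {n} (f : Fin n → Bool) x → f x ≡ false → count f ≤ count (λ i → f i ∧ not (i == x))
count-remove-none f x e = count-mono (λ i fi → ∧-true fi (≢-true λ { refl → true≢false fi e }))

module Distinguish {n : ℕ} (Γ : Context n) where
  open Labellings Γ

  DistinguishingLab : Set
  DistinguishingLab = Σ[ lam ∈ Lab ] ((∀ a b → lam a b ≡ lam b a) ×
    (∀ (φ : Aut) → (∀ a b → adj a b ≡ true → lam (at φ a) (at φ b) ≡ lam a b) → ∀ z → at φ z ≡ z))

  -- `connected` says that the graph without `r` and `s` is connected, in terms of sets closed under
  -- adjacency. `common` and `capped` are what the fields `bound₂` and `cap` of the invariant
  -- require at the start.
  record Gadget (r s t : V) : Set where
    field
      adj-rs : adj r s ≡ true
      adj-st : adj s t ≡ true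
      t≢r : t ≢ r
      connected : ∀ (W : V → Bool) → (∀ a b → a ≢ r → a ≢ s → b ≢ r → b ≢ s → adj a b ≡ true → W a ≡ true → W b ≡ true) →
        W t ≡ true → ∀ z → z ≢ r → z ≢ s → W z ≡ true
      crowded : Trees.Crowded Γ r s t adj-rs
      common : ∀ z → adj r z ≡ true → adj s z ≡ true → z ≢ t → count (λ y → (adj r y ∧ adj s y) ∧ not (y == t)) < k ∸ 2
      capped : ∀ z → adj r z ≡ true → z ≢ s → z ≢ t → adj t z ≡ true →
        count (λ y → ((adj r y ∧ not (y == s)) ∧ not (y == t)) ∧ adj t y) ≤ k ∸ 2

  module _ {r s t : V} (gadget : Gadget r s t) where
    open Gadget gadget
    open Rooted r s t adj-rs
    open Forests Γ r s t adj-rs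
    open Trees Γ r s t adj-rs
    open Search Γ r s t adj-rs

    private
      r≢s : r ≢ s
      r≢s = adj-≢ adj-rs
      s≢t : s ≢ t
      s≢t = adj-≢ adj-st
      adj-sr : adj s r ≡ true
      adj-sr = trans (adj-sym s r) adj-rs
      adj-ts : adj t s ≡ true
      adj-ts = trans (adj-sym t s) adj-st

      off : V → Bool
      off z = not (z == r) ∧ not (z == s)

      off-intro : ∀ {z} → z ≢ r → z ≢ s → off z ≡ true
      off-intro a b = ∧-true (≢-true a) (≢-true b)

      off-elim : ∀ {z} → off z ≡ true → z ≢ r × z ≢ s
      off-elim {z} e = true-≢ (∧-true₁ e) , true-≢ (∧-true₂ {not (z == r)} e)

      K₀ : V → Bool
      K₀ z = off z ∧ not (z == t)

      K₀-intro : ∀ {z} → z ≢ r → z ≢ s → z ≢ t → K₀ z ≡ true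
      K₀-intro a b c = ∧-true (off-intro a b) (≢-true c)

      K₀-elim : ∀ {z} → K₀ z ≡ true → z ≢ r × z ≢ s × z ≢ t
      K₀-elim {z} e = proj₁ (off-elim (∧-true₁ e)) , proj₂ (off-elim (∧-true₁ e)) , true-≢ (∧-true₂ {off z} e)

      -- The edges at `r` and `s` are decided from the outset: all red but for `st`.
      act₀ : Lab
      act₀ a b = adj a b ∧ (off a ∧ off b)

      act₀-intro : ∀ {a b} → adj a b ≡ true → a ≢ r → a ≢ s → b ≢ r → b ≢ s → act₀ a b ≡ true
      act₀-intro e p q u v = ∧-true e (∧-true (off-intro p q) (off-intro u v))

      act₀-adj : ∀ {a b} → act₀ a b ≡ true → adj a b ≡ true
      act₀-adj = ∧-true₁

      act₀-off : ∀ {a b} → act₀ a b ≡ true → (a ≢ r × a ≢ s) × (b ≢ r × b ≢ s)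
      act₀-off {a} {b} e = off-elim (∧-true₁ h) , off-elim (∧-true₂ {off a} h)
        where h = ∧-true₂ {adj a b} e

      P₀ : List V
      P₀ = t ∷ s ∷ r ∷ []

      in-P₀ : ∀ {w} → w ∈ P₀ → w ≡ t ⊎ w ≡ s ⊎ w ≡ r
      in-P₀ (here e) = inj₁ e
      in-P₀ (there (here e)) = inj₂ (inj₁ e)
      in-P₀ (there (there (here e))) = inj₂ (inj₂ e)

      not-in-P₀ : ∀ {z} → K₀ z ≡ false → z ∈ P₀
      not-in-P₀ {z} e with z ≟F t | z ≟F s | z ≟F r
      ... | yes p | _ | _ = here p
      ... | no _ | yes p | _ = there (here p)
      ... | no _ | no _ | yes p = there (there (here p))
      ... | no a | no b | no c = ⊥-elim (true≢false (K₀-intro c b a) e)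

      active-eq : ∀ z → K₀ z ≡ true → active act₀ z ≡ count (λ w → (adj z w ∧ not (w == r)) ∧ not (w == s))
      active-eq z Kz = count-cong (λ w → bool-ext
        (λ e → let _ , (p , q) = act₀-off {z} e in ∧-true (∧-true (act₀-adj {z} e) (≢-true p)) (≢-true q))
        (λ e → act₀-intro (∧-true₁ (∧-true₁ e)) (proj₁ (K₀-elim Kz)) (proj₁ (proj₂ (K₀-elim Kz)))
          (true-≢ (∧-true₂ {adj z w} (∧-true₁ e))) (true-≢ (∧-true₂ {adj z w ∧ not (w == r)} e))))

      drop-s : ∀ z → count (λ w → adj z w ∧ not (w == r)) ≤ suc (count (λ w → (adj z w ∧ not (w == r)) ∧ not (w == s)))
      drop-s z = count-remove-≤ _ s

      keep-s : ∀ z → adj z s ≡ false → count (λ w → adj z w ∧ not (w == r)) ≤ count (λ w → (adj z w ∧ not (w == r)) ∧ not (w == s))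
      keep-s z e = count-remove-none _ s (cong (_∧ not (s == r)) e)

      drop-r : ∀ z → k ≤ suc (count (λ w → adj z w ∧ not (w == r)))
      drop-r z = subst (_≤ suc (count (λ w → adj z w ∧ not (w == r)))) (regular z) (count-remove-≤ (adj z) r)

      keep-r : ∀ z → adj z r ≡ false → k ≤ count (λ w → adj z w ∧ not (w == r))
      keep-r z e = subst (_≤ count (λ w → adj z w ∧ not (w == r))) (regular z) (count-remove-none (adj z) r e)

      -- Next to `s`, the class lies among the `k ∸ 2` neighbours of `s` other than `r` and `t`, and
      -- `z` has lost one edge. Next to `t` only, it lies among the `k ∸ 1` neighbours of `t` other
      -- than `s`, and `z` has lost none.
      bound₁₀ : ∀ z w → K₀ z ≡ true → special z ≡ false → w ∈ P₀ → adj z w ≡ true → classSize K₀ P₀ z < active act₀ z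
      bound₁₀ z w Kz sz w∈ e with true⊎false (adj z s)
      ... | inj₁ zs = ≤-trans small (subst (k ∸ 1 ≤_) (sym (active-eq z Kz)) (∸-monoˡ-≤ 1 (≤-trans (keep-r z (trans (adj-sym z r) sz)) (drop-s z))))
        where
        small : suc (classSize K₀ P₀ z) ≤ k ∸ 1
        small = ∸-monoˡ-≤ 1 (≤-trans (s≤s (count-mono-< {g = λ y → adj s y ∧ not (y == t)}
          (λ y h → ∧-true (trans (adj-sym s y) (trans (sym (cls-sound (∧-true₂ {K₀ y} h) (there (here refl)))) zs))
            (≢-true (proj₂ (proj₂ (K₀-elim (∧-true₁ h))))))
          r (¬true⇒false (λ h → proj₁ (K₀-elim (∧-true₁ h)) refl)) (∧-true adj-sr (≢-true (t≢r ∘ sym)))))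
          (≤-reflexive (trans (sym (count-remove (adj s) t adj-st)) (regular s))))
      ... | inj₂ zs = ≤-trans small (subst (k ≤_) (sym (active-eq z Kz)) (≤-trans (keep-r z (trans (adj-sym z r) sz)) (keep-s z zs)))
        where
        zt : adj z t ≡ true
        zt with in-P₀ w∈
        ... | inj₁ refl = e
        ... | inj₂ (inj₁ refl) = ⊥-elim (true≢false e zs)
        ... | inj₂ (inj₂ refl) = ⊥-elim (true≢false (trans (adj-sym r z) e) sz)
        small : suc (classSize K₀ P₀ z) ≤ k
        small = subst (suc (classSize K₀ P₀ z) ≤_) (regular t) (count-mono-<
          (λ y h → trans (adj-sym t y) (trans (sym (cls-sound (∧-true₂ {K₀ y} h) (here refl))) zt))
          s (¬true⇒false (λ h → proj₁ (proj₂ (K₀-elim (∧-true₁ h))) refl)) adj-ts)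

      special-cls : ∀ {z y} → special z ≡ true → cls P₀ z y ≡ true → adj r y ≡ true
      special-cls {z} {y} sz c = trans (adj-sym r y) (trans (sym (cls-sound c (there (there (here refl))))) (trans (adj-sym z r) sz))

      -- A neighbour of both `r` and `s` has lost two edges; `common` makes up for that. A neighbour
      -- of `r` only keeps `k ∸ 1` edges, while its class may have `k ∸ 1` members; the minimum with
      -- `k ∸ 2` absorbs this case.
      bound₂₀ : ∀ z → K₀ z ≡ true → special z ≡ true → classSize K₀ P₀ z ⊓ (k ∸ 2) < active act₀ z
      bound₂₀ z Kz sz with true⊎false (adj z s)
      ... | inj₁ zs = ≤-trans (s≤s (m⊓n≤m _ (k ∸ 2))) (≤-trans (s≤s (count-mono
              (λ y h → ∧-true (∧-true (special-cls sz (∧-true₂ {K₀ y} h))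
                (trans (adj-sym s y) (trans (sym (cls-sound (∧-true₂ {K₀ y} h) (there (here refl)))) zs)))
                (≢-true (proj₂ (proj₂ (K₀-elim (∧-true₁ h))))))))
            (≤-trans (common z sz (trans (adj-sym s z) zs) (proj₂ (proj₂ (K₀-elim Kz))))
              (subst (k ∸ 2 ≤_) (sym (active-eq z Kz)) (∸-monoˡ-≤ 2 (≤-trans (drop-r z) (s≤s (drop-s z)))))))
      ... | inj₂ zs = ≤-trans (s≤s (m⊓n≤n _ (k ∸ 2))) (≤-trans (≤-reflexive (sym (+-∸-assoc 1 2≤k)))
            (subst (k ∸ 1 ≤_) (sym (active-eq z Kz)) (≤-trans (∸-monoˡ-≤ 1 (drop-r z)) (keep-s z zs))))

      cap₀ : ∀ z w → K₀ z ≡ true → special z ≡ true → w ∈ P₀ → act₀ z w ≡ true → classSize K₀ P₀ z ≤ k ∸ 2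
      cap₀ z w Kz sz w∈ e with in-P₀ w∈
      ... | inj₂ (inj₁ refl) = ⊥-elim (proj₂ (proj₂ (act₀-off {z} e)) refl)
      ... | inj₂ (inj₂ refl) = ⊥-elim (proj₁ (proj₂ (act₀-off {z} e)) refl)
      ... | inj₁ refl = ≤-trans (count-mono (λ y h → let a , b , c = K₀-elim (∧-true₁ h) in
              ∧-true (∧-true (∧-true (special-cls sz (∧-true₂ {K₀ y} h)) (≢-true b)) (≢-true c))
                (trans (adj-sym t y) (trans (sym (cls-sound (∧-true₂ {K₀ y} h) (here refl))) (act₀-adj {z} e)))))
            (capped z sz (proj₁ (proj₂ (K₀-elim Kz))) (proj₂ (proj₂ (K₀-elim Kz))) (trans (adj-sym t z) (act₀-adj {z} e)))

      inv₀ : Inv K₀ P₀ act₀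
      inv₀ = record
        { outside = λ w∈ → ¬true⇒false (λ e → out w∈ (K₀-elim e))
        ; closed = λ z w Kz e → closed z w
        ; act-sym = λ a b → cong₂ _∧_ (adj-sym a b) (∧-comm (off a) (off b))
        ; act-adj = λ a b → act₀-adj {a}
        ; act-in = λ a b Ka Kb e → act₀-intro e (proj₁ (K₀-elim Ka)) (proj₁ (proj₂ (K₀-elim Ka))) (proj₁ (K₀-elim Kb)) (proj₁ (proj₂ (K₀-elim Kb)))
        ; act-cls = λ y z w Ky Kz c w∈ → cong₂ _∧_ (cls-sound c w∈) (cong (_∧ off w) (trans (∧-true₁ {off y} Ky) (sym (∧-true₁ {off z} Kz))))
        ; r∈P = there (there (here refl)) ; s∈P = there (here refl) ; t∈P = here refl
        ; act-r = λ z Kz → ¬true⇒false (λ e → proj₁ (proj₂ (act₀-off {z} e)) refl)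
        ; bound₁ = bound₁₀ ; bound₂ = bound₂₀ ; cap = cap₀ }
        where
        out : ∀ {w} → w ∈ P₀ → w ≢ r × w ≢ s × w ≢ t → ⊥
        out w∈ (a , b , c) with in-P₀ w∈
        ... | inj₁ e = c e
        ... | inj₂ (inj₁ e) = b e
        ... | inj₂ (inj₂ e) = a e
        closed : ∀ z w → K₀ w ≡ true ⊎ w ∈ P₀
        closed z w with true⊎false (K₀ w)
        ... | inj₁ e = inj₁ e
        ... | inj₂ e = inj₂ (not-in-P₀ e)

      family-head : ∀ {P τ} → Family K₀ act₀ P (suc τ) → ∃[ lam ] P lam
      family-head (_ ∷ _ , _ , _ , (lam , good , _) ∷ _) = lam , good

      F : SearchForest t K₀
      F = search (count K₀) t K₀ ≤-refl

      module F = SearchForest F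

      F-cover : ∀ z → K₀ z ≡ true → ∃[ i ] F.Ks i z ≡ true
      F-cover z Kz with ∨-cases {z == t} (connected W step (∨-true₁ (==-refl t)) z (proj₁ (K₀-elim Kz)) (proj₁ (proj₂ (K₀-elim Kz))))
        where
        W : V → Bool
        W z = (z == t) ∨ someᵇ (λ i → F.Ks i z)
        step : ∀ a b → a ≢ r → a ≢ s → b ≢ r → b ≢ s → adj a b ≡ true → W a ≡ true → W b ≡ true
        step a b a≢r a≢s b≢r b≢s e Wa with b ≟F t
        ... | yes refl = ∨-true₁ (==-refl t)
        ... | no b≢t with ∨-cases {a == t} Wa
        ... | inj₁ h with refl ← ==-sound h with i , g ← F.exhausts-root b (K₀-intro b≢r b≢s b≢t) e = ∨-true₂ {b == t} (someᵇ-complete _ i g)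
        ... | inj₂ h with i , g ← someᵇ-sound _ h = ∨-true₂ {b == t} (someᵇ-complete _ i (F.exhausts i a b g (K₀-intro b≢r b≢s b≢t) e))
      ... | inj₁ h = ⊥-elim (proj₂ (proj₂ (K₀-elim Kz)) (==-sound h))
      ... | inj₂ h = someᵇ-sound _ h

      isForest : IsForest (s ∷ r ∷ []) t K₀ F.Ks F.root F.lf
      isForest = record
        { cover = F-cover ; sub = F.sub ; disjoint = F.disjoint ; closed = closed
        ; connected = λ i → tree-connected (F.trees i)
        ; root∈ = λ i → tree-root (F.trees i)
        ; root-adj = F.child
        ; leaf-only = λ i e → tree-leaf (subst (Tree _ _) e (F.trees i)) }
        where
        closed : ∀ i z w → F.Ks i z ≡ true → adj z w ≡ true → F.Ks i w ≡ true ⊎ w ∈ P₀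
        closed i z w iz e with true⊎false (K₀ w)
        ... | inj₁ Kw = inj₁ (F.exhausts i z w iz Kw e)
        ... | inj₂ h = inj₂ (not-in-P₀ h)

      forest₀ : ∀ m (Ks : Fin m → V → Bool) root lf → IsForest (s ∷ r ∷ []) t K₀ Ks root lf → (∀ i → Tree (Ks i) (root i) (lf i)) →
        ∃[ lam ] ForestGood K₀ (s ∷ r ∷ []) act₀ t lam
      -- Impossible: `t` has more than two neighbours, hence one besides `r` and `s`.
      forest₀ zero Ks root lf isF trees = ⊥-elim (empty (count-find-diff
          (λ y → (y == r) ∨ (y == s)) (adj t) (≤-trans (s≤s (≤-trans (≤-reflexive
            (count-∨ _ _ (λ i p q → r≢s (trans (sym (==-sound p)) (==-sound q))))) (≤-reflexive (cong₂ _+_ (count-single r) (count-single s)))))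
            (≤-trans (s≤s (s≤s (s≤s z≤n))) (≤-trans k≥5 (≤-reflexive (sym (regular t))))))))
        where
        empty : ∃[ y ] (adj t y ≡ true × (y == r) ∨ (y == s) ≡ false) → ⊥
        empty (y , ty , e) with IsForest.cover isF y (K₀-intro (λ { refl → true≢false (∨-true₁ (==-refl y)) e })
          (λ { refl → true≢false (∨-true₂ {y == r} (==-refl y)) e }) (adj-≢ ty ∘ sym))
        ... | ()
      forest₀ (suc m) Ks root lf isF trees =
        family-head (forest-family (s ∷ r ∷ []) t act₀ K₀ Ks root lf isF inv₀
          (λ z Kz e → act₀-intro e (proj₁ (K₀-elim Kz)) (proj₁ (proj₂ (K₀-elim Kz))) t≢r (s≢t ∘ sym))
          (s≢t ∘ sym) t≢r s (here refl) adj-ts (λ i → tree-solvable crowded (trees i)) 0 (pot-one inv₀))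

      core : ∃[ lam ] ForestGood K₀ (s ∷ r ∷ []) act₀ t lam
      core = forest₀ F.size F.Ks F.root F.lf isForest F.trees

      lamF : Lab
      lamF = proj₁ core

      module G = ForestGood (proj₂ core)

      region : V → V → Bool
      region a b = (K₀ a ∨ K₀ b) ∧ act₀ a b

      only-t : V → Bool
      only-t y = y == t

    opaque
      gadget-lab : Lab
      gadget-lab a b = if region a b then lamF a b else star s only-t a b

      gadget-in : ∀ {a b} → region a b ≡ true → gadget-lab a b ≡ lamF a b
      gadget-in e rewrite e = refl

      gadget-out : ∀ {a b} → region a b ≡ false → gadget-lab a b ≡ star s only-t a b
      gadget-out e rewrite e = refl

    private
      lam = gadget-lab

      region-sym : ∀ a b → region a b ≡ region b a
      region-sym a b = cong₂ _∧_ (∨-comm (K₀ a) (K₀ b)) (Inv.act-sym inv₀ a b)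

      lam-sym : ∀ a b → lam a b ≡ lam b a
      lam-sym a b with true⊎false (region a b)
      ... | inj₁ e = trans (gadget-in e) (trans (G.lam-sym a b) (sym (gadget-in (trans (region-sym b a) e))))
      ... | inj₂ e = trans (gadget-out e) (trans (star-sym s only-t a b) (sym (gadget-out (trans (region-sym b a) e))))

      lam-K : ∀ z w → K₀ z ≡ true → act₀ z w ≡ true → lam z w ≡ lamF z w
      lam-K z w Kz a = gadget-in (∧-true (∨-true₁ Kz) a)

      region-off : ∀ a b → region a b ≡ true → (a ≢ r × a ≢ s) × (b ≢ r × b ≢ s)
      region-off a b e = act₀-off {a} (∧-true₂ {K₀ a ∨ K₀ b} e)

      lam-r : ∀ w → lam r w ≡ false
      lam-r w = trans (gadget-out (¬true⇒false (λ e → proj₁ (proj₁ (region-off r w e)) refl)))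
        (¬true⇒false (λ e → contra (star-cases e)))
        where
        contra : (r ≡ s × only-t w ≡ true) ⊎ (w ≡ s × only-t r ≡ true) → ⊥
        contra (inj₁ (e , _)) = r≢s e
        contra (inj₂ (_ , e)) = t≢r (sym (==-sound e))

      lam-s : ∀ w → lam s w ≡ true → w ≡ t
      lam-s w e with star-cases (trans (sym (gadget-out (¬true⇒false (λ e → proj₂ (proj₁ (region-off s w e)) refl)))) e)
      ... | inj₁ (_ , h) = ==-sound h
      ... | inj₂ (_ , h) = ⊥-elim (s≢t (==-sound h))

      lam-ts : lam t s ≡ true
      lam-ts = trans (gadget-out (¬true⇒false (λ e → proj₂ (proj₂ (region-off t s e)) refl))) (trans (star-at only-t (s≢t ∘ sym)) (==-refl t))

      lam-st : lam s t ≡ true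
      lam-st = trans (lam-sym s t) lam-ts

      t-child : ∃[ w ] (K₀ w ≡ true × adj t w ≡ true × lam t w ≡ true)
      t-child with w , Kw , a , l ← G.into = w , Kw , trans (adj-sym t w) (act₀-adj {w} a) , trans (lam-sym t w) (trans (lam-K w t Kw a) l)

      some-blue : ∀ z → z ≢ r → ∃[ w ] (adj z w ≡ true × lam z w ≡ true)
      some-blue z z≢r with z ≟F s | z ≟F t
      ... | yes refl | _ = t , adj-st , lam-st
      ... | no _ | yes refl = s , adj-ts , lam-ts
      ... | no z≢s | no z≢t with w , a , l ← G.blue₁ z (K₀-intro z≢r z≢s z≢t) =
        w , act₀-adj {z} a , trans (lam-K z w (K₀-intro z≢r z≢s z≢t) a) l

      two-blue : ∀ z → adj r z ≡ true → z ≢ s →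
        ∃[ w ] ∃[ w′ ] (w ≢ w′ × (adj z w ≡ true × lam z w ≡ true) × (adj z w′ ≡ true × lam z w′ ≡ true))
      two-blue z rz z≢s with z ≟F t
      ... | yes refl with w , Kw , a , l ← t-child = s , w , (proj₁ (proj₂ (K₀-elim Kw)) ∘ sym) , (adj-ts , lam-ts) , (a , l)
      two-blue z rz z≢s | no z≢t with w , w′ , d , (a , l) , (a′ , l′) ← G.blue₂ z (K₀-intro (adj-≢ rz ∘ sym) z≢s z≢t) rz =
        w , w′ , d , (act₀-adj {z} a , trans (lam-K z w Kz a) l) , (act₀-adj {z} a′ , trans (lam-K z w′ Kz a′) l′)
        where Kz = K₀-intro (adj-≢ rz ∘ sym) z≢s z≢t

    gadget-distinguishing : DistinguishingLab
    gadget-distinguishing = lam , lam-sym , λ φ pres → Fixing.fixes φ pres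
      where
      module Fixing (φ : Aut) (pres : ∀ a b → adj a b ≡ true → lam (at φ a) (at φ b) ≡ lam a b) where
        pull : ∀ z w → adj (at φ z) w ≡ true → ∃[ w′ ] (at φ w′ ≡ w × adj z w′ ≡ true × lam z w′ ≡ lam (at φ z) w)
        pull z w e = w′ , φw′ , a , trans (sym (pres z w′ a)) (cong (lam (at φ z)) φw′)
          where
          w′ = at (Aut-inv φ) w
          φw′ : at φ w′ ≡ w
          φw′ = Data.Fin.Permutation.inverseʳ (perm φ)
            where import Data.Fin.Permutation
          a : adj z w′ ≡ true
          a = trans (sym (adj-perm φ z w′)) (trans (cong (adj (at φ z)) φw′) e)

        φr : at φ r ≡ r
        φr with at φ r ≟F r
        ... | yes e = e
        ... | no ne with w , a , l ← some-blue (at φ r) ne with w′ , _ , _ , l′ ← pull r w a =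
          ⊥-elim (true≢false (trans l′ l) (lam-r w′))

        φs : at φ s ≡ s
        φs with at φ s ≟F s
        ... | yes e = e
        ... | no ne with w , w′ , d , (a , l) , (a′ , l′) ← two-blue (at φ s)
                           (trans (cong (λ y → adj y (at φ s)) (sym φr)) (trans (adj-perm φ r s) adj-rs)) ne
            with u , e , _ , m ← pull s w a | u′ , e′ , _ , m′ ← pull s w′ a′ =
          ⊥-elim (d (trans (sym e) (trans (cong (at φ) (trans (lam-s u (trans m l)) (sym (lam-s u′ (trans m′ l′))))) e′)))

        φt : at φ t ≡ t
        φt = lam-s (at φ t) (trans (cong (λ y → lam y (at φ t)) (sym φs)) (trans (pres s t adj-st) lam-st))

        fixP : ∀ w → w ∈ P₀ → at φ w ≡ w
        fixP w w∈ with in-P₀ w∈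
        ... | inj₁ refl = φt
        ... | inj₂ (inj₁ refl) = φs
        ... | inj₂ (inj₂ refl) = φr

        Kφ : ∀ z → K₀ (at φ z) ≡ K₀ z
        Kφ z = bool-ext
          (λ e → let a , b , c = K₀-elim e in K₀-intro (λ { refl → a φr }) (λ { refl → b φs }) (λ { refl → c φt }))
          (λ e → let a , b , c = K₀-elim e in K₀-intro (λ h → a (aut-injective φ (trans h (sym φr))))
            (λ h → b (aut-injective φ (trans h (sym φs)))) (λ h → c (aut-injective φ (trans h (sym φt)))))

        presF : Preserves φ K₀ act₀ lamF
        presF a b m e = trans (sym (gadget-in (∧-true (trans (cong₂ _∨_ (Kφ a) (Kφ b)) m) (trans (act-invariant inv₀ φ fixP Kφ a b m) e))))
          (trans (pres a b (act₀-adj {a} e)) (gadget-in (∧-true m e)))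

        fixes : ∀ z → at φ z ≡ z
        fixes z with true⊎false (K₀ z)
        ... | inj₁ e = G.rigid φ fixP Kφ presF z e
        ... | inj₂ e = fixP z (not-in-P₀ e)

-- Choice of the root gadget

module Choose {n : ℕ} (Γ : Context n) where
  open Labellings Γ
  open Distinguish Γ

  -- Connectedness of the subgraph induced on `C`, as an induction principle instead of paths.
  Connecting : (V → Bool) → Set
  Connecting C = ∀ (W : V → Bool) → (∀ a b → C a ≡ true → C b ≡ true → adj a b ≡ true → W a ≡ true → W b ≡ true) →
    ∀ a b → C a ≡ true → C b ≡ true → W a ≡ true → W b ≡ true

  full-neighbourhood : ∀ x (f : V → Bool) → (∀ y → f y ≡ true → adj x y ≡ true) → k ≤ count f → ∀ y → adj x y ≡ true → f y ≡ true
  full-neighbourhood x f f⊆ k≤ y xy with true⊎false (f y)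
  ... | inj₁ e = e
  ... | inj₂ e = ⊥-elim (<-irrefl refl (≤-trans (count-mono-< f⊆ y e xy) (≤-trans (≤-reflexive (regular x)) k≤)))

  module _ (C : V → Bool) where
    near far boundary : V → Bool
    near z = someᵇ (λ c → C c ∧ adj c z)
    far z = not (C z) ∧ not (near z)
    boundary z = not (C z) ∧ near z

    near-intro : ∀ {c z} → C c ≡ true → adj c z ≡ true → near z ≡ true
    near-intro {c} {z} Cc e = someᵇ-complete _ c (∧-true Cc e)

    far-C : ∀ {z} → far z ≡ true → C z ≡ false
    far-C e = true-not (∧-true₁ e)

    far-adj : ∀ {z c} → far z ≡ true → C c ≡ true → adj c z ≡ false
    far-adj {z} e Cc = ¬true⇒false (λ h → true≢false (near-intro Cc h) (true-not (∧-true₂ {not (C z)} e)))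

    boundary-C : ∀ {z} → boundary z ≡ true → C z ≡ false
    boundary-C e = true-not (∧-true₁ e)

    boundary-near : ∀ {z} → boundary z ≡ true → ∃[ c ] (C c ≡ true × adj c z ≡ true)
    boundary-near {z} e with c , h ← someᵇ-sound _ (∧-true₂ {not (C z)} e) = c , ∧-true₁ h , ∧-true₂ {C c} h

    trichotomy : ∀ z → C z ≡ true ⊎ boundary z ≡ true ⊎ far z ≡ true
    trichotomy z with true⊎false (C z) | true⊎false (near z)
    ... | inj₁ e | _ = inj₁ e
    ... | inj₂ e | inj₁ h = inj₂ (inj₁ (∧-true (not-true e) h))
    ... | inj₂ e | inj₂ h = inj₂ (inj₂ (∧-true (not-true e) (not-true h)))

  -- A maximal connected set C that does not dominate the graph: by maximality, every
  -- boundary vertex is adjacent to all vertices that C does not dominate.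
  record Core (o : V) : Set where
    field
      C : V → Bool
      o∈C : C o ≡ true
      connecting : Connecting C
      r : V
      r-far : far C r ≡ true
      joined : ∀ b z → boundary C b ≡ true → far C z ≡ true → adj b z ≡ true

  -- If a boundary vertex `y` and the set `C` together still leave some `z` undominated, then `y`
  -- joins `C` and `z` replaces `r`.
  grow : ∀ fuel (o : V) (C : V → Bool) → C o ≡ true → Connecting C → ∀ r → far C r ≡ true →
    count (λ z → not (C z)) ≤ fuel → Core o
  grow fuel o C Co conn r fr h with any? (λ y → any? (λ z → (boundary C y ∧ far (λ x → C x ∨ (x == y)) z) ≟B true))
  ... | no none = record { C = C ; o∈C = Co ; connecting = conn ; r = r ; r-far = fr ; joined = joined }
    where
    joined : ∀ b z → boundary C b ≡ true → far C z ≡ true → adj b z ≡ true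
    joined b z bb fz with true⊎false (adj b z)
    ... | inj₁ e = e
    ... | inj₂ e = ⊥-elim (none (b , z , ∧-true bb (∧-true (not-true Dz) (not-true (¬true⇒false nearD)))))
      where
      D : V → Bool
      D x = C x ∨ (x == b)
      Dz : D z ≡ false
      Dz = ¬true⇒false λ h → absurd (∨-cases h)
        where
        absurd : C z ≡ true ⊎ (z == b) ≡ true → ⊥
        absurd (inj₁ Cz) = true≢false Cz (far-C C fz)
        absurd (inj₂ zb) with refl ← ==-sound zb = true≢false (∧-true₂ {not (C z)} bb) (true-not (∧-true₂ {not (C z)} fz))
      nearD : near D z ≡ true → ⊥
      nearD h with c , g ← someᵇ-sound _ h with ∨-cases (∧-true₁ g)
      ... | inj₁ Cc = true≢false (∧-true₂ {D c} g) (far-adj C fz Cc)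
      ... | inj₂ cb with refl ← ==-sound cb = true≢false (∧-true₂ {D c} g) e
  grow zero o C Co conn r fr h | yes (y , z , e) = ⊥-elim (1+n≰n (≤-trans (count-pos y (∧-true₁ (∧-true₁ e))) h))
  grow (suc fuel) o C Co conn r fr h | yes (y , z , e) =
    grow fuel o D (∨-true₁ Co) connD z (∧-true₂ {boundary C y} e)
      (≤-pred (≤-trans (count-mono-< (λ x p → not-true (¬true⇒false (λ q → true≢false (∨-true₁ q) (true-not p)))) y
        (cong not (∨-true₂ {C y} (==-refl y))) (∧-true₁ (∧-true₁ e))) h))
    where
    D : V → Bool
    D x = C x ∨ (x == y)
    Dy : D y ≡ true
    Dy = ∨-true₂ {C y} (==-refl y)
    nb = boundary-near C (∧-true₁ e)
    c = proj₁ nb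
    Cc = proj₁ (proj₂ nb)
    cy = proj₂ (proj₂ nb)
    connD : Connecting D
    connD W step = result
      where
      stepC : ∀ a b → C a ≡ true → C b ≡ true → W a ≡ true → W b ≡ true
      stepC = conn W (λ a b Ca Cb → step a b (∨-true₁ Ca) (∨-true₁ Cb))
      to-c : ∀ a → D a ≡ true → W a ≡ true → W c ≡ true
      to-c a Da Wa with ∨-cases Da
      ... | inj₁ Ca = stepC a c Ca Cc Wa
      ... | inj₂ p with refl ← ==-sound p = step a c Dy (∨-true₁ Cc) (trans (adj-sym a c) cy) Wa
      from-c : ∀ b → D b ≡ true → W c ≡ true → W b ≡ true
      from-c b Db Wc with ∨-cases Db
      ... | inj₁ Cb = stepC c b Cc Cb Wc
      ... | inj₂ p with refl ← ==-sound p = step c b (∨-true₁ Cc) Dy cy Wc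
      result : ∀ a b → D a ≡ true → D b ≡ true → W a ≡ true → W b ≡ true
      result a b Da Db Wa = from-c b Db (to-c a Da Wa)

  Complete : Set
  Complete = ∀ a b → a ≢ b → adj a b ≡ true

  CompleteBipartite : Set
  CompleteBipartite = Σ[ side ∈ (V → Bool) ] ((∀ a b → adj a b ≡ true → side a ≢ side b) × (∀ a b → side a ≢ side b → adj a b ≡ true))

  HasGadget : Set
  HasGadget = ∃[ r ] ∃[ s ] ∃[ t ] Gadget r s t

  -- A vertex adjacent to all others forces `n = suc k`; by regularity every vertex is then adjacent
  -- to all others.
  dominating⇒complete : ∀ o → (∀ z → z ≢ o → adj o z ≡ true) → Complete
  dominating⇒complete o dom a b a≢b with true⊎false (adj a b)
  ... | inj₁ e = e
  ... | inj₂ e = ⊥-elim (<-irrefl refl (subst₂ _<_ (regular a) same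
      (count-mono-< {f = adj a} {g = λ y → true ∧ not (y == a)} (λ y ay → ≢-true (adj-≢ ay ∘ sym)) b e (≢-true (a≢b ∘ sym)))))
    where
    same : count (λ y → true ∧ not (y == a)) ≡ k
    same = suc-injective (trans (sym (count-remove (λ _ → true) a refl)) (trans (count-remove (λ _ → true) o refl)
      (cong suc (trans (count-cong (λ y → bool-ext (λ h → dom y (true-≢ h)) (λ h → ≢-true (adj-≢ h ∘ sym)))) (regular o)))))

  module FromCore (o : V) (whole : Connecting (λ _ → true)) (core : Core o) where
    open Core core

    bd Z : V → Bool
    bd = boundary C
    Z = far C

    opaque
      some-boundary : ∃[ b ] bd b ≡ true
      some-boundary with any? (λ b → bd b ≟B true)
      ... | yes p = p
      ... | no none = ⊥-elim (true≢false (whole C step o r refl refl o∈C) (far-C C r-far))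
        where
        step : ∀ a b → true ≡ true → true ≡ true → adj a b ≡ true → C a ≡ true → C b ≡ true
        step a b _ _ e Ca with true⊎false (C b)
        ... | inj₁ h = h
        ... | inj₂ h = ⊥-elim (none (b , ∧-true (not-true h) (near-intro C Ca e)))

    b₀ : V
    b₀ = proj₁ some-boundary
    bd-b₀ = proj₂ some-boundary

    r-bd : ∀ b → bd b ≡ true → adj r b ≡ true
    r-bd b e = trans (adj-sym r b) (joined b r e r-far)

    r-C : ∀ c → C c ≡ true → adj r c ≡ false
    r-C c Cc = trans (adj-sym r c) (far-adj C r-far Cc)

    C-≢r : ∀ {c} → C c ≡ true → c ≢ r
    C-≢r Cc refl = true≢false Cc (far-C C r-far)

    -- Deleting r and a good s leaves the graph connected.
    good : V → Bool
    good s = adj r s ∧ (not (bd s) ∨ someᵇ (λ b → bd b ∧ not (b == s)))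

    good-adj : ∀ {s} → good s ≡ true → adj r s ≡ true
    good-adj = ∧-true₁

    good-interior : ∀ {s} → adj r s ≡ true → bd s ≡ false → good s ≡ true
    good-interior e f = ∧-true e (∨-true₁ (not-true f))

    good-other : ∀ {s b} → adj r s ≡ true → bd b ≡ true → b ≢ s → good s ≡ true
    good-other {s} {b} e f g = ∧-true e (∨-true₂ {not (bd s)} (someᵇ-complete _ b (∧-true f (≢-true g))))

    good-bd : ∀ {s} → good s ≡ true → ∃[ b ] (bd b ≡ true × b ≢ s)
    good-bd {s} e with ∨-cases {not (bd s)} (∧-true₂ {adj r s} e)
    ... | inj₁ h = b₀ , bd-b₀ , λ { refl → true≢false bd-b₀ (true-not h) }
    ... | inj₂ h with b , g ← someᵇ-sound _ h = b , ∧-true₁ g , true-≢ (∧-true₂ {bd b} g)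

    -- `C` contains neither `r` nor `s`. A boundary vertex has a neighbour in `C`, and a far vertex
    -- is joined to the boundary vertex other than `s` that `good` provides.
    connected : ∀ s → good s ≡ true → ∀ t → t ≢ r → t ≢ s → (W : V → Bool) →
      (∀ a b → a ≢ r → a ≢ s → b ≢ r → b ≢ s → adj a b ≡ true → W a ≡ true → W b ≡ true) →
      W t ≡ true → ∀ z → z ≢ r → z ≢ s → W z ≡ true
    connected s gs t t≢r t≢s W step Wt z z≢r z≢s = from-o z z≢r z≢s (to-o t t≢r t≢s Wt)
      where
      C-≢s : ∀ {c} → C c ≡ true → c ≢ s
      C-≢s Cc refl = true≢false (good-adj gs) (r-C _ Cc)
      inC : ∀ a b → C a ≡ true → C b ≡ true → W a ≡ true → W b ≡ true
      inC = connecting W (λ a b Ca Cb → step a b (C-≢r Ca) (C-≢s Ca) (C-≢r Cb) (C-≢s Cb))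
      bd-≢r : ∀ {b} → bd b ≡ true → b ≢ r
      bd-≢r e refl = adj-≢ (r-bd _ e) refl
      to-o-bd : ∀ a → bd a ≡ true → a ≢ s → W a ≡ true → W o ≡ true
      to-o-bd a ba a≢s Wa with c , Cc , ca ← boundary-near C ba =
        inC c o Cc o∈C (step a c (bd-≢r ba) a≢s (C-≢r Cc) (C-≢s Cc) (trans (adj-sym a c) ca) Wa)
      from-o-bd : ∀ a → bd a ≡ true → a ≢ s → W o ≡ true → W a ≡ true
      from-o-bd a ba a≢s Wo with c , Cc , ca ← boundary-near C ba =
        step c a (C-≢r Cc) (C-≢s Cc) (bd-≢r ba) a≢s ca (inC o c o∈C Cc Wo)
      gb = good-bd gs
      to-o : ∀ a → a ≢ r → a ≢ s → W a ≡ true → W o ≡ true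
      to-o a a≢r a≢s Wa with trichotomy C a
      ... | inj₁ Ca = inC a o Ca o∈C Wa
      ... | inj₂ (inj₁ ba) = to-o-bd a ba a≢s Wa
      ... | inj₂ (inj₂ za) with b , bb , b≢s ← gb =
        to-o-bd b bb b≢s (step a b a≢r a≢s (bd-≢r bb) b≢s (trans (adj-sym a b) (joined b a bb za)) Wa)
      from-o : ∀ a → a ≢ r → a ≢ s → W o ≡ true → W a ≡ true
      from-o a a≢r a≢s Wo with trichotomy C a
      ... | inj₁ Ca = inC o a o∈C Ca Wo
      ... | inj₂ (inj₁ ba) = from-o-bd a ba a≢s Wo
      ... | inj₂ (inj₂ za) with b , bb , b≢s ← gb =
        step b a (bd-≢r bb) b≢s a≢r a≢s (joined b a bb za) (from-o-bd b bb b≢s Wo)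

    minus : V → V → Bool
    minus s y = adj r y ∧ not (y == s)

    count-minus : ∀ s → adj r s ≡ true → suc (count (minus s)) ≡ k
    count-minus s e = trans (sym (count-remove (adj r) s e)) (regular r)

    -- Apart from `s` and `t` only `k ∸ 2` neighbours of `r` are left, so the premise of `crowded`
    -- cannot hold and `capped` is immediate. As `u` is not adjacent to `s`, the inequality `common`
    -- is strict.
    triangle : ∀ s t u → good s ≡ true → adj r t ≡ true → adj s t ≡ true → adj r u ≡ true → u ≢ s → adj s u ≡ false → Gadget r s t
    triangle s t u gs rt st ru u≢s su = record
      { adj-rs = rs ; adj-st = st ; t≢r = adj-≢ rt ∘ sym
      ; connected = connected s gs t (adj-≢ rt ∘ sym) (adj-≢ st ∘ sym)
      ; crowded = λ x _ _ _ f f⊆ _ h v _ → ⊥-elim (<-irrefl refl (≤-trans (≤-trans (≤-reflexive k-1) h)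
          (≤-trans (count-mono (λ y e → let a , b , c , _ = f⊆ y e in ∧-true (∧-true a (≢-true b)) (≢-true c))) (≤-reflexive two))))
      ; common = λ z _ _ _ → subst (count (λ y → (adj r y ∧ adj s y) ∧ not (y == t)) <_) two (count-mono-<
          (λ y e → ∧-true (∧-true (∧-true₁ {adj r y} (∧-true₁ e)) (≢-true (adj-≢ (∧-true₂ {adj r y} (∧-true₁ e)) ∘ sym)))
            (∧-true₂ {adj r y ∧ adj s y} e))
          u (¬true⇒false (λ e → true≢false (∧-true₂ {adj r u} (∧-true₁ e)) su))
          (∧-true (∧-true ru (≢-true u≢s)) (≢-true λ { refl → true≢false st su })))
      ; capped = λ z _ _ _ _ → ≤-trans (count-mono (λ y e → ∧-true₁ e)) (≤-reflexive two) }
      where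
      rs = good-adj gs
      two : count (λ y → minus s y ∧ not (y == t)) ≡ k ∸ 2
      two = sym (trans (cong (_∸ 2) (sym (trans (cong suc (sym (count-remove (minus s) t (∧-true rt (≢-true (adj-≢ st ∘ sym)))))) (count-minus s rs)))) refl)
      k-1 : suc (k ∸ 2) ≡ k ∸ 1
      k-1 = sym (+-∸-assoc 1 2≤k)

    module NoTriangle (none : ∀ s t u → good s ≡ true → adj r t ≡ true → adj s t ≡ true → adj r u ≡ true → u ≢ s → adj s u ≡ true) where

      -- By `none`, `s` is adjacent to `r` and to all other neighbours of `r`. These are already `k`
      -- vertices, none of them in `C`.
      closed-twin : ∀ s t → good s ≡ true → adj r t ≡ true → adj s t ≡ true → ∀ u → adj s u ≡ true → C u ≡ true → ⊥
      closed-twin s t gs rt st u su Cu = <-irrefl refl (subst₂ _<_ size (regular s)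
        (count-mono-< {f = λ y → minus s y ∨ (y == r)} sub u (¬true⇒false λ h → absurd (∨-cases h)) su))
        where
        size : count (λ y → minus s y ∨ (y == r)) ≡ k
        size = trans (count-∨ _ _ (λ y e f → adj-≢ (∧-true₁ e) (sym (==-sound f))))
          (trans (cong (count (minus s) +_) (count-single r)) (trans (+-comm _ 1) (count-minus s (good-adj gs))))
        sub : ∀ y → minus s y ∨ (y == r) ≡ true → adj s y ≡ true
        sub y e with ∨-cases e
        ... | inj₁ h = none s t y gs rt st (∧-true₁ h) (true-≢ (∧-true₂ {adj r y} h))
        ... | inj₂ h with refl ← ==-sound h = trans (adj-sym s y) (good-adj gs)
        absurd : minus s u ≡ true ⊎ (u == r) ≡ true → ⊥
        absurd (inj₁ h) = true≢false (∧-true₁ h) (r-C u Cu)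
        absurd (inj₂ h) = C-≢r Cu (==-sound h)

      -- The boundary vertex `b₀` has a neighbour `c` in `C`. If `b₀` is good, it is `s` or adjacent
      -- to `s`, so `closed-twin` applies to it. If not, all other neighbours of `r` are good and
      -- share a neighbour with `r`, hence are adjacent to `b₀` by `none`; with `r` and `c`, this
      -- gives `b₀` more than `k` neighbours.
      no-common : ∀ s t → good s ≡ true → adj r t ≡ true → adj s t ≡ true → ⊥
      no-common s t gs rt st = cases (true⊎false (good b₀)) (b₀ ≟F s)
        where
        nb = boundary-near C bd-b₀
        c = proj₁ nb
        Cc = proj₁ (proj₂ nb)
        bc : adj b₀ c ≡ true
        bc = trans (adj-sym b₀ c) (proj₂ (proj₂ nb))
        rb = r-bd b₀ bd-b₀
        good′ : good b₀ ≡ false → ∀ y → adj r y ≡ true → y ≢ b₀ → good y ≡ true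
        good′ ngb y ry y≢b with true⊎false (bd y)
        ... | inj₂ h = good-interior ry h
        ... | inj₁ h = ⊥-elim (true≢false (good-other rb h y≢b) ngb)
        common′ : ∀ y → adj r y ≡ true → ∃[ u ] (adj r u ≡ true × adj y u ≡ true)
        common′ y ry with y ≟F s
        ... | yes refl = t , rt , st
        ... | no y≢s = s , good-adj gs , trans (adj-sym y s) (none s t y gs rt st ry y≢s)
        size : count (λ y → minus b₀ y ∨ (y == r)) ≡ k
        size = trans (count-∨ _ _ (λ y e f → adj-≢ (∧-true₁ e) (sym (==-sound f))))
          (trans (cong (count (minus b₀) +_) (count-single r)) (trans (+-comm _ 1) (count-minus b₀ rb)))
        sub : good b₀ ≡ false → ∀ y → minus b₀ y ∨ (y == r) ≡ true → adj b₀ y ≡ true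
        sub ngb y e with ∨-cases {minus b₀ y} {y == r} e
        ... | inj₂ h with refl ← ==-sound h = trans (adj-sym b₀ y) rb
        sub ngb y e | inj₁ h with u , ru , yu ← common′ y (∧-true₁ h) =
          trans (adj-sym b₀ y) (none y u b₀ (good′ ngb y (∧-true₁ h) y≢b) ru yu rb (y≢b ∘ sym))
          where y≢b = true-≢ (∧-true₂ {adj r y} h)
        absurd : minus b₀ c ≡ true ⊎ (c == r) ≡ true → ⊥
        absurd (inj₁ h) = true≢false (∧-true₁ h) (r-C c Cc)
        absurd (inj₂ h) = C-≢r Cc (==-sound h)
        cases : good b₀ ≡ true ⊎ good b₀ ≡ false → Dec (b₀ ≡ s) → ⊥
        cases (inj₁ gb) (yes e) = closed-twin s t gs rt st c (subst (λ y → adj y c ≡ true) e bc) Cc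
        cases (inj₁ gb) (no b≢s) = closed-twin b₀ s gb (good-adj gs) (trans (adj-sym b₀ s) (none s t b₀ gs rt st rb b≢s)) c bc Cc
        cases (inj₂ ngb) _ = <-irrefl refl (subst₂ _<_ size (regular b₀)
          (count-mono-< {f = λ y → minus b₀ y ∨ (y == r)} (sub ngb) c (¬true⇒false λ h → absurd (∨-cases h)) bc))

      -- A far neighbour of `r` would be good and share the neighbour `b₀` with `r`.
      r⊆bd : ∀ y → adj r y ≡ true → bd y ≡ true
      r⊆bd y ry with true⊎false (bd y)
      ... | inj₁ h = h
      ... | inj₂ h with trichotomy C y
      ... | inj₁ Cy = ⊥-elim (true≢false ry (r-C y Cy))
      ... | inj₂ (inj₁ by) = by
      ... | inj₂ (inj₂ zy) = ⊥-elim (no-common y b₀ (good-interior ry h) (r-bd b₀ bd-b₀) (trans (adj-sym y b₀) (joined b₀ y bd-b₀ zy)))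

      bd≡r : ∀ y → bd y ≡ adj r y
      bd≡r y = bool-ext (r-bd y) (r⊆bd y)

      count-bd : count bd ≡ k
      count-bd = trans (count-cong bd≡r) (regular r)

      all-good : ∀ s → adj r s ≡ true → good s ≡ true
      all-good s rs with b , bb , b≢s ← count-another bd s (≤-trans 2≤k (≤-reflexive (sym count-bd))) = good-other rs bb b≢s

      independent : ∀ s u → bd s ≡ true → bd u ≡ true → adj s u ≡ true → ⊥
      independent s u bs bu = no-common s u (all-good s (r-bd s bs)) (r-bd u bu)

      full⇒bd : ∀ x → (∀ y → bd y ≡ true → adj x y ≡ true) → ∀ y → adj x y ≡ true → bd y ≡ true
      full⇒bd x h = full-neighbourhood x bd h (≤-reflexive (sym count-bd))

      Z-bd : ∀ z → Z z ≡ true → ∀ y → adj z y ≡ true → bd y ≡ true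
      Z-bd z zz = full⇒bd z (λ y by → trans (adj-sym z y) (joined y z by zz))

      crowded-all : ∀ s → adj r s ≡ true → (f : V → Bool) → (∀ y → f y ≡ true → adj r y ≡ true × y ≢ s) → k ∸ 1 ≤ count f →
        ∀ y → bd y ≡ true → y ≢ s → f y ≡ true
      crowded-all s rs f f⊆ h y by y≢s with true⊎false (f y)
      ... | inj₁ e = e
      ... | inj₂ e = ⊥-elim (<-irrefl refl (≤-trans (≤-trans (s≤s h) (count-mono-< {g = minus s}
          (λ y e → ∧-true (proj₁ (f⊆ y e)) (≢-true (proj₂ (f⊆ y e)))) y e (∧-true (r-bd y by) (≢-true y≢s))))
          (≤-reflexive (cong (_∸ 1) (count-minus s rs)))))

      -- A set as in `crowded` would be the whole boundary without `s`; but `t` is adjacent to `y₂`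
      -- and not to `y₁`, against uniformity. Also `y₁` yields `capped`, and `common` is void as the
      -- boundary is independent.
      partial : ∀ t → C t ≡ true → 2 ≤ count (λ y → bd y ∧ adj t y) → ∀ y → bd y ≡ true → adj t y ≡ false → HasGadget
      partial t Ct two y₁ by₁ ty₁ with s , es ← count-find (λ y → bd y ∧ adj t y) (≤-trans (s≤s z≤n) two)
        with y₂ , ey₂ , y₂≢s ← count-another (λ y → bd y ∧ adj t y) s two = r , s , t , record
        { adj-rs = rs ; adj-st = trans (adj-sym s t) ts ; t≢r = C-≢r Ct
        ; connected = connected s (all-good s rs) t (C-≢r Ct) t≢s
        ; crowded = λ x _ _ _ f f⊆ uniform h → ⊥-elim (true≢false (trans (uniform y₁ y₂
            (crowded-all s rs f (λ y e → proj₁ (f⊆ y e) , proj₁ (proj₂ (f⊆ y e))) h y₁ by₁ y₁≢s)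
            (crowded-all s rs f (λ y e → proj₁ (f⊆ y e) , proj₁ (proj₂ (f⊆ y e))) h y₂ (∧-true₁ ey₂) y₂≢s)) (∧-true₂ {bd y₂} ey₂)) ty₁)
        ; common = λ z rz sz _ → ⊥-elim (independent s z (∧-true₁ es) (r⊆bd z rz) sz)
        ; capped = λ z _ _ _ _ → ≤-pred (≤-trans (count-mono-< {g = minus s} (λ y e → ∧-true₁ (∧-true₁ e)) y₁
            (¬true⇒false (λ e → true≢false (∧-true₂ {minus s y₁ ∧ not (y₁ == t)} e) ty₁)) (∧-true (r-bd y₁ by₁) (≢-true y₁≢s)))
            (≤-reflexive (trans (cong (_∸ 1) (count-minus s rs)) (+-∸-assoc 1 2≤k)))) }
        where
        rs = r-bd s (∧-true₁ es)
        ts = ∧-true₂ {bd s} es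
        t≢s : t ≢ s
        t≢s = adj-≢ ts
        y₁≢s : y₁ ≢ s
        y₁≢s refl = true≢false ts ty₁

      module NoPartial (full : ∀ t → C t ≡ true → 2 ≤ count (λ y → bd y ∧ adj t y) → ∀ y → bd y ≡ true → adj t y ≡ true) where

        -- For `crowded`: a far `x`, or an `x` in `C` with two neighbours on the boundary, has the
        -- boundary as its whole neighbourhood, and the boundary is the neighbourhood of `r`. A
        -- boundary vertex `x` is excluded by independence.
        pendant : ∀ t s → C t ≡ true → bd s ≡ true → adj t s ≡ true → (∀ y → bd y ≡ true → adj t y ≡ true → y ≡ s) → HasGadget
        pendant t s Ct bs ts unique = r , s , t , record
          { adj-rs = rs ; adj-st = trans (adj-sym s t) ts ; t≢r = C-≢r Ct
          ; connected = connected s (all-good s rs) t (C-≢r Ct) (adj-≢ ts)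
          ; crowded = crowded
          ; common = λ z rz sz _ → ⊥-elim (independent s z bs (r⊆bd z rz) sz)
          ; capped = λ z rz z≢s _ tz → ⊥-elim (z≢s (unique z (r⊆bd z rz) tz)) }
          where
          rs = r-bd s bs
          crowded : ∀ x → x ≢ r → x ≢ s → x ≢ t → (f : V → Bool) →
            (∀ y → f y ≡ true → adj r y ≡ true × y ≢ s × y ≢ t × adj x y ≡ true) →
            (∀ y z → f y ≡ true → f z ≡ true → adj t y ≡ adj t z) → k ∸ 1 ≤ count f → ∀ v → adj x v ≡ true → adj r v ≡ true
          crowded x _ _ _ f f⊆ _ h v xv with trichotomy C x
          ... | inj₂ (inj₂ zx) = r-bd v (Z-bd x zx v xv)
          ... | inj₁ Cx = r-bd v (full⇒bd x (full x Cx (≤-trans (≤-trans (≤-trans (s≤s (s≤s z≤n)) (∸-monoˡ-≤ 1 k≥5)) h)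
                (count-mono (λ y e → let a , _ , _ , d = f⊆ y e in ∧-true (r⊆bd y a) d)))) v xv)
          ... | inj₂ (inj₁ bx) with y , e ← count-find f (≤-trans (≤-trans (s≤s z≤n) (∸-monoˡ-≤ 1 k≥5)) h) =
            ⊥-elim (independent x y bx (r⊆bd y (proj₁ (f⊆ y e))) (proj₂ (proj₂ (proj₂ (f⊆ y e)))))

        -- The neighbour `c` of `b₀` in `C` now has the boundary as its whole neighbourhood, so the
        -- connected set `C` is just `c`. All vertices off the boundary have the same neighbourhood.
        bipartite : (∀ t s → C t ≡ true → bd s ≡ true → adj t s ≡ true → ∃[ y ] (bd y ≡ true × adj t y ≡ true × y ≢ s)) → CompleteBipartite
        bipartite more = bd , separate , join
          where
          nb = boundary-near C bd-b₀
          c = proj₁ nb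
          Cc = proj₁ (proj₂ nb)
          c-full : ∀ y → bd y ≡ true → adj c y ≡ true
          c-full with y , by , cy , ne ← more c b₀ Cc bd-b₀ (proj₂ (proj₂ nb)) =
            full c Cc (count-two _ (∧-true by cy) (∧-true bd-b₀ (proj₂ (proj₂ nb))) ne)
          c-bd : ∀ y → adj c y ≡ true → bd y ≡ true
          c-bd = full⇒bd c c-full
          only-c : ∀ a → C a ≡ true → a ≡ c
          only-c a Ca = ==-sound (connecting (λ y → y == c) step c a Cc Ca (==-refl c))
            where
            step : ∀ a b → C a ≡ true → C b ≡ true → adj a b ≡ true → (a == c) ≡ true → (b == c) ≡ true
            step a b Ca Cb e h with refl ← ==-sound h = ⊥-elim (true≢false Cb (boundary-C C (c-bd b e)))
          outer-bd : ∀ a → bd a ≡ false → (∀ y → bd y ≡ true → adj a y ≡ true) × (∀ y → adj a y ≡ true → bd y ≡ true)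
          outer-bd a na with trichotomy C a
          ... | inj₁ Ca rewrite only-c a Ca = c-full , c-bd
          ... | inj₂ (inj₁ ba) = ⊥-elim (true≢false ba na)
          ... | inj₂ (inj₂ za) = (λ y by → trans (adj-sym a y) (joined y a by za)) , Z-bd a za
          separate : ∀ a b → adj a b ≡ true → bd a ≢ bd b
          separate a b e h with true⊎false (bd a)
          ... | inj₁ ba = independent a b ba (trans (sym h) ba) e
          ... | inj₂ na = true≢false (proj₂ (outer-bd a na) b e) (trans (sym h) na)
          join : ∀ a b → bd a ≢ bd b → adj a b ≡ true
          join a b h with true⊎false (bd a) | true⊎false (bd b)
          ... | inj₁ p | inj₁ q = ⊥-elim (h (trans p (sym q)))
          ... | inj₂ p | inj₂ q = ⊥-elim (h (trans p (sym q)))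
          ... | inj₂ p | inj₁ q = proj₁ (outer-bd a p) b q
          ... | inj₁ p | inj₂ q = trans (adj-sym a b) (proj₁ (outer-bd b q) a p)

        decide : HasGadget ⊎ CompleteBipartite
        decide with any? (λ t → any? (λ s → ((C t ∧ (bd s ∧ adj t s)) ∧ not (someᵇ (λ y → (bd y ∧ adj t y) ∧ not (y == s)))) ≟B true))
        ... | yes (t , s , e) = inj₁ (pendant t s (∧-true₁ e₁) (∧-true₁ (∧-true₂ {C t} e₁)) (∧-true₂ {bd s} (∧-true₂ {C t} e₁)) unique)
          where
          e₁ = ∧-true₁ e
          unique : ∀ y → bd y ≡ true → adj t y ≡ true → y ≡ s
          unique y by ty with y ≟F s
          ... | yes p = p
          ... | no ne = ⊥-elim (true≢false (someᵇ-complete _ y (∧-true (∧-true by ty) (≢-true ne))) (true-not (∧-true₂ {C t ∧ (bd s ∧ adj t s)} e)))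
        ... | no none′ = inj₂ (bipartite more)
          where
          more : ∀ t s → C t ≡ true → bd s ≡ true → adj t s ≡ true → ∃[ y ] (bd y ≡ true × adj t y ≡ true × y ≢ s)
          more t s Ct bs ts with true⊎false (someᵇ (λ y → (bd y ∧ adj t y) ∧ not (y == s)))
          ... | inj₁ h with y , g ← someᵇ-sound _ h = y , ∧-true₁ (∧-true₁ g) , ∧-true₂ {bd y} (∧-true₁ g) , true-≢ (∧-true₂ {bd y ∧ adj t y} g)
          ... | inj₂ h = ⊥-elim (none′ (t , s , ∧-true (∧-true Ct (∧-true bs ts)) (not-true h)))

      decide : HasGadget ⊎ CompleteBipartite
      decide with any? (λ t → any? (λ y → ((C t ∧ does (2 ≤? count (λ y → bd y ∧ adj t y))) ∧ (bd y ∧ not (adj t y))) ≟B true))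
      ... | yes (t , y , e) = inj₁ (partial t (∧-true₁ (∧-true₁ e)) (≡true-dec (2 ≤? _) (∧-true₂ {C t} (∧-true₁ e)))
            y (∧-true₁ e₂) (true-not (∧-true₂ {bd y} e₂)))
        where e₂ = ∧-true₂ {C t ∧ does (2 ≤? count (λ y → bd y ∧ adj t y))} e
      ... | no none′ = NoPartial.decide full
        where
        full : ∀ t → C t ≡ true → 2 ≤ count (λ y → bd y ∧ adj t y) → ∀ y → bd y ≡ true → adj t y ≡ true
        full t Ct two y by with true⊎false (adj t y)
        ... | inj₁ e = e
        ... | inj₂ e = ⊥-elim (none′ (t , y , ∧-true (∧-true Ct (dec-≡true (2 ≤? _) two)) (∧-true by (not-true e))))

    decide : HasGadget ⊎ CompleteBipartite
    decide with any? (λ s → any? (λ t → any? (λ u →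
        ((good s ∧ (adj r t ∧ adj s t)) ∧ ((adj r u ∧ not (u == s)) ∧ not (adj s u))) ≟B true)))
    ... | yes (s , t , u , e) = inj₁ (r , s , t , triangle s t u (∧-true₁ e₁) (∧-true₁ (∧-true₂ {good s} e₁)) (∧-true₂ {adj r t} (∧-true₂ {good s} e₁))
          (∧-true₁ (∧-true₁ e₂)) (true-≢ (∧-true₂ {adj r u} (∧-true₁ e₂))) (true-not (∧-true₂ {adj r u ∧ not (u == s)} e₂)))
      where
      e₁ = ∧-true₁ e
      e₂ = ∧-true₂ {good s ∧ (adj r t ∧ adj s t)} e
    ... | no none′ = NoTriangle.decide none
      where
      none : ∀ s t u → good s ≡ true → adj r t ≡ true → adj s t ≡ true → adj r u ≡ true → u ≢ s → adj s u ≡ true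
      none s t u gs rt st ru ne with true⊎false (adj s u)
      ... | inj₁ h = h
      ... | inj₂ h = ⊥-elim (none′ (s , t , u , ∧-true (∧-true gs (∧-true rt st)) (∧-true (∧-true ru (≢-true ne)) (not-true h))))

  choose : (o : V) → Connecting (λ _ → true) → HasGadget ⊎ CompleteBipartite ⊎ Complete
  choose o whole with any? (λ z → far (λ y → y == o) z ≟B true)
  ... | no none = inj₂ (inj₂ (dominating⇒complete o dom))
    where
    dom : ∀ z → z ≢ o → adj o z ≡ true
    dom z z≢o with true⊎false (near (λ y → y == o) z)
    ... | inj₂ h = ⊥-elim (none (z , ∧-true (≢-true z≢o) (not-true h)))
    ... | inj₁ h with c , g ← someᵇ-sound _ h with refl ← ==-sound (∧-true₁ {c == o} g) = ∧-true₂ {c == o} g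
  ... | yes (r , fr) with FromCore.decide o whole (grow _ o (λ y → y == o) (==-refl o) single r fr ≤-refl)
    where
    single : Connecting (λ y → y == o)
    single W step a b ea eb Wa with refl ← ==-sound ea with refl ← ==-sound eb = Wa
  ... | inj₁ g = inj₁ g
  ... | inj₂ b = inj₂ (inj₁ b)

-- Complete and complete bipartite graphs

m≢2+m : ∀ (m : ℕ) → m ≢ suc (suc m)
m≢2+m zero ()
m≢2+m (suc m) e = m≢2+m m (suc-injective e)

module Ranking {n : ℕ} (Γ : Context n) where
  open Labellings Γ
  open Distinguish Γ
  open Choose Γ using (Complete)

  module _ (M c : ℕ) (3≤c : 3 ≤ c) (c<M : 3 + c ≤ M) (rank : V → ℕ) (rank-injective : ∀ {u w} → rank u ≡ rank w → u ≡ w)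
    (rank-bound : ∀ v → rank v < M) (rank-onto : ∀ j → j < M → ∃[ v ] rank v ≡ j)
    (path : ∀ u w → rank w ≡ suc (rank u) → adj u w ≡ true) (chord : ∀ u w → rank u ≡ 1 → rank w ≡ c → adj u w ≡ true) where

    -- The path 0 – 1 – … – (M ∸ 1) with the chord joining 1 and c; the tail beyond c is longer than
    -- the one before 1.
    Link : ℕ → ℕ → Set
    Link i j = (j ≡ suc i ⊎ i ≡ suc j) ⊎ ((i ≡ 1 × j ≡ c) ⊎ (i ≡ c × j ≡ 1))

    private
      link? : ∀ i j → Dec (Link i j)
      link? i j = ((j ≟ suc i) ⊎-dec (i ≟ suc j)) ⊎-dec (((i ≟ 1) ×-dec (j ≟ c)) ⊎-dec ((i ≟ c) ×-dec (j ≟ 1)))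

      link-sym : ∀ {i j} → Link i j → Link j i
      link-sym (inj₁ (inj₁ e)) = inj₁ (inj₂ e)
      link-sym (inj₁ (inj₂ e)) = inj₁ (inj₁ e)
      link-sym (inj₂ (inj₁ (a , b))) = inj₂ (inj₂ (b , a))
      link-sym (inj₂ (inj₂ (a , b))) = inj₂ (inj₁ (b , a))

      relink : ∀ {i i′ j} → i ≡ i′ → Link i j → Link i′ j
      relink refl l = l

      link-adj : ∀ u w → Link (rank u) (rank w) → adj u w ≡ true
      link-adj u w (inj₁ (inj₁ e)) = path u w e
      link-adj u w (inj₁ (inj₂ e)) = trans (adj-sym u w) (path w u e)
      link-adj u w (inj₂ (inj₁ (a , b))) = chord u w a b
      link-adj u w (inj₂ (inj₂ (a , b))) = trans (adj-sym u w) (chord w u b a)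

      plain-link : ∀ {i j} → i ≢ 1 → i ≢ c → Link i j → j ≡ suc i ⊎ i ≡ suc j
      plain-link _ _ (inj₁ e) = e
      plain-link a _ (inj₂ (inj₁ (e , _))) = ⊥-elim (a e)
      plain-link _ b (inj₂ (inj₂ (e , _))) = ⊥-elim (b e)

      two-places : ∀ {i j₁ j₂ j₃} → (j₁ ≡ suc i ⊎ i ≡ suc j₁) → (j₂ ≡ suc i ⊎ i ≡ suc j₂) → (j₃ ≡ suc i ⊎ i ≡ suc j₃) →
        j₁ ≢ j₂ → j₂ ≢ j₃ → j₁ ≢ j₃ → ⊥
      two-places (inj₁ a) (inj₁ b) _ p q s = p (trans a (sym b))
      two-places (inj₁ a) (inj₂ b) (inj₁ d) p q s = s (trans a (sym d))
      two-places (inj₁ a) (inj₂ b) (inj₂ d) p q s = q (suc-injective (trans (sym b) d))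
      two-places (inj₂ a) (inj₁ b) (inj₁ d) p q s = q (trans b (sym d))
      two-places (inj₂ a) (inj₁ b) (inj₂ d) p q s = s (suc-injective (trans (sym a) d))
      two-places (inj₂ a) (inj₂ b) _ p q s = p (suc-injective (trans (sym a) b))

    ranked-lab : Lab
    ranked-lab u w = does (link? (rank u) (rank w))

    ranked-distinguishing : DistinguishingLab
    ranked-distinguishing = ranked-lab ,
      (λ a b → bool-ext (λ e → dec-≡true (link? _ _) (link-sym (≡true-dec (link? (rank a) (rank b)) e)))
                        (λ e → dec-≡true (link? _ _) (link-sym (≡true-dec (link? (rank b) (rank a)) e)))) ,
      λ φ pres v → Fix.fixes φ pres (rank v) v refl
      where
      at-rank : ∀ j → j < M → V
      at-rank j h = proj₁ (rank-onto j h)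
      rank-at : ∀ j (h : j < M) → rank (at-rank j h) ≡ j
      rank-at j h = proj₂ (rank-onto j h)

      module Fix (φ : Aut) (pres : ∀ a b → adj a b ≡ true → ranked-lab (at φ a) (at φ b) ≡ ranked-lab a b) where
        forth : ∀ u w → Link (rank u) (rank w) → Link (rank (at φ u)) (rank (at φ w))
        forth u w l = ≡true-dec (link? _ _) (trans (pres u w (link-adj u w l)) (dec-≡true (link? _ _) l))

        back : ∀ u w → Link (rank (at φ u)) (rank w) → ∃[ w′ ] (at φ w′ ≡ w × Link (rank u) (rank w′))
        back u w l = w′ , e , ≡true-dec (link? _ _) (trans (sym (pres u w′ (trans (sym (adj-perm φ u w′)) (link-adj _ _ l′)))) (dec-≡true (link? _ _) l′))
          where
          w′ = at (Aut-inv φ) w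
          e : at φ w′ ≡ w
          e = inverseʳ (perm φ)
          l′ : Link (rank (at φ u)) (rank (at φ w′))
          l′ = subst (λ x → Link (rank (at φ u)) (rank x)) (sym e) l

        distinct : ∀ {u w} → rank u ≢ rank w → rank (at φ u) ≢ rank (at φ w)
        distinct ne e = ne (cong rank (aut-injective φ (rank-injective e)))

        2≤M : 2 ≤ M
        2≤M = ≤-trans (s≤s (s≤s z≤n)) c<M
        c<M′ : c < M
        c<M′ = ≤-trans (s≤s (n≤1+n c)) (≤-trans (n≤1+n _) c<M)
        sc<M : suc c < M
        sc<M = ≤-trans (n≤1+n _) c<M
        1<c : 1 < c
        1<c = ≤-trans (s≤s (s≤s z≤n)) 3≤c
        2<M : 2 < M
        2<M = ≤-trans 3≤c (≤-trans (n≤1+n c) c<M′)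

        u₀ u₁ u₂ u-c : V
        u₀ = at-rank 0 (≤-trans (s≤s z≤n) 2≤M)
        u₁ = at-rank 1 2≤M
        u₂ = at-rank 2 2<M
        u-c = at-rank c c<M′
        r₀ : rank u₀ ≡ 0
        r₀ = rank-at 0 _
        r₁ : rank u₁ ≡ 1
        r₁ = rank-at 1 _
        r₂ : rank u₂ ≡ 2
        r₂ = rank-at 2 _
        r-c : rank u-c ≡ c
        r-c = rank-at c _

        0-link : ∀ {j} → Link 0 j → j ≡ 1
        0-link (inj₁ (inj₁ e)) = e
        0-link (inj₂ (inj₂ (e , _))) = ⊥-elim (<⇒≢ (≤-trans (s≤s z≤n) 1<c) e)

        -- Rank 0 has one link, and every rank other than 0 and the last has at least two. If 0 went
        -- to the last rank, then rank 1, with three links, would go to the last but one, which lies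
        -- beyond `c` and has two.
        fixes-0 : rank (at φ u₀) ≡ 0
        fixes-0 with rank (at φ u₀) in e
        ... | zero = refl
        ... | suc i with suc (suc i) <? M
        ... | yes h with w , ew , lw ← back u₀ (at-rank i (≤-trans (n≤1+n _) (≤-trans (n≤1+n _) h)))
                         (subst₂ Link (sym e) (sym (rank-at i _)) (inj₁ (inj₂ refl)))
                    | w′ , ew′ , lw′ ← back u₀ (at-rank (suc (suc i)) h) (subst₂ Link (sym e) (sym (rank-at _ _)) (inj₁ (inj₁ refl))) =
            ⊥-elim (m≢2+m i (trans (sym (rank-at i _)) (trans (cong rank (trans (sym ew) (trans (cong (at φ) (rank-injective
              (trans (0-link (relink r₀ lw)) (sym (0-link (relink r₀ lw′)))))) ew′))) (rank-at _ _))))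
        ... | no h = ⊥-elim (two-places (places u₀ (inj₁ (inj₂ (trans r₁ (cong suc (sym r₀))))))
                (places u₂ (inj₁ (inj₁ (trans r₂ (cong suc (sym r₁)))))) (places u-c (inj₂ (inj₁ (r₁ , r-c))))
                (distinct λ p → 0≢1+n (trans (sym r₀) (trans p r₂)))
                (distinct λ p → <⇒≢ 3≤c (trans (sym r₂) (trans p r-c)))
                (distinct λ p → <⇒≢ (≤-trans (s≤s z≤n) 1<c) (trans (sym r₀) (trans p r-c))))
          where
          M≡ : M ≡ suc (suc i)
          M≡ = ≤-antisym (≮⇒≥ h) (subst (_< M) e (rank-bound (at φ u₀)))
          c≤i : suc c ≤ i
          c≤i = ≤-pred (≤-pred (subst (3 + c ≤_) M≡ c<M))
          si≢1 : suc i ≢ 1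
          si≢1 p = <⇒≢ (≤-trans (s≤s z≤n) c≤i) (sym (suc-injective p))
          si≢c : suc i ≢ c
          si≢c p = <⇒≢ (≤-trans c≤i (n≤1+n i)) (sym p)
          top : rank (at φ u₁) ≡ i
          top with plain-link si≢1 si≢c (relink e (forth u₀ u₁ (inj₁ (inj₁ (trans r₁ (cong suc (sym r₀)))))))
          ... | inj₂ p = suc-injective (sym p)
          ... | inj₁ p = ⊥-elim (h (subst (_< M) p (rank-bound _)))
          places : ∀ w → Link (rank u₁) (rank w) → rank (at φ w) ≡ suc i ⊎ i ≡ suc (rank (at φ w))
          places w l = plain-link (λ p → <⇒≢ (≤-trans 1<c (≤-trans (n≤1+n c) c≤i)) (sym p)) (λ p → <⇒≢ c≤i (sym p))
            (relink top (forth u₁ w l))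

        φ₀ : at φ u₀ ≡ u₀
        φ₀ = rank-injective (trans fixes-0 (sym r₀))

        φ₁ : at φ u₁ ≡ u₁
        φ₁ = rank-injective (trans (0-link (relink fixes-0 (forth u₀ u₁ (inj₁ (inj₁ (trans r₁ (cong suc (sym r₀)))))))) (sym r₁))

        -- The links of rank 1 lead to 0, which is taken, to 2 and to `c`. But `c` has three links,
        -- to `c - 1`, `c + 1` and 1, and rank 2 only two, because `c` is at least 3.
        fixes-2 : rank (at φ u₂) ≡ 2
        fixes-2 with subst (λ x → Link x (rank (at φ u₂))) (trans (cong rank φ₁) r₁) (forth u₁ u₂ (inj₁ (inj₁ (trans r₂ (cong suc (sym r₁))))))
        ... | inj₁ (inj₁ e) = e
        ... | inj₁ (inj₂ e) = ⊥-elim (distinct (λ p → 0≢1+n (sym (trans (sym r₂) (trans p r₀)))) (trans (sym (suc-injective e)) (sym fixes-0)))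
        ... | inj₂ (inj₂ (e , _)) = ⊥-elim (<⇒≢ 1<c e)
        ... | inj₂ (inj₁ (_ , e)) = ⊥-elim (crossing c refl)
          where
          from : ∀ j (h : j < M) → Link c j → ∃[ w ] (rank (at φ w) ≡ j × (rank w ≡ 3 ⊎ 2 ≡ suc (rank w)))
          from j h l with w , p , l′ ← back u₂ (at-rank j h) (subst₂ Link (sym e) (sym (rank-at j h)) l) =
            w , trans (cong rank p) (rank-at j h) , plain-link (λ ()) (<⇒≢ 3≤c) (relink r₂ l′)
          crossing : ∀ d → d ≡ c → ⊥
          crossing zero d≡ = <⇒≢ (≤-trans (s≤s z≤n) 1<c) d≡
          crossing (suc d) d≡
            with w₁ , p₁ , q₁ ← from d (≤-trans (≤-trans (n≤1+n _) (≤-reflexive (cong suc d≡))) c<M′) (inj₁ (inj₂ (sym d≡)))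
               | w₂ , p₂ , q₂ ← from (suc c) sc<M (inj₁ (inj₁ refl))
               | w₃ , p₃ , q₃ ← from 1 2≤M (inj₂ (inj₂ (refl , refl))) =
            two-places q₁ q₂ q₃
              (differ (λ x → <⇒≢ (s≤s (≤-trans (n≤1+n d) (≤-reflexive d≡))) (trans (sym p₁) (trans x p₂))))
              (differ (λ x → <⇒≢ (≤-trans 1<c (n≤1+n c)) (sym (trans (sym p₂) (trans x p₃)))))
              (differ (λ x → <⇒≢ (≤-pred (subst (3 ≤_) (sym d≡) 3≤c)) (sym (trans (sym p₁) (trans x p₃)))))
            where
            differ : ∀ {u w} → rank (at φ u) ≢ rank (at φ w) → rank u ≢ rank w
            differ ne x = ne (cong (rank ∘ at φ) (rank-injective x))

        φ₂ : at φ u₂ ≡ u₂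
        φ₂ = rank-injective (trans fixes-2 (sym r₂))

        below : ∀ i → ∀ v → rank v ≤ suc (suc i) → at φ v ≡ v
        below zero v h = small (rank v) refl h
          where
          small : ∀ j → rank v ≡ j → j ≤ 2 → at φ v ≡ v
          small 0 e _ = subst (λ x → at φ x ≡ x) (rank-injective (trans r₀ (sym e))) φ₀
          small 1 e _ = subst (λ x → at φ x ≡ x) (rank-injective (trans r₁ (sym e))) φ₁
          small 2 e _ = subst (λ x → at φ x ≡ x) (rank-injective (trans r₂ (sym e))) φ₂
          small (suc (suc (suc _))) e (s≤s (s≤s ()))
        below (suc i) v h with m≤n⇒m<n∨m≡n h
        ... | inj₁ h′ = below i v (≤-pred h′)
        ... | inj₂ e = rank-injective (trans next (sym e))
          where
          u = at-rank (suc (suc i)) (≤-trans (≤-reflexive (sym e)) (<⇒≤ (rank-bound v)))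
          ru : rank u ≡ suc (suc i)
          ru = rank-at _ _
          φu : at φ u ≡ u
          φu = below i u (≤-reflexive ru)
          old : ∀ {w} → w ≡ at φ v → rank w ≤ suc (suc i) → ⊥
          old {w} p q with refl ← aut-injective φ (trans (below i w q) p) = 1+n≰n (≤-trans (≤-reflexive (sym e)) q)
          next : rank (at φ v) ≡ suc (suc (suc i))
          next with subst (λ x → Link x (rank (at φ v))) (trans (cong rank φu) ru) (forth u v (inj₁ (inj₁ (trans e (cong suc (sym ru))))))
          ... | inj₁ (inj₁ p) = p
          ... | inj₁ (inj₂ p) = ⊥-elim (old refl (≤-trans (n≤1+n _) (≤-reflexive (sym p))))
          ... | inj₂ (inj₂ (_ , p)) = ⊥-elim (old refl (≤-trans (≤-reflexive p) (s≤s z≤n)))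

        fixes : ∀ j v → rank v ≡ j → at φ v ≡ v
        fixes j v e = below j v (≤-trans (≤-reflexive e) (≤-trans (n≤1+n j) (n≤1+n _)))

  k<n : V → k < n
  k<n o = subst₂ _<_ (regular o) (trans (count-Σ _) (trans (Σ-const n 1) (*-identityʳ n)))
    (count-mono-< {g = λ _ → true} (λ _ _ → refl) o (adj-irrefl o) refl)

  complete-distinguishing : V → Complete → DistinguishingLab
  -- The chord closes a triangle, and six vertices, present since `k ≥ 5`, make the tail longer than
  -- the other end.
  complete-distinguishing o complete = ranked-distinguishing n 3 ≤-refl (≤-trans (s≤s k≥5) (k<n o)) toℕ toℕ-injective toℕ<n
    (λ j h → fromℕ< h , toℕ-fromℕ< h)
    (λ u w e → complete u w (λ { refl → 1+n≢n (sym e) }))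
    (λ u w e f → complete u w (λ { refl → 0≢1+n (suc-injective (trans (sym e) f)) }))

idx : ∀ {n} → (Fin n → Bool) → Fin n → ℕ
idx f zero = 0
idx f (suc v) = ⟦ f zero ⟧ + idx (f ∘ suc) v

idx-< : ∀ {n} (f : Fin n → Bool) v → f v ≡ true → idx f v < count f
idx-< f zero e = count-pos zero e
idx-< f (suc v) e = subst (idx f (suc v) <_) (sym (count-suc f)) (+-monoʳ-< ⟦ f zero ⟧ (idx-< (f ∘ suc) v e))

idx-injective : ∀ {n} (f : Fin n → Bool) v w → f v ≡ true → f w ≡ true → idx f v ≡ idx f w → v ≡ w
idx-injective f zero zero _ _ _ = refl
idx-injective f zero (suc w) e _ h rewrite e = ⊥-elim (0≢1+n h)
idx-injective f (suc v) zero _ e h rewrite e = ⊥-elim (0≢1+n (sym h))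
idx-injective f (suc v) (suc w) e e′ h = cong suc (idx-injective (f ∘ suc) v w e e′ (+-cancelˡ-≡ ⟦ f zero ⟧ _ _ h))

idx-onto : ∀ {n} (f : Fin n → Bool) i → i < count f → ∃[ v ] (f v ≡ true × idx f v ≡ i)
idx-onto {zero} f i h = ⊥-elim (1+n≰n (≤-trans (s≤s z≤n) (subst (i <_) (count-none {f = f} (λ ())) h)))
idx-onto {suc n} f i h with true⊎false (f zero)
... | inj₂ e with v , p , q ← idx-onto (f ∘ suc) i (subst (i <_) (trans (count-suc f) (cong (λ b → ⟦ b ⟧ + count (f ∘ suc)) e)) h) =
  suc v , p , trans (cong (λ b → ⟦ b ⟧ + idx (f ∘ suc) v) e) q
idx-onto {suc n} f zero h | inj₁ e = zero , e , refl
idx-onto {suc n} f (suc i) h | inj₁ e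
  with v , p , q ← idx-onto (f ∘ suc) i (≤-pred (subst (suc i <_) (trans (count-suc f) (cong (λ b → ⟦ b ⟧ + count (f ∘ suc)) e)) h)) =
  suc v , p , trans (cong (λ b → ⟦ b ⟧ + idx (f ∘ suc) v) e) (cong suc q)

odd≢even : ∀ a b → suc (a + a) ≢ b + b
odd≢even a zero ()
odd≢even zero (suc b) e = 0≢1+n (suc-injective (trans e (cong suc (+-suc b b))))
odd≢even (suc a) (suc b) e = odd≢even a b (suc-injective (suc-injective (trans (cong suc (cong suc (sym (+-suc a a)))) (trans e (cong suc (+-suc b b))))))

halves : ∀ j → ∃[ i ] (j ≡ i + i ⊎ j ≡ suc (i + i))
halves zero = 0 , inj₁ refl
halves (suc j) with halves j
... | i , inj₁ e = i , inj₂ (cong suc e)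
... | i , inj₂ e = suc i , inj₁ (cong suc (trans e (sym (+-suc i i))))

double-< : ∀ i k → i + i < k + k → i < k
double-< i k h with ≤-<-connex k i
... | inj₂ l = l
... | inj₁ l = ⊥-elim (<-irrefl refl (≤-trans h (+-mono-≤ l l)))

module Bipartite {n : ℕ} (Γ : Context n) where
  open Labellings Γ
  open Distinguish Γ
  open Choose Γ using (CompleteBipartite)
  open Ranking Γ

  bipartite-distinguishing : V → CompleteBipartite → DistinguishingLab
  bipartite-distinguishing o (side , separate , join) =
    -- Rank 3 would be on the same side as rank 1, so the chord goes to rank 4.
    ranked-distinguishing (k + k) 4 (s≤s (s≤s (s≤s z≤n))) (≤-trans (s≤s (s≤s (s≤s (s≤s (s≤s (s≤s (s≤s z≤n))))))) (+-mono-≤ k≥5 k≥5))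
      rank rank-injective rank-bound rank-onto path chord
    where
    part : Bool → V → Bool
    part b v = side v ⇔ᵇ b

    flip-side : ∀ {b v} → side v ≡ not b → (λ w → adj v w) ≗ part b
    flip-side {b} {v} e w = bool-ext
      (λ h → ⇔ᵇ-refl (opposite (side v) (side w) b e (separate v w h)))
      (λ h → join v w (λ p → not-fixed (trans (sym (trans (sym p) e)) (⇔ᵇ-sound {side w} {b} h))))
      where
      opposite : ∀ x y b → x ≡ not b → x ≢ y → y ≡ b
      opposite x true true _ _ = refl
      opposite x false false _ _ = refl
      opposite x true false e h = ⊥-elim (h e)
      opposite x false true e h = ⊥-elim (h e)
      not-fixed : ∀ {b} → not b ≡ b → ⊥
      not-fixed {true} ()
      not-fixed {false} ()

    part-size-from : ∀ b v → side v ≡ not b → count (part b) ≡ k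
    part-size-from b v e = trans (sym (count-cong (flip-side e))) (regular v)

    neighbour : ∃[ w ] adj o w ≡ true
    neighbour = count-find (adj o) (≤-trans (s≤s z≤n) (≤-trans k≥5 (≤-reflexive (sym (regular o)))))

    part-size : ∀ b → count (part b) ≡ k
    part-size b with true⊎false (side o ⇔ᵇ b)
    ... | inj₂ e = part-size-from b o (lemma (side o) b e)
      where
      lemma : ∀ x b → (x ⇔ᵇ b) ≡ false → x ≡ not b
      lemma true false _ = refl
      lemma false true _ = refl
    ... | inj₁ e = part-size-from b (proj₁ neighbour) (lemma (side o) _ b (⇔ᵇ-sound e) (separate o _ (proj₂ neighbour)))
      where
      lemma : ∀ x y b → x ≡ b → x ≢ y → y ≡ not b
      lemma true true b e h = ⊥-elim (h refl)
      lemma false false b e h = ⊥-elim (h refl)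
      lemma true false true _ _ = refl
      lemma false true false _ _ = refl

    index : V → ℕ
    index v = idx (part (side v)) v

    -- One side receives the even ranks and the other the odd ones, so consecutive ranks are
    -- adjacent.
    rank : V → ℕ
    rank v = ⟦ side v ⟧ + (index v + index v)

    own : ∀ v → part (side v) v ≡ true
    own v = ⇔ᵇ-refl {side v} refl

    index-bound : ∀ v → index v < k
    index-bound v = subst (index v <_) (part-size (side v)) (idx-< _ v (own v))

    rank-bound : ∀ v → rank v < k + k
    rank-bound v = ≤-trans (s≤s (+-monoˡ-≤ (index v + index v) (⟦⟧≤1 (side v))))
      (≤-trans (≤-reflexive (cong suc (sym (+-suc (index v) (index v))))) (+-mono-≤ (index-bound v) (index-bound v)))

    same-side : ∀ x y a b → ⟦ x ⟧ + (a + a) ≡ ⟦ y ⟧ + (b + b) → x ≡ y × a ≡ b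
    same-side true true a b e = refl , double-injective a b (suc-injective e)
    same-side false false a b e = refl , double-injective a b e
    same-side true false a b e = ⊥-elim (odd≢even a b e)
    same-side false true a b e = ⊥-elim (odd≢even b a (sym e))

    opposite-sides : ∀ x y a b → ⟦ y ⟧ + (b + b) ≡ suc (⟦ x ⟧ + (a + a)) → x ≢ y
    opposite-sides true .true a b e refl = odd≢even a b (suc-injective (sym e))
    opposite-sides false .false a b e refl = odd≢even a b (sym e)

    rank-injective : ∀ {u w} → rank u ≡ rank w → u ≡ w
    rank-injective {u} {w} e with same-side (side u) (side w) (index u) (index w) e
    ... | p , q = idx-injective (part (side u)) u w (own u) (⇔ᵇ-refl (sym p)) (trans q (cong (λ b → idx (part b) w) (sym p)))

    placed : ∀ b i → i < k → ∃[ v ] rank v ≡ ⟦ b ⟧ + (i + i)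
    placed b i h with v , e , f ← idx-onto (part b) i (subst (i <_) (sym (part-size b)) h) =
      v , cong₂ (λ c j → ⟦ c ⟧ + (j + j)) (⇔ᵇ-sound {side v} {b} e) (trans (cong (λ c → idx (part c) v) (⇔ᵇ-sound {side v} {b} e)) f)

    rank-onto : ∀ j → j < k + k → ∃[ v ] rank v ≡ j
    rank-onto j h with halves j
    ... | i , inj₁ e with v , f ← placed false i (double-< i k (subst (_< k + k) e h)) = v , trans f (sym e)
    ... | i , inj₂ e with v , f ← placed true i (double-< i k (≤-trans (n≤1+n _) (subst (_< k + k) e h))) = v , trans f (sym e)

    path : ∀ u w → rank w ≡ suc (rank u) → adj u w ≡ true
    path u w e = join u w (opposite-sides (side u) (side w) (index u) (index w) e)

    chord : ∀ u w → rank u ≡ 1 → rank w ≡ 4 → adj u w ≡ true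
    chord u w e f = join u w (λ p → parity (side u) (side w) p (index u) (index w) e f)
      where
      parity : ∀ x y → x ≡ y → ∀ a b → ⟦ x ⟧ + (a + a) ≡ 1 → ⟦ y ⟧ + (b + b) ≡ 4 → ⊥
      parity true .true refl a b e f = odd≢even b 2 f
      parity false .false refl a b e f = odd≢even 0 a (sym e)

-- The distinguishing index

T⇒≡ : ∀ {b} → T b → b ≡ true
T⇒≡ = Equivalence.to T-≡

≡⇒T : ∀ {b} → b ≡ true → T b
≡⇒T = Equivalence.from T-≡

card-count : ∀ {n} (f : Fin n → Bool) → ∣ tabulate f ∣ ≡ count f
card-count {zero} f = sym (trans (count-Σ f) (Σ-zero _))
card-count {suc n} f rewrite count-Σ f | Σ-suc (λ i → ⟦ f i ⟧) with f zero
... | true = cong suc (trans (card-count (f ∘ suc)) (count-Σ (f ∘ suc)))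
... | false = trans (card-count (f ∘ suc)) (count-Σ (f ∘ suc))

any-vec? : ∀ {m n} {Q : Vec (Fin m) n → Set} → (∀ v → Dec (Q v)) → Dec (∃[ v ] Q v)
any-vec? {n = zero} Q? = map′ (λ q → [] , q) (λ { ([] , q) → q }) (Q? [])
any-vec? {n = suc n} Q? = map′ (λ { (x , v , q) → x ∷ v , q }) (λ { (x ∷ v , q) → x , v , q })
  (any? (λ x → any-vec? (λ v → Q? (x ∷ v))))

module _ {n k : ℕ} (k≥5 : k ≥ 5) (G : Graph n) (conn : Connected G) (reg : Regular G k) where
  open Graph G

  context : Context n
  context = record
    { adj = adj
    ; adj-sym = λ a b → bool-ext (T⇒≡ ∘ symmetric ∘ ≡⇒T) (T⇒≡ ∘ symmetric ∘ ≡⇒T)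
    ; adj-irrefl = λ a → ¬true⇒false (irreflexive refl ∘ ≡⇒T)
    ; k = k
    ; k≥5 = k≥5
    ; regular = λ v → trans (sym (card-count (adj v))) (reg v) }

  open Labellings context using (Aut; at; adj-perm)
  open Distinguish context
  open Choose context
  open Ranking context using (complete-distinguishing)
  open Bipartite context using (bipartite-distinguishing)

  private
    o : Fin n
    o = proj₁ conn

    whole : Connecting (λ _ → true)
    whole W step a b _ _ = along (proj₂ conn a b)
      where
      along : ∀ {a b} → Star Adj a b → W a ≡ true → W b ≡ true
      along ε Wa = Wa
      along (e ◅ es) Wa = along es (step _ _ refl refl (T⇒≡ e) Wa)

  distinguishing : DistinguishingLab
  distinguishing with choose o whole
  ... | inj₁ (r , s , t , g) = gadget-distinguishing g
  ... | inj₂ (inj₁ b) = bipartite-distinguishing o b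
  ... | inj₂ (inj₂ c) = complete-distinguishing o c

  to-aut : Automorphism G → Aut
  to-aut φ = record { perm = perm ; adj-perm = λ a b → bool-ext
      (λ e → T⇒≡ (Equivalence.from preserves (≡⇒T e))) (λ e → T⇒≡ (Equivalence.to preserves (≡⇒T e))) }
    where open Automorphism φ

  two-labels : HasDistinguishingLabelling G 2
  two-labels = labelling , λ φ pres → proj₂ (proj₂ distinguishing) (to-aut φ)
      (λ a b e → colour-injective (pres (≡⇒T e)))
    where
    lam = proj₁ distinguishing
    colour : Bool → Fin 2
    colour b = if b then suc zero else zero
    colour-injective : ∀ {a b} → colour a ≡ colour b → a ≡ b
    colour-injective {true} {true} _ = refl
    colour-injective {false} {false} _ = refl
    labelling : EdgeLabelling G 2
    labelling = record { label = λ {u} {w} _ → colour (lam u w) ; label-sym = λ _ _ → cong colour (proj₁ (proj₂ distinguishing) _ _) }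

  not-zero : ¬ HasDistinguishingLabelling G 0
  not-zero (c , _) with w , e ← count-find (adj o) (≤-trans (s≤s z≤n) (≤-trans k≥5 (≤-reflexive (sym (Context.regular context o)))))
    with () ← EdgeLabelling.label c (≡⇒T e)

  -- A nontrivial automorphism and its inverse as finite tables, so that existence can be decided by
  -- search.
  Moves : Vec (Fin n) n → Vec (Fin n) n → Set
  Moves f g = ((∀ i → lookup f (lookup g i) ≡ i) × (∀ i → lookup g (lookup f i) ≡ i)) ×
    ((∀ a b → adj (lookup f a) (lookup f b) ≡ adj a b) × (∃[ i ] lookup f i ≢ i))

  moves? : Dec (∃[ f ] ∃[ g ] Moves f g)
  moves? = any-vec? (λ f → any-vec? (λ g → (all? (λ i → _ ≟F i) ×-dec all? (λ i → _ ≟F i)) ×-dec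
    (all? (λ a → all? (λ b → _ ≟B adj a b)) ×-dec any? (λ i → ¬? (_ ≟F i)))))

  moving : ∀ {f g} → Moves f g → ¬ HasDistinguishingLabelling G 1
  moving {f} {g} ((fg , gf) , (f-adj , i , fi≢i)) (c , d) = fi≢i (d φ (λ e → one _ _) i)
    where
    φ : Automorphism G
    φ = record
      { perm = permutation (lookup f) (lookup g) fg gf
      ; preserves = mk⇔ (λ e → ≡⇒T (trans (f-adj _ _) (T⇒≡ e))) (λ e → ≡⇒T (trans (sym (f-adj _ _)) (T⇒≡ e))) }
    one : (a b : Fin 1) → a ≡ b
    one zero zero = refl

  one-label : ¬ (∃[ f ] ∃[ g ] Moves f g) → HasDistinguishingLabelling G 1
  one-label none = record { label = λ _ → zero ; label-sym = λ _ _ → refl } , fixes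
    where
    fixes : ∀ φ → _ → ∀ i → Automorphism.perm φ ⟨$⟩ʳ i ≡ i
    fixes φ _ i with (Automorphism.perm φ ⟨$⟩ʳ i) ≟F i
    ... | yes e = e
    ... | no ne = ⊥-elim (none (tabulate f , tabulate g ,
        ((λ j → trans (lookup∘tabulate f _) (trans (cong f (lookup∘tabulate g j)) (inverseʳ π))) ,
         (λ j → trans (lookup∘tabulate g _) (trans (cong g (lookup∘tabulate f j)) (inverseˡ π)))) ,
        (λ a b → trans (cong₂ adj (lookup∘tabulate f a) (lookup∘tabulate f b)) (adj-perm (to-aut φ) a b)) ,
        i , λ e → ne (trans (sym (lookup∘tabulate f i)) e)))
      where
      π = Automorphism.perm φ
      f g : Fin n → Fin n
      f j = π ⟨$⟩ʳ j
      g j = π ⟨$⟩ˡ j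

  -- The exact index has to be named: 0 fails because there is an edge, and 1 works exactly if the
  -- identity is the only automorphism.
  index≤2 : ∃[ d ] (IsDistinguishingIndex G d × d ≤ 2)
  index≤2 with moves?
  ... | no none = 1 , (one-label none , λ { zero h → ⊥-elim (not-zero h) ; (suc d) _ → s≤s z≤n }) , s≤s z≤n
  ... | yes (f , g , h) = 2 , (two-labels , λ { zero l → ⊥-elim (not-zero l) ; 1 l → ⊥-elim (moving {f} {g} h l)
                                              ; (suc (suc d)) _ → s≤s (s≤s z≤n) }) , ≤-refl

theorem3p2 : ∀ (n k : ℕ) → k ≥ 5 → (G : Graph n) → Connected G → Regular G k →
    ∃[ d ] (IsDistinguishingIndex G d × d ≤ 2)
theorem3p2 n k k≥5 G conn reg = index≤2 k≥5 G conn reg
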